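{- For a word $w=x^{a_1}y\,x^{a_2}y\cdots x^{a_L}y$ in noncommuting letters $x,y$ (with $a_1\ge1$, $a_2,\dots,a_L\ge 0$) and $\lambda\in\mathbb{C}\setminus\mathbb{Z}_{\ge1}$, set $$F(w;\lambda)=\sum_{n_1>\dots>n_L>0}\ \prod_{r=1}^{L}\frac{1}{n_r^{a_r}(n_r-\lambda)}.$$ For integers $k_1,l_1,\dots,k_m,l_m\ge 0$ with $k_1,l_m\ge1$ set $f(\{k_i,l_i\}_{i=1}^m;\lambda)=F(x^{k_1}y^{l_1}x^{k_2}y^{l_2}\cdots x^{k_m}y^{l_m};\lambda)$ and $g(\{k_i,l_i\}_{i=1}^m;\lambda)=F(x^{l_m}y^{k_m}x^{l_{m-1}}y^{k_{m-1}}\cdots x^{l_1}y^{k_1};\lambda)$. Let $I=\{(0,0),(1,0),(0,1)\}$, $\lambda'=\lambda-1$, and for a family of indices $\delta_i,\epsilon_i$ write $|\delta|=\sum\delta_i$, $|\epsilon|=\sum\epsilon_i$ (likewise $|\delta'|,|\epsilon'|$). Let $m\ge1$ and $k_1,l_1,\dots,k_m,l_m\in\mathbb{Z}_{\ge1}$. Then, for all $\lambda\in\mathbb{C}\setminus\mathbb{Z}_{\ge1}$: (i) If $k_1\ne1$ and $l_m\ne1$: $$\sum_{\{(\delta_i,\epsilon_i)\}_{i=1}^m\in I^m}(-\lambda)^{m-|\delta|-|\epsilon|}f(\{k_i-\delta_i,l_i-\epsilon_i\}_{i=1}^m;\lambda)=\sum_{\delta_1'\in\{0,1\}}\ \sum_{\{(\delta_j',\epsilon_j')\}_{j=2}^m\in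 I^{m-1}}\ \sum_{\epsilon_{m+1}'\in\{0,1\}}(-\lambda')^{m-|\delta'|-|\epsilon'|}f(\{k_i-\delta_i',l_i-\epsilon_{i+1}'\}_{i=1}^m;\lambda').$$ (ii) If $k_1=1$ and $l_m\ne1$: $$\sum_{\epsilon_1\in\{0,1\}}\ \sum_{\{(\delta_i,\epsilon_i)\}_{i=2}^m\in I^{m-1}}(-\lambda)^{m-|\delta|-|\epsilon|}f(\{1,l_1-\epsilon_1\}\cup\{k_i-\delta_i,l_i-\epsilon_i\}_{i=2}^m;\lambda)=\sum_{\{(\delta_j',\epsilon_j')\}_{j=2}^m\in I^{m-1}}\ \sum_{\epsilon_{m+1}'\in\{0,1\}}(-\lambda')^{m-|\delta'|-|\epsilon'|}f(\{1,l_1-\epsilon_2'\}\cup\{k_i-\delta_i',l_i-\epsilon_{i+1}'\}_{i=2}^m;\lambda').$$ (iii) If $k_1\ne1$ and $l_m=1$: $$\sum_{\{(\delta_i,\epsilon_i)\}_{i=1}^{m-1}\in I^{m-1}}\ \sum_{\delta_m\in\{0,1\}}(-\lambda)^{m-|\delta|-|\epsilon|}f(\{k_i-\delta_i,l_i-\epsilon_i\}_{i=1}^{m-1}\cup\{k_m-\delta_m,1\};\lambda)=\sum_{\delta_1'\in\{0,1\}}\ \sum_{\{(\delta_j',\epsilon_j')\}_{j=2}^m\in I^{m-1}}(-\lambda')^{m-|\delta'|-|\epsilon'|}f(\{k_i-\delta_i',l_i-\epsilon_{i+1}'\}_{i=1}^{m-1}\cup\{k_m-\delta_m',1\};\lambda').$$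 (iv) If $k_1=l_m=1$ and $m\ge2$: $$\sum_{\epsilon_1\in\{0,1\}}\ \sum_{\{(\delta_i,\epsilon_i)\}_{i=2}^{m-1}\in I^{m-2}}\ \sum_{\delta_m\in\{0,1\}}(-\lambda)^{m-|\delta|-|\epsilon|}f(\{1,l_1-\epsilon_1\}\cup\{k_i-\delta_i,l_i-\epsilon_i\}_{i=2}^{m-1}\cup\{k_m-\delta_m,1\};\lambda)=\sum_{\{(\delta_j',\epsilon_j')\}_{j=2}^m\in I^{m-1}}(-\lambda')^{m-|\delta'|-|\epsilon'|}f(\{1,l_1-\epsilon_2'\}\cup\{k_i-\delta_i',l_i-\epsilon_{i+1}'\}_{i=2}^{m-1}\cup\{k_m-\delta_m',1\};\lambda').$$ Moreover the same four identities hold with $f$ replaced by $g$ throughout.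
   Context: Here $\{a_1,b_1\}\cup\{a_i,b_i\}_{i=2}^m$ denotes the sequence $(a_1,b_1,a_2,b_2,\dots,a_m,b_m)$, and in each sum the exponents $|\delta|,|\epsilon|$ (resp. $|\delta'|,|\epsilon'|$) are the sums of all the $\delta_i,\epsilon_i$ (resp. $\delta_i',\epsilon_i'$) occurring as summation variables in that sum. Since $x^ay^0x^b=x^{a+b}$ and $y^ax^0y^b=y^{a+b}$, entries equal to $0$ are allowed in $f,g$. Equivalently, $f(\{k_i,l_i\};\lambda)=\sum_{n_1>\dots>n_{L_m}>0}\prod_{i=1}^m\big(n_{L_{i-1}+1}^{k_i}\prod_{r=L_{i-1}+1}^{L_i}(n_r-\lambda)\big)^{ -1}$ with $L_i=l_1+\dots+l_i$; these are generating functions in $\lambda$ of sums of multiple zeta values of fixed index with total weight increased by the power of $\lambda$, and $g$ corresponds to the dual index. -}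

module Defs where

open import Algebra.Bundles.Raw using (RawRing)
open import Data.Integer as ℤ using (ℤ; +_; -[1+_])
import Data.Integer.Properties as ℤₚ
open import Data.List using (List; []; _∷_; _++_; foldr; replicate; cartesianProductWith)
open import Data.Nat as ℕ using (ℕ; zero; suc; _≤_; _∸_; _⊔_)
import Data.Nat.Properties as ℕₚ
open import Data.Product using (∃; _×_; _,_; proj₁; proj₂)
open import Data.Rational as ℚ using (ℚ; 0ℚ; 1ℚ; ½)
import Data.Rational.Properties as ℚₚ
open import Data.Rational.Solver using (module +-*-Solver)
import Data.Rational.Unnormalised as ℚᵘ
import Data.Rational.Unnormalised.Properties as ℚᵘₚ
open import Data.Vec as Vec using (Vec; []; _∷_; _∷ʳ_; head; last; reverse; sum; zipWith)
open import Data.Vec.Relation.Unary.All using (All)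
open import Level using (0ℓ)
open import Relation.Binary.PropositionalEquality
  using (_≡_; _≢_; refl; sym; trans; cong; cong₂; subst)
open import Relation.Nullary using (yes; no; contradiction)

-- A real number is a Cauchy sequence of rationals with a modulus; equality of reals is _≈ᴿ_.

IsCauchy : (ℕ → ℚ) → Set
IsCauchy s = ∀ ε → 0ℚ ℚ.< ε →
  ∃ λ N → ∀ m n → N ≤ m → N ≤ n → ℚ.∣ s m ℚ.- s n ∣ ℚ.< ε

record ℝ : Set where
  constructor mkℝ
  field
    seq    : ℕ → ℚ
    cauchy : IsCauchy seq

open ℝ

infix  4 _≈ᴿ_ _<ᴿ_
infixl 6 _+ᴿ_ _-ᴿ_
infixl 7 _*ᴿ_

_≈ᴿ_ : ℝ → ℝ → Set
x ≈ᴿ y = ∀ ε → 0ℚ ℚ.< ε →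
  ∃ λ N → ∀ n → N ≤ n → ℚ.∣ seq x n ℚ.- seq y n ∣ ℚ.< ε

_<ᴿ_ : ℝ → ℝ → Set
x <ᴿ y = ∃ λ ε → 0ℚ ℚ.< ε × ∃ λ N → ∀ n → N ≤ n → seq x n ℚ.+ ε ℚ.≤ seq y n

-- Abstract, so that conversion checking never unfolds the moduli of convergence.
abstract

  half-half : ∀ p → ½ ℚ.* p ℚ.+ ½ ℚ.* p ≡ p
  half-half p = trans (sym (ℚₚ.*-distribʳ-+ p ½ ½)) (ℚₚ.*-identityˡ p)

  *-pos : ∀ {p q} → 0ℚ ℚ.< p → 0ℚ ℚ.< q → 0ℚ ℚ.< p ℚ.* q
  *-pos {p} {q} 0<p 0<q =
    subst (ℚ._< p ℚ.* q) (ℚₚ.*-zeroˡ q) (ℚₚ.*-monoˡ-<-pos q {{ℚ.positive 0<q}} 0<p)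

  half-pos : ∀ {p} → 0ℚ ℚ.< p → 0ℚ ℚ.< ½ ℚ.* p
  half-pos = *-pos (ℚₚ.positive⁻¹ ½)

  add-gap : ∀ a b c d → (a ℚ.+ b) ℚ.- (c ℚ.+ d) ≡ (a ℚ.- c) ℚ.+ (b ℚ.- d)
  add-gap = solve 4 (λ a b c d → (a :+ b) :- (c :+ d) := (a :- c) :+ (b :- d)) refl
    where open +-*-Solver

  neg-gap : ∀ a b → (ℚ.- a) ℚ.- (ℚ.- b) ≡ ℚ.- (a ℚ.- b)
  neg-gap = solve 2 (λ a b → (:- a) :- (:- b) := :- (a :- b)) refl
    where open +-*-Solver

  mul-gap : ∀ a b c d → a ℚ.* b ℚ.- c ℚ.* d ≡ a ℚ.* (b ℚ.- d) ℚ.+ d ℚ.* (a ℚ.- c)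
  mul-gap = solve 4 (λ a b c d → a :* b :- c :* d := a :* (b :- d) :+ d :* (a :- c)) refl
    where open +-*-Solver

  inv-gap : ∀ r s p q → (r ℚ.- s) ℚ.* (p ℚ.* q) ≡ (p ℚ.* r) ℚ.* q ℚ.- (q ℚ.* s) ℚ.* p
  inv-gap = solve 4 (λ r s p q → (r :- s) :* (p :* q) := (p :* r) :* q :- (q :* s) :* p) refl
    where open +-*-Solver

  split : ∀ a b → a ≡ (a ℚ.- b) ℚ.+ b
  split = solve 2 (λ a b → a := (a :- b) :+ b) refl
    where open +-*-Solver

  ∣-∣-comm : ∀ a b → ℚ.∣ a ℚ.- b ∣ ≡ ℚ.∣ b ℚ.- a ∣
  ∣-∣-comm a b = trans (sym (ℚₚ.∣-p∣≡∣p∣ (a ℚ.- b))) (cong ℚ.∣_∣ (flip a b))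
    where
    flip : ∀ a b → ℚ.- (a ℚ.- b) ≡ b ℚ.- a
    flip = solve 2 (λ a b → :- (a :- b) := b :- a) refl
      where open +-*-Solver

  const-cauchy : ∀ q → IsCauchy (λ _ → q)
  const-cauchy q ε 0<ε =
    0 , λ _ _ _ _ → subst (ℚ._< ε) (sym (cong ℚ.∣_∣ (ℚₚ.+-inverseʳ q))) 0<ε

  +-cauchy : ∀ {s t} → IsCauchy s → IsCauchy t → IsCauchy (λ n → s n ℚ.+ t n)
  +-cauchy {s} {t} cs ct ε 0<ε with cs (½ ℚ.* ε) (half-pos 0<ε) | ct (½ ℚ.* ε) (half-pos 0<ε)
  ... | M , hs | N , ht = M ⊔ N , λ m n lm ln → begin-strict
    ℚ.∣ (s m ℚ.+ t m) ℚ.- (s n ℚ.+ t n) ∣   ≡⟨ cong ℚ.∣_∣ (add-gap (s m) (t m) (s n) (t n)) ⟩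
    ℚ.∣ (s m ℚ.- s n) ℚ.+ (t m ℚ.- t n) ∣   ≤⟨ ℚₚ.∣p+q∣≤∣p∣+∣q∣ (s m ℚ.- s n) (t m ℚ.- t n) ⟩
    ℚ.∣ s m ℚ.- s n ∣ ℚ.+ ℚ.∣ t m ℚ.- t n ∣ <⟨ ℚₚ.+-mono-<
                                                 (hs m n (ℕₚ.m⊔n≤o⇒m≤o M N lm) (ℕₚ.m⊔n≤o⇒m≤o M N ln))
                                                 (ht m n (ℕₚ.m⊔n≤o⇒n≤o M N lm) (ℕₚ.m⊔n≤o⇒n≤o M N ln)) ⟩
    ½ ℚ.* ε ℚ.+ ½ ℚ.* ε                     ≡⟨ half-half ε ⟩
    ε                                       ∎
    where open ℚₚ.≤-Reasoning

  neg-cauchy : ∀ {s} → IsCauchy s → IsCauchy (λ n → ℚ.- s n)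
  neg-cauchy {s} cs ε 0<ε with cs ε 0<ε
  ... | N , hs = N , λ m n lm ln → subst (ℚ._< ε)
    (sym (trans (cong ℚ.∣_∣ (neg-gap (s m) (s n))) (ℚₚ.∣-p∣≡∣p∣ (s m ℚ.- s n)))) (hs m n lm ln)

  bounded : ∀ {s} → IsCauchy s →
    ∃ λ B → 0ℚ ℚ.< B × ∃ λ N → ∀ n → N ≤ n → ℚ.∣ s n ∣ ℚ.≤ B
  bounded {s} cs with cs 1ℚ (ℚₚ.positive⁻¹ 1ℚ)
  ... | N , hs = 1ℚ ℚ.+ ℚ.∣ s N ∣
               , ℚₚ.+-mono-<-≤ (ℚₚ.positive⁻¹ 1ℚ) (ℚₚ.0≤∣p∣ (s N))
               , N , λ n ln → begin
    ℚ.∣ s n ∣                       ≡⟨ cong ℚ.∣_∣ (split (s n) (s N)) ⟩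
    ℚ.∣ (s n ℚ.- s N) ℚ.+ s N ∣     ≤⟨ ℚₚ.∣p+q∣≤∣p∣+∣q∣ (s n ℚ.- s N) (s N) ⟩
    ℚ.∣ s n ℚ.- s N ∣ ℚ.+ ℚ.∣ s N ∣ ≤⟨ ℚₚ.+-monoˡ-≤ ℚ.∣ s N ∣ (ℚₚ.<⇒≤ (hs n N ln ℕₚ.≤-refl)) ⟩
    1ℚ ℚ.+ ℚ.∣ s N ∣                ∎
    where open ℚₚ.≤-Reasoning

  scale : ∀ {B δ} a b → ℚ.∣ a ∣ ℚ.≤ B → 0ℚ ℚ.< B → ℚ.∣ b ∣ ℚ.< δ → ℚ.∣ a ℚ.* b ∣ ℚ.< B ℚ.* δ
  scale {B} {δ} a b ha 0<B hb = begin-strict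
    ℚ.∣ a ℚ.* b ∣       ≡⟨ ℚₚ.∣p*q∣≡∣p∣*∣q∣ a b ⟩
    ℚ.∣ a ∣ ℚ.* ℚ.∣ b ∣ ≤⟨ ℚₚ.*-monoʳ-≤-nonNeg ℚ.∣ b ∣ {{ℚₚ.∣-∣-nonNeg b}} ha ⟩
    B ℚ.* ℚ.∣ b ∣       <⟨ ℚₚ.*-monoʳ-<-pos B {{ℚ.positive 0<B}} hb ⟩
    B ℚ.* δ             ∎
    where open ℚₚ.≤-Reasoning

  mul-close : ∀ {B C δ η ε} a b c d → 0ℚ ℚ.< B → 0ℚ ℚ.< C →
              ℚ.∣ a ∣ ℚ.≤ B → ℚ.∣ d ∣ ℚ.≤ C → ℚ.∣ b ℚ.- d ∣ ℚ.< δ → ℚ.∣ a ℚ.- c ∣ ℚ.< η →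
              B ℚ.* δ ≡ ½ ℚ.* ε → C ℚ.* η ≡ ½ ℚ.* ε → ℚ.∣ a ℚ.* b ℚ.- c ℚ.* d ∣ ℚ.< ε
  mul-close {B} {C} {δ} {η} {ε} a b c d 0<B 0<C ha hd hbd hac eB eC = begin-strict
    ℚ.∣ a ℚ.* b ℚ.- c ℚ.* d ∣
      ≡⟨ cong ℚ.∣_∣ (mul-gap a b c d) ⟩
    ℚ.∣ a ℚ.* (b ℚ.- d) ℚ.+ d ℚ.* (a ℚ.- c) ∣
      ≤⟨ ℚₚ.∣p+q∣≤∣p∣+∣q∣ (a ℚ.* (b ℚ.- d)) (d ℚ.* (a ℚ.- c)) ⟩
    ℚ.∣ a ℚ.* (b ℚ.- d) ∣ ℚ.+ ℚ.∣ d ℚ.* (a ℚ.- c) ∣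
      <⟨ ℚₚ.+-mono-< (scale a (b ℚ.- d) ha 0<B hbd) (scale d (a ℚ.- c) hd 0<C hac) ⟩
    B ℚ.* δ ℚ.+ C ℚ.* η
      ≡⟨ cong₂ ℚ._+_ eB eC ⟩
    ½ ℚ.* ε ℚ.+ ½ ℚ.* ε
      ≡⟨ half-half ε ⟩
    ε ∎
    where open ℚₚ.≤-Reasoning

  shrink : ∀ {B ε} → 0ℚ ℚ.< B → 0ℚ ℚ.< ε → ∃ λ δ → 0ℚ ℚ.< δ × B ℚ.* δ ≡ ε
  shrink {B} {ε} 0<B 0<ε =
    B⁻¹ ℚ.* ε
    , *-pos (ℚₚ.positive⁻¹ B⁻¹ {{ℚₚ.1/pos⇒pos B {{B>0}}}}) 0<ε
    , trans (sym (ℚₚ.*-assoc B B⁻¹ ε))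
            (trans (cong (ℚ._* ε) (ℚₚ.*-inverseʳ B {{B≢0}})) (ℚₚ.*-identityˡ ε))
    where
    B>0 : ℚ.Positive B
    B>0 = ℚ.positive 0<B
    B≢0 : ℚ.NonZero B
    B≢0 = ℚₚ.pos⇒nonZero B {{B>0}}
    B⁻¹ : ℚ
    B⁻¹ = ℚ.1/_ B {{B≢0}}

  *-cauchy : ∀ {s t} → IsCauchy s → IsCauchy t → IsCauchy (λ n → s n ℚ.* t n)
  *-cauchy {s} {t} cs ct ε 0<ε =
    let B , 0<B , K , hB = bounded cs
        C , 0<C , L , hC = bounded ct
        δ , 0<δ , eB     = shrink 0<B (half-pos 0<ε)
        η , 0<η , eC     = shrink 0<C (half-pos 0<ε)
        M , ht           = ct δ 0<δ
        N , hs           = cs η 0<η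
    in (K ⊔ L) ⊔ (M ⊔ N) , λ m n lm ln →
         mul-close (s m) (t m) (s n) (t n) 0<B 0<C
           (hB m (on₁ K L M N lm)) (hC n (on₂ K L M N ln))
           (ht m n (on₃ K L M N lm) (on₃ K L M N ln))
           (hs m n (on₄ K L M N lm) (on₄ K L M N ln)) eB eC
    where
    on₁ : ∀ K L M N {n} → (K ⊔ L) ⊔ (M ⊔ N) ≤ n → K ≤ n
    on₁ K L M N h = ℕₚ.m⊔n≤o⇒m≤o K L (ℕₚ.m⊔n≤o⇒m≤o (K ⊔ L) (M ⊔ N) h)
    on₂ : ∀ K L M N {n} → (K ⊔ L) ⊔ (M ⊔ N) ≤ n → L ≤ n
    on₂ K L M N h = ℕₚ.m⊔n≤o⇒n≤o K L (ℕₚ.m⊔n≤o⇒m≤o (K ⊔ L) (M ⊔ N) h)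
    on₃ : ∀ K L M N {n} → (K ⊔ L) ⊔ (M ⊔ N) ≤ n → M ≤ n
    on₃ K L M N h = ℕₚ.m⊔n≤o⇒m≤o M N (ℕₚ.m⊔n≤o⇒n≤o (K ⊔ L) (M ⊔ N) h)
    on₄ : ∀ K L M N {n} → (K ⊔ L) ⊔ (M ⊔ N) ≤ n → N ≤ n
    on₄ K L M N h = ℕₚ.m⊔n≤o⇒n≤o M N (ℕₚ.m⊔n≤o⇒n≤o (K ⊔ L) (M ⊔ N) h)

-- The value at 0 is never relevant: it only occurs at the finitely many
-- positions where a positive real's representative may vanish.
recip : ℚ → ℚ
recip p with p ℚ.≟ 0ℚ
... | yes _  = 0ℚ
... | no p≢0 = ℚ.1/_ p {{ℚ.≢-nonZero p≢0}}

recip-inverse : ∀ p → 0ℚ ℚ.< p → p ℚ.* recip p ≡ 1ℚ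
recip-inverse p 0<p with p ℚ.≟ 0ℚ
... | yes p≡0 = contradiction (sym p≡0) (ℚₚ.<⇒≢ 0<p)
... | no p≢0  = ℚₚ.*-inverseʳ p {{ℚ.≢-nonZero p≢0}}

recip-close : ∀ {c p q ε} → 0ℚ ℚ.< c → c ℚ.≤ p → c ℚ.≤ q → 0ℚ ℚ.< ε →
              ℚ.∣ p ℚ.- q ∣ ℚ.< (c ℚ.* c) ℚ.* ε → ℚ.∣ recip p ℚ.- recip q ∣ ℚ.< ε
recip-close {c} {p} {q} {ε} 0<c c≤p c≤q 0<ε h =
  ℚₚ.*-cancelʳ-<-nonNeg (p ℚ.* q) {{ℚₚ.pos⇒nonNeg (p ℚ.* q) {{ℚ.positive 0<pq}}}} (begin-strict
    ℚ.∣ recip p ℚ.- recip q ∣ ℚ.* (p ℚ.* q)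
      ≡⟨ cong (ℚ.∣ recip p ℚ.- recip q ∣ ℚ.*_) (sym (ℚₚ.0≤p⇒∣p∣≡p (ℚₚ.<⇒≤ 0<pq))) ⟩
    ℚ.∣ recip p ℚ.- recip q ∣ ℚ.* ℚ.∣ p ℚ.* q ∣
      ≡⟨ sym (ℚₚ.∣p*q∣≡∣p∣*∣q∣ (recip p ℚ.- recip q) (p ℚ.* q)) ⟩
    ℚ.∣ (recip p ℚ.- recip q) ℚ.* (p ℚ.* q) ∣
      ≡⟨ cong ℚ.∣_∣ (inv-gap (recip p) (recip q) p q) ⟩
    ℚ.∣ (p ℚ.* recip p) ℚ.* q ℚ.- (q ℚ.* recip q) ℚ.* p ∣
      ≡⟨ cong₂ (λ u v → ℚ.∣ u ℚ.* q ℚ.- v ℚ.* p ∣) (recip-inverse p 0<p) (recip-inverse q 0<q) ⟩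
    ℚ.∣ 1ℚ ℚ.* q ℚ.- 1ℚ ℚ.* p ∣
      ≡⟨ cong₂ (λ u v → ℚ.∣ u ℚ.- v ∣) (ℚₚ.*-identityˡ q) (ℚₚ.*-identityˡ p) ⟩
    ℚ.∣ q ℚ.- p ∣
      ≡⟨ ∣-∣-comm q p ⟩
    ℚ.∣ p ℚ.- q ∣
      <⟨ h ⟩
    (c ℚ.* c) ℚ.* ε
      ≤⟨ ℚₚ.*-monoʳ-≤-nonNeg ε {{nn 0<ε}} (ℚₚ.≤-trans
           (ℚₚ.*-monoʳ-≤-nonNeg c {{nn 0<c}} c≤p)
           (ℚₚ.*-monoˡ-≤-nonNeg p {{nn 0<p}} c≤q)) ⟩
    (p ℚ.* q) ℚ.* ε
      ≡⟨ ℚₚ.*-comm (p ℚ.* q) ε ⟩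
    ε ℚ.* (p ℚ.* q) ∎)
  where
  open ℚₚ.≤-Reasoning
  nn : ∀ {r} → 0ℚ ℚ.< r → ℚ.NonNegative r
  nn {r} 0<r = ℚ.nonNegative (ℚₚ.<⇒≤ 0<r)
  0<p : 0ℚ ℚ.< p
  0<p = ℚₚ.<-≤-trans 0<c c≤p
  0<q : 0ℚ ℚ.< q
  0<q = ℚₚ.<-≤-trans 0<c c≤q
  0<pq : 0ℚ ℚ.< p ℚ.* q
  0<pq = *-pos 0<p 0<q

fromℚᴿ : ℚ → ℝ
fromℚᴿ q = mkℝ (λ _ → q) (const-cauchy q)

0ᴿ : ℝ
0ᴿ = fromℚᴿ 0ℚ

_+ᴿ_ : ℝ → ℝ → ℝ
x +ᴿ y = mkℝ (λ n → seq x n ℚ.+ seq y n) (+-cauchy {seq x} {seq y} (cauchy x) (cauchy y))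

-ᴿ_ : ℝ → ℝ
-ᴿ x = mkℝ (λ n → ℚ.- seq x n) (neg-cauchy {seq x} (cauchy x))

_-ᴿ_ : ℝ → ℝ → ℝ
x -ᴿ y = x +ᴿ (-ᴿ y)

_*ᴿ_ : ℝ → ℝ → ℝ
x *ᴿ y = mkℝ (λ n → seq x n ℚ.* seq y n) (*-cauchy {seq x} {seq y} (cauchy x) (cauchy y))

abstract
  recip-cauchy : ∀ x → 0ᴿ <ᴿ x → IsCauchy (λ n → recip (seq x n))
  recip-cauchy x (c , 0<c , M , c≤x) ε 0<ε =
    let N , hx = cauchy x ((c ℚ.* c) ℚ.* ε) (*-pos (*-pos 0<c 0<c) 0<ε)
    in M ⊔ N , λ m n lm ln → recip-close 0<c (below N lm) (below N ln) 0<ε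
         (hx m n (ℕₚ.m⊔n≤o⇒n≤o M N lm) (ℕₚ.m⊔n≤o⇒n≤o M N ln))
    where
    below : ∀ N {n} → M ⊔ N ≤ n → c ℚ.≤ seq x n
    below N {n} h = subst (ℚ._≤ seq x n) (ℚₚ.+-identityˡ c) (c≤x n (ℕₚ.m⊔n≤o⇒m≤o M N h))

invᴿ : (x : ℝ) → 0ᴿ <ᴿ x → ℝ
invᴿ x 0<x = mkℝ (λ n → recip (seq x n)) (recip-cauchy x 0<x)

record ℂ : Set where
  constructor _+i_
  field
    re im : ℝ

open ℂ

infix  4 _≈_ _#_
infixl 6 _+_ _-_
infixl 7 _*_
infix  8 -_

_≈_ : ℂ → ℂ → Set
z ≈ w = re z ≈ᴿ re w × im z ≈ᴿ im w

fromℚ : ℚ → ℂ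
fromℚ q = fromℚᴿ q +i 0ᴿ

fromℕ : ℕ → ℂ
fromℕ n = fromℚ (+ n ℚ./ 1)

0ᶜ 1ᶜ : ℂ
0ᶜ = fromℚ 0ℚ
1ᶜ = fromℚ 1ℚ

_+_ : ℂ → ℂ → ℂ
z + w = (re z +ᴿ re w) +i (im z +ᴿ im w)

-_ : ℂ → ℂ
- z = (-ᴿ re z) +i (-ᴿ im z)

_-_ : ℂ → ℂ → ℂ
z - w = z + (- w)

_*_ : ℂ → ℂ → ℂ
z * w = (re z *ᴿ re w -ᴿ im z *ᴿ im w) +i (re z *ᴿ im w +ᴿ im z *ᴿ re w)

∣_∣² : ℂ → ℝ
∣ z ∣² = re z *ᴿ re z +ᴿ im z *ᴿ im z

-- z ≠ w in the positive sense: |z − w|² is bounded away from 0.  Inverses are only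
-- available under this condition, which classically is the negation of z ≈ w.
_#_ : ℂ → ℂ → Set
z # w = 0ᴿ <ᴿ ∣ z - w ∣²

inv : (z : ℂ) → 0ᴿ <ᴿ ∣ z ∣² → ℂ
inv z z≠0 = (re z *ᴿ r) +i (-ᴿ (im z *ᴿ r))
  where
  r : ℝ
  r = invᴿ ∣ z ∣² z≠0

ℂ-rawRing : RawRing 0ℓ 0ℓ
ℂ-rawRing = record
  { Carrier = ℂ ; _≈_ = _≈_ ; _+_ = _+_ ; _*_ = _*_ ; -_ = -_ ; 0# = 0ᶜ ; 1# = 1ᶜ }

open import Algebra.Definitions.RawSemiring (RawRing.rawSemiring ℂ-rawRing) public
  using (_^_)

zpow : (z : ℂ) → 0ᴿ <ᴿ ∣ z ∣² → ℤ → ℂ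
zpow z z≠0 (+ n)    = z ^ n
zpow z z≠0 -[1+ n ] = inv z z≠0 ^ suc n

∑ : {A : Set} → List A → (A → ℂ) → ℂ
∑ xs t = foldr (λ x s → t x + s) 0ᶜ xs

infix 5 ∑
syntax ∑ xs (λ x → t) = ∑[ x ∈ xs ] t

infix 4 _⟶_

_⟶_ : (ℕ → ℂ) → ℂ → Set
s ⟶ S = ∀ ε → 0ℚ ℚ.< ε →
  ∃ λ N → ∀ n → N ≤ n → ∣ s n - S ∣² <ᴿ fromℚᴿ (ε ℚ.* ε)

record ℂ∖ℤ≥1 : Set where
  constructor _avoiding_
  field
    val   : ℂ
    apart : ∀ n → fromℕ (suc n) # val

open ℂ∖ℤ≥1

<ᴿ-resp : ∀ {x y} → (∀ n → seq x n ≡ seq y n) → 0ᴿ <ᴿ x → 0ᴿ <ᴿ y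
<ᴿ-resp e (c , 0<c , N , h) = c , 0<c , N , λ n ln → subst (0ℚ ℚ.+ c ℚ.≤_) (e n) (h n ln)

suc-/1 : ∀ n → + suc n ℚ./ 1 ≡ 1ℚ ℚ.+ + n ℚ./ 1
suc-/1 n = ℚₚ.toℚᵘ-injective (begin
  ℚ.toℚᵘ (+ suc n ℚ./ 1)                    ≈⟨ ℚₚ.toℚᵘ-fromℚᵘ (ℚᵘ.mkℚᵘ (+ suc n) 0) ⟩
  ℚᵘ.mkℚᵘ (+ suc n) 0                       ≈⟨ ℚᵘ.*≡* (cong (ℤ._* + 1) (sym (ℤₚ.*-identityʳ (+ suc n)))) ⟩
  ℚᵘ.mkℚᵘ (+ suc n ℤ.* + 1) 0               ≈⟨ ℚᵘ.*≡* (cong (ℤ._* + 1) (shape n)) ⟩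
  ℚᵘ.1ℚᵘ ℚᵘ.+ ℚᵘ.mkℚᵘ (+ n) 0               ≈⟨ ℚᵘₚ.+-congʳ ℚᵘ.1ℚᵘ
                                                 (ℚᵘₚ.≃-sym (ℚₚ.toℚᵘ-fromℚᵘ (ℚᵘ.mkℚᵘ (+ n) 0))) ⟩
  ℚᵘ.1ℚᵘ ℚᵘ.+ ℚ.toℚᵘ (+ n ℚ./ 1)            ≈⟨ ℚᵘₚ.≃-sym (ℚₚ.toℚᵘ-homo-+ 1ℚ (+ n ℚ./ 1)) ⟩
  ℚ.toℚᵘ (1ℚ ℚ.+ + n ℚ./ 1)                 ∎)
  where
  open ℚᵘₚ.≃-Reasoning
  shape : ∀ n → + suc n ℤ.* + 1 ≡ + 1 ℤ.* + 1 ℤ.+ + n ℤ.* + 1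
  shape n = ℤₚ.*-distribʳ-+ (+ 1) (+ 1) (+ n)

abstract
  pred-apart : ∀ w n → fromℕ (suc (suc n)) # w → fromℕ (suc n) # (w - 1ᶜ)
  pred-apart w n = <ᴿ-resp {∣ fromℕ (suc (suc n)) - w ∣²} {∣ fromℕ (suc n) - (w - 1ᶜ) ∣²} λ i →
    trans (cong (λ p → (p ℚ.- seq (re w) i) ℚ.* (p ℚ.- seq (re w) i)
                       ℚ.+ (0ℚ ℚ.- seq (im w) i) ℚ.* (0ℚ ℚ.- seq (im w) i)) (suc-/1 (suc n)))
          (shape (+ suc n ℚ./ 1) (seq (re w) i) (seq (im w) i))
    where
    shape : ∀ p a b →
      ((1ℚ ℚ.+ p) ℚ.- a) ℚ.* ((1ℚ ℚ.+ p) ℚ.- a) ℚ.+ (0ℚ ℚ.- b) ℚ.* (0ℚ ℚ.- b)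
      ≡ (p ℚ.- (a ℚ.- 1ℚ)) ℚ.* (p ℚ.- (a ℚ.- 1ℚ)) ℚ.+ (0ℚ ℚ.- (b ℚ.- 0ℚ)) ℚ.* (0ℚ ℚ.- (b ℚ.- 0ℚ))
    shape = solve 3 (λ p a b →
      ((con 1ℚ :+ p) :- a) :* ((con 1ℚ :+ p) :- a) :+ (con 0ℚ :- b) :* (con 0ℚ :- b)
      := (p :- (a :- con 1ℚ)) :* (p :- (a :- con 1ℚ)) :+ (con 0ℚ :- (b :- con 0ℚ)) :* (con 0ℚ :- (b :- con 0ℚ))) refl
      where open +-*-Solver

pred : ℂ∖ℤ≥1 → ℂ∖ℤ≥1
pred z = (val z - 1ᶜ) avoiding λ n → pred-apart (val z) n (apart z (suc n))

abstract
  -pred≠0 : ∀ z → 0ᴿ <ᴿ ∣ - val (pred z) ∣²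
  -pred≠0 z = <ᴿ-resp {∣ fromℕ 1 - val z ∣²} {∣ - val (pred z) ∣²}
    (λ i → shape (seq (re (val z)) i) (seq (im (val z)) i)) (apart z 0)
    where
    shape : ∀ a b →
      (1ℚ ℚ.- a) ℚ.* (1ℚ ℚ.- a) ℚ.+ (0ℚ ℚ.- b) ℚ.* (0ℚ ℚ.- b)
      ≡ (ℚ.- (a ℚ.- 1ℚ)) ℚ.* (ℚ.- (a ℚ.- 1ℚ)) ℚ.+ (ℚ.- (b ℚ.- 0ℚ)) ℚ.* (ℚ.- (b ℚ.- 0ℚ))
    shape = solve 2 (λ a b →
      (con 1ℚ :- a) :* (con 1ℚ :- a) :+ (con 0ℚ :- b) :* (con 0ℚ :- b)
      := (:- (a :- con 1ℚ)) :* (:- (a :- con 1ℚ)) :+ (:- (b :- con 0ℚ)) :* (:- (b :- con 0ℚ))) refl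
      where open +-*-Solver

data Letter : Set where
  X Y : Letter

Word : Set
Word = List Letter

-- The words x^a₁ y ⋯ x^a_L y with L ≥ 1 and a₁ ≥ 1 are those of the form x u y
-- (the letters x, y are written X, Y).
Admissible : Word → Set
Admissible w = ∃ λ u → w ≡ X ∷ u ++ Y ∷ []

-- x^a₁ y x^a₂ y ⋯ x^a_L y ↦ a₁, …, a_L
exponents : Word → List ℕ
exponents = go 0
  where
  go : ℕ → Word → List ℕ
  go a []      = []
  go a (X ∷ w) = go (suc a) w
  go a (Y ∷ w) = a ∷ go 0 w

-- 1 / (r^a (r − z)) at r = n + 1
factor : ℂ∖ℤ≥1 → ℕ → ℕ → ℂ
factor z n a = fromℚ (+ 1 ℚ./ suc n) ^ a * inv (fromℕ (suc n) - val z) (apart z n)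

-- truncated z as N is the sum over N ≥ n₁ > ⋯ > n_L > 0 of the products of the
-- factors 1 / (n_r^a_r (n_r − z)); the last clause splits on whether n₁ ≤ N or n₁ = N + 1.
truncated : ℂ∖ℤ≥1 → List ℕ → ℕ → ℂ
truncated z []       N       = 1ᶜ
truncated z (a ∷ as) zero    = 0ᶜ
truncated z (a ∷ as) (suc N) = truncated z (a ∷ as) N + factor z N a * truncated z as N

_HasSum[_]_ : Word → ℂ∖ℤ≥1 → ℂ → Set
w HasSum[ z ] S = truncated z (exponents w) ⟶ S

-- F w z is the sum of the series wherever the series is defined, and arbitrary elsewhere.
IsSeries : (Word → ℂ∖ℤ≥1 → ℂ) → Set
IsSeries F = ∀ w → Admissible w → ∀ z → w HasSum[ z ] F w z

-- x^k₁ y^l₁ ⋯ x^k_m y^l_m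
word : ∀ {m} → Vec ℕ m → Vec ℕ m → Word
word []       []       = []
word (k ∷ ks) (l ∷ ls) = replicate k X ++ replicate l Y ++ word ks ls

module _ (F : Word → ℂ∖ℤ≥1 → ℂ) where

  f g : ∀ {m} → Vec ℕ m → Vec ℕ m → ℂ∖ℤ≥1 → ℂ
  f k l z = F (word k l) z
  g k l z = F (word (reverse l) (reverse k)) z

O : List ℕ
O = 0 ∷ 1 ∷ []

I : List (ℕ × ℕ)
I = (0 , 0) ∷ (1 , 0) ∷ (0 , 1) ∷ []

I^ : ∀ m → List (Vec (ℕ × ℕ) m)
I^ zero    = [] ∷ []
I^ (suc m) = cartesianProductWith _∷_ I (I^ m)

δs εs : ∀ {m} → Vec (ℕ × ℕ) m → Vec ℕ m
δs = Vec.map proj₁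
εs = Vec.map proj₂

module _ (h : ∀ {m} → Vec ℕ m → Vec ℕ m → ℂ∖ℤ≥1 → ℂ) where

  -- (−z)^(m − |δ| − |ε|) h({kᵢ − δᵢ, lᵢ − εᵢ}; z).  No subtraction is truncated
  -- below: the entries of k and l are positive, those of δ and ε are at most 1, and
  -- |δ| + |ε| ≤ m in all left-hand sides.
  termˡ : ∀ {m} → Vec ℕ m → Vec ℕ m → ℂ∖ℤ≥1 → Vec ℕ m → Vec ℕ m → ℂ
  termˡ {m} k l z δ ε =
    (- val z) ^ (m ∸ (sum δ ℕ.+ sum ε)) * h (zipWith _∸_ k δ) (zipWith _∸_ l ε) z

  -- Here ε = (ε₂, …, ε_{m+1}), and z′ = z − 1.  The exponent is −1 when
  -- |δ| + |ε| = m + 1, which happens in (i).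
  termʳ : ∀ {m} → Vec ℕ m → Vec ℕ m → ℂ∖ℤ≥1 → Vec ℕ m → Vec ℕ m → ℂ
  termʳ {m} k l z δ ε =
    zpow (- val (pred z)) (-pred≠0 z) (+ m ℤ.- + (sum δ ℕ.+ sum ε))
      * h (zipWith _∸_ k δ) (zipWith _∸_ l ε) (pred z)

  -- An index kᵢ or lᵢ from which nothing is subtracted is given the entry 0 in δ or ε.
  Equation-i Equation-ii Equation-iii :
    ∀ {n} → Vec ℕ (suc n) → Vec ℕ (suc n) → ℂ∖ℤ≥1 → Set

  Equation-i {n} k l z =
    ∑[ p ∈ I^ (suc n) ] termˡ k l z (δs p) (εs p)
    ≈
    ∑[ δ₁ ∈ O ] ∑[ p ∈ I^ n ] ∑[ ε ∈ O ] termʳ k l z (δ₁ ∷ δs p) (εs p ∷ʳ ε)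

  Equation-ii {n} k l z =
    ∑[ ε₁ ∈ O ] ∑[ p ∈ I^ n ] termˡ k l z (0 ∷ δs p) (ε₁ ∷ εs p)
    ≈
    ∑[ p ∈ I^ n ] ∑[ ε ∈ O ] termʳ k l z (0 ∷ δs p) (εs p ∷ʳ ε)

  Equation-iii {n} k l z =
    ∑[ p ∈ I^ n ] ∑[ δₘ ∈ O ] termˡ k l z (δs p ∷ʳ δₘ) (εs p ∷ʳ 0)
    ≈
    ∑[ δ₁ ∈ O ] ∑[ p ∈ I^ n ] termʳ k l z (δ₁ ∷ δs p) (εs p ∷ʳ 0)

  Equation-iv : ∀ {n} → Vec ℕ (suc (suc n)) → Vec ℕ (suc (suc n)) → ℂ∖ℤ≥1 → Set
  Equation-iv {n} k l z =
    ∑[ ε₁ ∈ O ] ∑[ p ∈ I^ n ] ∑[ δₘ ∈ O ] termˡ k l z (0 ∷ (δs p ∷ʳ δₘ)) (ε₁ ∷ (εs p ∷ʳ 0))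
    ≈
    ∑[ p ∈ I^ (suc n) ] termʳ k l z (0 ∷ δs p) (εs p ∷ʳ 0)

  DifferenceEquations : Set
  DifferenceEquations =
      (∀ n (k l : Vec ℕ (suc n)) → All (1 ≤_) k → All (1 ≤_) l → ∀ z →
         (head k ≢ 1 → last l ≢ 1 → Equation-i   k l z)
       × (head k ≡ 1 → last l ≢ 1 → Equation-ii  k l z)
       × (head k ≢ 1 → last l ≡ 1 → Equation-iii k l z))
    × (∀ n (k l : Vec ℕ (suc (suc n))) → All (1 ≤_) k → All (1 ≤_) l → ∀ z →
         head k ≡ 1 → last l ≡ 1 → Equation-iv k l z)

{-# OPTIONS --safe #-}
module Submission where

-- Write x and y for the operators on sequences (a₀, a₁, …) that divide the n-th entry by n
-- (entry 0 becoming 0), respectively send a to the sequence with n-th entry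
-- (a₀ + ⋯ + aₙ₋₁) / (n − λ).  Applying a word w to the unit sequence δ₀ at 0 gives the terms
-- of the series F(w; λ).  Let y′ be the operator y for λ′ = λ − 1, let S be the shift, and put
-- Q a = ((a₀ + ⋯ + aₙ) / (n − λ′))ₙ and P = 1 − λ′ x.  Then y = S Q and y′ = Q S, so Q y = y′ Q,
-- and P x = x P, while on sequences with a₀ = 0
--
--   x + y − λ x y = P Q   and   x + y′ − λ′ y′ x = Q P.
--
-- The left-hand sides are the sums of the entries of x^(k₁−1) (P Q) y^(l₁−1) x^(k₂−1) (P Q) ⋯ δ₀.
-- Moving every P to the left and every Q to the right turns y into y′ and regroups the factors as
-- P x^(k₁−1) y′^(l₁−1) (Q P) x^(k₂−1) ⋯ y′^(lₘ−1) Q δ₀, which is the right-hand side, because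
-- −λ′ Q δ₀ = (1 − λ′ y′) δ₀; if lₘ = 1, the starting point is instead (1 − λ x) y δ₀ = P y′ δ₀.
-- These identities hold for every truncation of the series.  If k₁ = 1, there is no P to absorb
-- the leftmost Q; instead x (1 − λ y) u = −λ′ x Q u + (Q u − S Q u), whose last term telescopes
-- to a boundary term that tends to 0.
--
-- All entries that occur are O(n^(−1/2)), whence convergence and the vanishing of the boundary
-- terms.  Reading words backwards with x and y exchanged turns the identities for g at (k, l) into
-- those for f at (reverse l, reverse k).

open import Algebra.Bundles using (CommutativeRing)
import Algebra.Properties.Ring as RingProperties
import Algebra.Properties.Semiring.Exp as Exp
import Algebra.Solver.Ring.NaturalCoefficients.Default as SemiringSolver
open import Algebra.Structures using (IsCommutativeRing)
open import Data.Integer as ℤ using (ℤ)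
import Data.Integer.Properties as ℤₚ
open import Data.List as List using (List; []; _∷_; _++_; replicate; cartesianProductWith)
import Data.List.Properties as Listₚ
open import Data.Nat as ℕ using (ℕ; zero; suc; _∸_; _⊔_; _≤_; z≤n; s≤s)
import Data.Nat.Properties as ℕₚ
open import Data.Nat.Solver using () renaming (module +-*-Solver to ℕ-Solver)
open import Data.Product using (∃; _×_; _,_; proj₁; proj₂; swap)
open import Data.Rational as ℚ using (ℚ; 0ℚ; 1ℚ; ½)
import Data.Rational.Properties as ℚₚ
open import Data.Rational.Solver using () renaming (module +-*-Solver to ℚ-Solver)
import Data.Rational.Unnormalised as ℚᵘ
import Data.Rational.Unnormalised.Properties as ℚᵘₚ
open import Data.Sum using (inj₁; inj₂; [_,_]′)
open import Data.Vec using (Vec; []; _∷_; _∷ʳ_; map; zipWith; sum; reverse; head; last; initLast)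
import Data.Vec.Properties as Vecₚ
open import Data.Vec.Relation.Unary.All using (All; []; _∷_)
open import Defs using
  ( half-half; half-pos; *-pos; shrink; suc-/1
  ; Word; X; Y; word; exponents; Admissible; δs; εs; O; I; I^ )
open import Level using (0ℓ)
open import Relation.Binary.Bundles using (Setoid)
open import Relation.Binary.PropositionalEquality as ≡ using (_≡_; _≢_; subst; subst₂)
import Relation.Binary.Reasoning.Setoid as SetoidReasoning
open import Relation.Nullary using (contradiction)

-- The exponent -1/2 of the growth bound leaves room on both sides. Applying y to a sequence of
-- order 1/n costs a logarithm, so that order is not preserved; an order n^(-s) with 0 < s < 1 is,
-- because the partial sums are of order n^(1-s) and y divides them by n again, while one further x
-- already makes the series summable. For s = 1/2 the comparison sequence can be chosen rational:
-- `ψ n` is 2 C(2n + 2, n + 1) / 4^(n + 1), and both sums that are needed have closed forms, so no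
-- logarithm or root is ever estimated. A limit can be taken summand by summand only if every word
-- that occurs is admissible. This is why the cases are distinguished by k₁ = 1 and lₘ = 1: a letter
-- that is alone at its end of the word must not be removed. The exponent -1 in (i) also comes from
-- an end: entry 0 of Q δ₀ is 1/(1 - λ) = 1/(-λ′), and this factor is carried through the whole
-- product. From `left` and `right` on, vectors hold the numbers kᵢ - 1 and lᵢ - 1, so that k₁ = 1
-- reads as 0.

module _ where

  open ℚ-Solver

  -- Inequalities between rationals.

  0<1 : 0ℚ ℚ.< 1ℚ
  0<1 = ℚₚ.positive⁻¹ 1ℚ

  *-mono-≤ : ∀ {a b c d} → 0ℚ ℚ.≤ a → 0ℚ ℚ.≤ d → a ℚ.≤ b → c ℚ.≤ d → a ℚ.* c ℚ.≤ b ℚ.* d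
  *-mono-≤ {a} {b} {c} {d} 0≤a 0≤d a≤b c≤d = ℚₚ.≤-trans
    (ℚₚ.*-monoˡ-≤-nonNeg a {{ℚ.nonNegative 0≤a}} c≤d)
    (ℚₚ.*-monoʳ-≤-nonNeg d {{ℚ.nonNegative 0≤d}} a≤b)

  *-nonNeg : ∀ {a b} → 0ℚ ℚ.≤ a → 0ℚ ℚ.≤ b → 0ℚ ℚ.≤ a ℚ.* b
  *-nonNeg {a} {b} 0≤a 0≤b = subst (ℚ._≤ a ℚ.* b) (ℚₚ.*-zeroˡ b)
    (ℚₚ.*-monoʳ-≤-nonNeg b {{ℚ.nonNegative 0≤b}} 0≤a)

  +-nonNeg : ∀ {a b} → 0ℚ ℚ.≤ a → 0ℚ ℚ.≤ b → 0ℚ ℚ.≤ a ℚ.+ b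
  +-nonNeg {a} {b} 0≤a 0≤b = subst (ℚ._≤ a ℚ.+ b) (ℚₚ.+-identityˡ 0ℚ) (ℚₚ.+-mono-≤ 0≤a 0≤b)

  p≤p+q : ∀ {p q} → 0ℚ ℚ.≤ q → p ℚ.≤ p ℚ.+ q
  p≤p+q {p} {q} 0≤q = subst (ℚ._≤ p ℚ.+ q) (ℚₚ.+-identityʳ p) (ℚₚ.+-monoʳ-≤ p 0≤q)

  p≤q+p : ∀ {p q} → 0ℚ ℚ.≤ q → p ℚ.≤ q ℚ.+ p
  p≤q+p {p} {q} 0≤q = subst (p ℚ.≤_) (ℚₚ.+-comm p q) (p≤p+q 0≤q)

  half<self : ∀ {ε} → 0ℚ ℚ.< ε → ½ ℚ.* ε ℚ.< ε
  half<self {ε} 0<ε = subst₂ ℚ._<_ (ℚₚ.+-identityʳ (½ ℚ.* ε)) (half-half ε)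
    (ℚₚ.+-monoʳ-< (½ ℚ.* ε) (half-pos 0<ε))

  Eventually : (ℕ → Set) → Set
  Eventually P = ∃ λ N → ∀ n → N ≤ n → P n

  always : ∀ {P} → (∀ n → P n) → Eventually P
  always p = 0 , λ n _ → p n

  eventually-map : ∀ {P Q : ℕ → Set} → (∀ n → P n → Q n) → Eventually P → Eventually Q
  eventually-map f (N , p) = N , λ n N≤n → f n (p n N≤n)

  eventually-map₂ : ∀ {P Q R : ℕ → Set} → (∀ n → P n → Q n → R n) →
                    Eventually P → Eventually Q → Eventually R
  eventually-map₂ f (M , p) (N , q) = M ⊔ N , λ n l →
    f n (p n (ℕₚ.m⊔n≤o⇒m≤o M N l)) (q n (ℕₚ.m⊔n≤o⇒n≤o M N l))

  ν ρ : ℕ → ℚ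
  ν n = ℤ.+ n ℚ./ 1
  ρ n = ℤ.+ 1 ℚ./ suc n

  toℚᵘ-ρ : ∀ n → ℚ.toℚᵘ (ρ n) ℚᵘ.≃ ℚᵘ.mkℚᵘ (ℤ.+ 1) n
  toℚᵘ-ρ n = ℚₚ.toℚᵘ-fromℚᵘ (ℚᵘ.mkℚᵘ (ℤ.+ 1) n)

  ρ-inverse : ∀ n → ρ n ℚ.* ν (suc n) ≡ 1ℚ
  ρ-inverse n = ℚₚ.toℚᵘ-injective (begin
    ℚ.toℚᵘ (ρ n ℚ.* ν (suc n))                        ≈⟨ ℚₚ.toℚᵘ-homo-* (ρ n) (ν (suc n)) ⟩
    ℚ.toℚᵘ (ρ n) ℚᵘ.* ℚ.toℚᵘ (ν (suc n))              ≈⟨ ℚᵘₚ.*-cong (toℚᵘ-ρ n)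
                                                           (ℚₚ.toℚᵘ-fromℚᵘ (ℚᵘ.mkℚᵘ (ℤ.+ suc n) 0)) ⟩
    ℚᵘ.mkℚᵘ (ℤ.+ 1) n ℚᵘ.* ℚᵘ.mkℚᵘ (ℤ.+ suc n) 0      ≈⟨ ℚᵘ.*≡* (ℤₚ.*-assoc (ℤ.+ 1) (ℤ.+ suc n) (ℤ.+ 1)) ⟩
    ℚᵘ.1ℚᵘ ∎)
    where open ℚᵘₚ.≃-Reasoning

  ρ-pos : ∀ n → 0ℚ ℚ.< ρ n
  ρ-pos n = ℚₚ.positive⁻¹ (ρ n) {{ℚₚ.normalize-pos 1 (suc n)}}

  ρ-nonNeg : ∀ n → 0ℚ ℚ.≤ ρ n
  ρ-nonNeg n = ℚₚ.<⇒≤ (ρ-pos n)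

  ρ≤ : ∀ ε → 0ℚ ℚ.< ε → Eventually λ n → ρ n ℚ.≤ ε
  ρ≤ ε 0<ε = archimedean ε {{ℚ.positive 0<ε}}
    where
    archimedean : ∀ ε → .{{ℚ.Positive ε}} → Eventually λ n → ρ n ℚ.≤ ε
    -- Here ε = (m + 1)/(d + 1) is at least 1/(d + 1), so `d` itself is a threshold.
    archimedean (ℚ.mkℚ (ℤ.+ suc m) d _) = d , λ n d≤n →
      ℚₚ.toℚᵘ-cancel-≤ (ℚᵘₚ.≤-respˡ-≃ (ℚᵘₚ.≃-sym (toℚᵘ-ρ n))
        (ℚᵘ.*≤* (subst₂ ℤ._≤_ (ℤₚ.pos-* 1 (suc d)) (ℤₚ.pos-* (suc m) (suc n))
          (ℤ.+≤+ (ℕₚ.*-mono-≤ {1} {suc m} (ℕ.s≤s ℕ.z≤n) (ℕ.s≤s d≤n))))))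

  ≤-cancelʳ : ∀ a b c → a ℚ.+ c ℚ.≤ b ℚ.+ c → a ℚ.≤ b
  ≤-cancelʳ a b c h = subst₂ ℚ._≤_ (cancel a c) (cancel b c) (ℚₚ.+-monoˡ-≤ (ℚ.- c) h)
    where
    cancel : ∀ a c → a ℚ.+ c ℚ.- c ≡ a
    cancel = solve 2 (λ a c → a :+ c :- c := a) ≡.refl

  -- Half of `x` is absorbed into the left side, which leaves ½x ≤ y. This is the last step of the
  -- contraction estimate.
  ≤½⇒≤2 : ∀ {x y} → x ℚ.≤ y ℚ.+ ½ ℚ.* x → x ℚ.≤ y ℚ.+ y
  ≤½⇒≤2 {x} {y} h = subst (ℚ._≤ y ℚ.+ y) (half-half x) (ℚₚ.+-mono-≤ ½x≤y ½x≤y)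
    where
    ½x≤y : ½ ℚ.* x ℚ.≤ y
    ½x≤y = ≤-cancelʳ (½ ℚ.* x) y (½ ℚ.* x) (subst (ℚ._≤ y ℚ.+ ½ ℚ.* x) (≡.sym (half-half x)) h)

  ∣sq∣≡ : ∀ a → ℚ.∣ a ∣ ℚ.* ℚ.∣ a ∣ ≡ a ℚ.* a
  ∣sq∣≡ a with ℚₚ.∣p∣≡p∨∣p∣≡-p a
  ... | inj₁ e = ≡.cong₂ ℚ._*_ e e
  ... | inj₂ e = ≡.trans (≡.cong₂ ℚ._*_ e e) (solve 1 (λ a → :- a :* :- a := a :* a) ≡.refl a)

  sq-cancel-≤ : ∀ {a c} → 0ℚ ℚ.≤ c → a ℚ.* a ℚ.≤ c ℚ.* c → ℚ.∣ a ∣ ℚ.≤ c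
  sq-cancel-≤ {a} {c} 0≤c h = ℚₚ.≮⇒≥ λ c<∣a∣ → ℚₚ.<-irrefl ≡.refl (begin-strict
    c ℚ.* c             ≤⟨ ℚₚ.*-monoˡ-≤-nonNeg c {{ℚ.nonNegative 0≤c}} (ℚₚ.<⇒≤ c<∣a∣) ⟩
    c ℚ.* ℚ.∣ a ∣       <⟨ ℚₚ.*-monoˡ-<-pos ℚ.∣ a ∣ {{ℚ.positive (ℚₚ.≤-<-trans 0≤c c<∣a∣)}} c<∣a∣ ⟩
    ℚ.∣ a ∣ ℚ.* ℚ.∣ a ∣ ≡⟨ ∣sq∣≡ a ⟩
    a ℚ.* a             ≤⟨ h ⟩
    c ℚ.* c             ∎)
    where open ℚₚ.≤-Reasoning

-- Reciprocals 1/(n + 1) and the comparison sequence ψ.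

p≤q⇒0≤q-p : ∀ {p q} → p ℚ.≤ q → 0ℚ ℚ.≤ q ℚ.- p
p≤q⇒0≤q-p {p} {q} p≤q = subst (ℚ._≤ q ℚ.- p) (ℚₚ.+-inverseʳ p) (ℚₚ.+-monoˡ-≤ (ℚ.- p) p≤q)

ν-suc : ∀ n → ν (suc n) ≡ 1ℚ ℚ.+ ν n
ν-suc = suc-/1

ν-nonNeg : ∀ n → 0ℚ ℚ.≤ ν n
ν-nonNeg zero    = ℚₚ.≤-refl
ν-nonNeg (suc n) = subst (0ℚ ℚ.≤_) (≡.sym (ν-suc n)) (+-nonNeg (ℚₚ.<⇒≤ 0<1) (ν-nonNeg n))

ρ≤1 : ∀ n → ρ n ℚ.≤ 1ℚ
ρ≤1 n = begin
  ρ n                  ≤⟨ p≤p+q (*-nonNeg (ρ-nonNeg n) (ν-nonNeg n)) ⟩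
  ρ n ℚ.+ ρ n ℚ.* ν n  ≡⟨ expand (ρ n) (ν n) ⟩
  ρ n ℚ.* (1ℚ ℚ.+ ν n) ≡⟨ ≡.cong (ρ n ℚ.*_) (ν-suc n) ⟨
  ρ n ℚ.* ν (suc n)    ≡⟨ ρ-inverse n ⟩
  1ℚ                   ∎
  where
  open ℚₚ.≤-Reasoning
  open ℚ-Solver
  expand : ∀ r v → r ℚ.+ r ℚ.* v ≡ r ℚ.* (1ℚ ℚ.+ v)
  expand = solve 2 (λ r v → r :+ r :* v := r :* (con 1ℚ :+ v)) ≡.refl

-- The ratio of the two reciprocals is (n + 2)/(n + 1) = 1 + `ρ n`, and `ρ n` is at most 1.
ρ≤2ρ : ∀ n → ρ n ℚ.≤ ρ (suc n) ℚ.+ ρ (suc n)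
ρ≤2ρ n = begin
  r                                      ≡⟨ ℚₚ.*-identityʳ r ⟨
  r ℚ.* 1ℚ                               ≡⟨ ≡.cong (r ℚ.*_) (ρ-inverse (suc n)) ⟨
  r ℚ.* (s ℚ.* ν (suc (suc n)))          ≡⟨ ≡.cong (λ v → r ℚ.* (s ℚ.* v)) (ν-suc (suc n)) ⟩
  r ℚ.* (s ℚ.* (1ℚ ℚ.+ ν (suc n)))       ≡⟨ expand r s (ν (suc n)) ⟩
  s ℚ.* r ℚ.+ s ℚ.* (r ℚ.* ν (suc n))    ≡⟨ ≡.cong (λ x → s ℚ.* r ℚ.+ s ℚ.* x) (ρ-inverse n) ⟩
  s ℚ.* r ℚ.+ s ℚ.* 1ℚ                   ≤⟨ ℚₚ.+-monoˡ-≤ (s ℚ.* 1ℚ)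
                                              (ℚₚ.*-monoˡ-≤-nonNeg s {{ℚ.nonNegative (ρ-nonNeg (suc n))}} (ρ≤1 n)) ⟩
  s ℚ.* 1ℚ ℚ.+ s ℚ.* 1ℚ                  ≡⟨ ≡.cong₂ ℚ._+_ (ℚₚ.*-identityʳ s) (ℚₚ.*-identityʳ s) ⟩
  s ℚ.+ s ∎
  where
  open ℚₚ.≤-Reasoning
  open ℚ-Solver
  r = ρ n
  s = ρ (suc n)
  expand : ∀ r s v → r ℚ.* (s ℚ.* (1ℚ ℚ.+ v)) ≡ s ℚ.* r ℚ.+ s ℚ.* (r ℚ.* v)
  expand = solve 3 (λ r s v → r :* (s :* (con 1ℚ :+ v)) := s :* r :+ s :* (r :* v)) ≡.refl

-- A sequence of order n^(-1/2) all of whose sums telescope: with φ(n) = (n + 1) ψ(n), both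
-- ψ(n) = 2 (φ(n + 1) − φ(n)) and ψ(n) / (n + 2) = 2 (ψ(n) − ψ(n + 1)).
ψ : ℕ → ℚ
ψ zero    = 1ℚ
ψ (suc n) = ψ n ℚ.* (1ℚ ℚ.- ½ ℚ.* ρ (suc n))

½ρ≤1 : ∀ n → 0ℚ ℚ.≤ 1ℚ ℚ.- ½ ℚ.* ρ n
½ρ≤1 n = subst (0ℚ ℚ.≤_) (shape (ρ n)) (+-nonNeg
  (p≤q⇒0≤q-p (ρ≤1 n)) (*-nonNeg (ℚₚ.<⇒≤ (ℚₚ.positive⁻¹ ½)) (ρ-nonNeg n)))
  where
  open ℚ-Solver
  shape : ∀ r → (1ℚ ℚ.- r) ℚ.+ ½ ℚ.* r ≡ 1ℚ ℚ.- ½ ℚ.* r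
  shape = solve 1 (λ r → (con 1ℚ :- r) :+ con ½ :* r := con 1ℚ :- con ½ :* r) ≡.refl

ψ-nonNeg : ∀ n → 0ℚ ℚ.≤ ψ n
ψ-nonNeg zero    = ℚₚ.<⇒≤ 0<1
ψ-nonNeg (suc n) = *-nonNeg (ψ-nonNeg n) (½ρ≤1 (suc n))

φ-step : ∀ n → (ν (suc (suc n)) ℚ.* ψ (suc n)) ℚ.+ (ν (suc (suc n)) ℚ.* ψ (suc n))
             ≡ (ν (suc n) ℚ.* ψ n ℚ.+ ν (suc n) ℚ.* ψ n) ℚ.+ ψ n
φ-step n = begin
  v′ ℚ.* (p ℚ.* (1ℚ ℚ.- ½ ℚ.* s)) ℚ.+ v′ ℚ.* (p ℚ.* (1ℚ ℚ.- ½ ℚ.* s))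
    ≡⟨ expand v′ p s ⟩
  (v′ ℚ.+ v′) ℚ.* p ℚ.- (s ℚ.* v′) ℚ.* p
    ≡⟨ ≡.cong₂ (λ x y → (x ℚ.+ x) ℚ.* p ℚ.- y ℚ.* p) (ν-suc (suc n)) (ρ-inverse (suc n)) ⟩
  ((1ℚ ℚ.+ v) ℚ.+ (1ℚ ℚ.+ v)) ℚ.* p ℚ.- 1ℚ ℚ.* p
    ≡⟨ collect v p ⟩
  (v ℚ.* p ℚ.+ v ℚ.* p) ℚ.+ p ∎
  where
  open ≡.≡-Reasoning
  open ℚ-Solver
  v  = ν (suc n)
  v′ = ν (suc (suc n))
  p  = ψ n
  s  = ρ (suc n)
  expand : ∀ v p s → v ℚ.* (p ℚ.* (1ℚ ℚ.- ½ ℚ.* s)) ℚ.+ v ℚ.* (p ℚ.* (1ℚ ℚ.- ½ ℚ.* s))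
                   ≡ (v ℚ.+ v) ℚ.* p ℚ.- (s ℚ.* v) ℚ.* p
  expand = solve 3 (λ v p s →
    v :* (p :* (con 1ℚ :- con ½ :* s)) :+ v :* (p :* (con 1ℚ :- con ½ :* s))
    := (v :+ v) :* p :- (s :* v) :* p) ≡.refl
  collect : ∀ v p → ((1ℚ ℚ.+ v) ℚ.+ (1ℚ ℚ.+ v)) ℚ.* p ℚ.- 1ℚ ℚ.* p ≡ (v ℚ.* p ℚ.+ v ℚ.* p) ℚ.+ p
  collect = solve 2 (λ v p →
    ((con 1ℚ :+ v) :+ (con 1ℚ :+ v)) :* p :- con 1ℚ :* p := (v :* p :+ v :* p) :+ p) ≡.refl

2× 4× : ℚ → ℚ
2× x = x ℚ.+ x
4× x = 2× (2× x)

-- With 1/(n + 2) in place of 1/(n + 1) the difference is exact and the factor is 2; a second factor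
-- 2 pays for the replacement.
ψ-step : ∀ n → ρ n ℚ.* ψ n ℚ.≤ 4× (ψ n ℚ.- ψ (suc n))
ψ-step n = begin
  ρ n ℚ.* ψ n          ≤⟨ ℚₚ.*-monoʳ-≤-nonNeg (ψ n) {{ℚ.nonNegative (ψ-nonNeg n)}} (ρ≤2ρ n) ⟩
  (s ℚ.+ s) ℚ.* ψ n    ≡⟨ shape s (ψ n) ⟩
  4× (ψ n ℚ.- ψ (suc n)) ∎
  where
  open ℚₚ.≤-Reasoning
  open ℚ-Solver
  s = ρ (suc n)
  shape : ∀ s p → (s ℚ.+ s) ℚ.* p ≡ 4× (p ℚ.- p ℚ.* (1ℚ ℚ.- ½ ℚ.* s))
  shape = solve 2 (λ s p → let d = p :- p :* (con 1ℚ :- con ½ :* s) in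
    (s :+ s) :* p := (d :+ d) :+ (d :+ d)) ≡.refl

-- This is the order n^(-1/2) of ψ: the product ψ(n)² (n + 2) decreases, and 2 is its value at n =
-- 0.
ψ² : ∀ n → (ψ n ℚ.* ψ n) ℚ.* ν (suc (suc n)) ℚ.≤ ν 2
ψ² zero    = ℚₚ.≤-refl
ψ² (suc n) = begin
  ((p ℚ.* t) ℚ.* (p ℚ.* t)) ℚ.* ν (suc (suc (suc n)))  ≡⟨ ≡.cong (((p ℚ.* t) ℚ.* (p ℚ.* t)) ℚ.*_) (ν-suc (suc (suc n))) ⟩
  ((p ℚ.* t) ℚ.* (p ℚ.* t)) ℚ.* (1ℚ ℚ.+ v)             ≡⟨ regroup p t v ⟩
  (p ℚ.* p) ℚ.* (t ℚ.* t ℚ.* (1ℚ ℚ.+ v))               ≤⟨ ℚₚ.*-monoˡ-≤-nonNeg (p ℚ.* p)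
                                                            {{ℚ.nonNegative (*-nonNeg (ψ-nonNeg n) (ψ-nonNeg n))}} step ⟩
  (p ℚ.* p) ℚ.* v                                      ≤⟨ ψ² n ⟩
  ν 2 ∎
  where
  open ℚₚ.≤-Reasoning
  open ℚ-Solver
  p = ψ n
  s = ρ (suc n)
  v = ν (suc (suc n))
  t = 1ℚ ℚ.- ½ ℚ.* s
  regroup : ∀ p t v → ((p ℚ.* t) ℚ.* (p ℚ.* t)) ℚ.* (1ℚ ℚ.+ v) ≡ (p ℚ.* p) ℚ.* (t ℚ.* t ℚ.* (1ℚ ℚ.+ v))
  regroup = solve 3 (λ p t v → ((p :* t) :* (p :* t)) :* (con 1ℚ :+ v)
                               := (p :* p) :* (t :* t :* (con 1ℚ :+ v))) ≡.refl
  expand : ∀ s v → (1ℚ ℚ.- ½ ℚ.* s) ℚ.* (1ℚ ℚ.- ½ ℚ.* s) ℚ.* (1ℚ ℚ.+ v)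
                   ℚ.+ (½ ℚ.* s ℚ.+ ½ ℚ.* ½ ℚ.* (s ℚ.* (1ℚ ℚ.- s)))
                   ≡ v ℚ.+ (1ℚ ℚ.- s ℚ.* v) ℚ.+ ½ ℚ.* ½ ℚ.* (s ℚ.* (s ℚ.* v ℚ.- 1ℚ))
  expand = solve 2 (λ s v → (con 1ℚ :- con ½ :* s) :* (con 1ℚ :- con ½ :* s) :* (con 1ℚ :+ v)
                   :+ (con ½ :* s :+ con ½ :* con ½ :* (s :* (con 1ℚ :- s)))
                   := v :+ (con 1ℚ :- s :* v) :+ con ½ :* con ½ :* (s :* (s :* v :- con 1ℚ))) ≡.refl
  collect : ∀ s v → v ℚ.+ (1ℚ ℚ.- 1ℚ) ℚ.+ ½ ℚ.* ½ ℚ.* (s ℚ.* (1ℚ ℚ.- 1ℚ)) ≡ v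
  collect = solve 2 (λ s v → v :+ (con 1ℚ :- con 1ℚ) :+ con ½ :* con ½ :* (s :* (con 1ℚ :- con 1ℚ)) := v) ≡.refl
  0≤½ : 0ℚ ℚ.≤ ½
  0≤½ = ℚₚ.<⇒≤ (ℚₚ.positive⁻¹ ½)
  -- As s v = 1, the left side equals v - ½ s - ¼ s (1 - s). Adding this deficit, which is
  -- nonnegative because s ≤ 1, turns the inequality into the equation `expand`.
  step : t ℚ.* t ℚ.* (1ℚ ℚ.+ v) ℚ.≤ v
  step = ℚₚ.≤-trans
    (p≤p+q (+-nonNeg (*-nonNeg 0≤½ (ρ-nonNeg (suc n)))
      (*-nonNeg (*-nonNeg 0≤½ 0≤½) (*-nonNeg (ρ-nonNeg (suc n)) (p≤q⇒0≤q-p (ρ≤1 (suc n)))))))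
    (ℚₚ.≤-reflexive (≡.trans (expand s v) (≡.trans
      (≡.cong (λ x → v ℚ.+ (1ℚ ℚ.- x) ℚ.+ ½ ℚ.* ½ ℚ.* (s ℚ.* (x ℚ.- 1ℚ))) (ρ-inverse (suc n)))
      (collect s v))))

ψ→0 : ∀ ε → 0ℚ ℚ.< ε → Eventually λ n → ψ n ℚ.≤ ε
ψ→0 ε 0<ε =
  -- With 2δ = ε², the bound ψ(n)² ≤ 2/(n + 2) ≤ 2δ becomes ψ(n) ≤ ε.
  let δ , 0<δ , 2δ≡ε² = shrink {ν 2} (ℚₚ.positive⁻¹ (ν 2)) (*-pos 0<ε 0<ε)
      M , h = ρ≤ δ 0<δ
  in M , λ n l → subst (ℚ._≤ ε) (ℚₚ.0≤p⇒∣p∣≡p (ψ-nonNeg n)) (sq-cancel-≤ {ψ n} (ℚₚ.<⇒≤ 0<ε) (begin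
       ψ n ℚ.* ψ n
         ≡⟨ ℚₚ.*-identityʳ (ψ n ℚ.* ψ n) ⟨
       ψ n ℚ.* ψ n ℚ.* 1ℚ
         ≡⟨ ≡.cong (ψ n ℚ.* ψ n ℚ.*_) (ρ-inverse (suc n)) ⟨
       ψ n ℚ.* ψ n ℚ.* (ρ (suc n) ℚ.* ν (suc (suc n)))
         ≡⟨ regroup (ψ n ℚ.* ψ n) (ρ (suc n)) (ν (suc (suc n))) ⟩
       ψ n ℚ.* ψ n ℚ.* ν (suc (suc n)) ℚ.* ρ (suc n)
         ≤⟨ *-mono-≤ (*-nonNeg (*-nonNeg (ψ-nonNeg n) (ψ-nonNeg n)) (ν-nonNeg (suc (suc n))))
              (ℚₚ.<⇒≤ 0<δ) (ψ² n) (h (suc n) (ℕₚ.m≤n⇒m≤1+n l)) ⟩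
       ν 2 ℚ.* δ
         ≡⟨ 2δ≡ε² ⟩
       ε ℚ.* ε ∎))
  where
  open ℚₚ.≤-Reasoning
  open ℚ-Solver
  regroup : ∀ p r v → p ℚ.* (r ℚ.* v) ≡ p ℚ.* v ℚ.* r
  regroup = solve 3 (λ p r v → p :* (r :* v) := p :* v :* r) ≡.refl

iterate : {A : Set} → ℕ → (A → A) → A → A
iterate zero    L a = a
iterate (suc n) L a = L (iterate n L a)

iterate-suc : ∀ {A : Set} n (L : A → A) a → iterate n L (L a) ≡ L (iterate n L a)
iterate-suc zero    L a = ≡.refl
iterate-suc (suc n) L a = ≡.cong L (iterate-suc n L a)

shorten : ∀ {m} → Vec ℕ m → Vec ℕ m → Vec ℕ m → Vec ℕ m → Word
shorten k l δ ε = word (zipWith _∸_ k δ) (zipWith _∸_ l ε)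

-- Linear operators on sequences over a commutative ring.

module Sequences (R : CommutativeRing 0ℓ 0ℓ) where

  open CommutativeRing R hiding (zero)
  open SemiringSolver commutativeSemiring using (solve; con; _:=_; _:+_; _:*_)

  Seq : Set
  Seq = ℕ → Carrier

  infix  4 _≋_
  infixr 6 _⊕_
  infixr 7 _•_

  _≋_ : Seq → Seq → Set
  a ≋ b = ∀ n → a n ≈ b n

  _⊕_ : Seq → Seq → Seq
  (a ⊕ b) n = a n + b n

  _•_ : Carrier → Seq → Seq
  (c • a) n = c * a n

  ≋-setoid : Setoid 0ℓ 0ℓ
  ≋-setoid = record
    { Carrier = Seq
    ; _≈_ = _≋_
    ; isEquivalence = record
      { refl = λ n → refl ; sym = λ e n → sym (e n) ; trans = λ e e′ n → trans (e n) (e′ n) }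
    }

  module ≋ = Setoid ≋-setoid

  ⊕-cong : ∀ {a a′ b b′} → a ≋ a′ → b ≋ b′ → a ⊕ b ≋ a′ ⊕ b′
  ⊕-cong e e′ n = +-cong (e n) (e′ n)

  •-cong : ∀ c {a a′} → a ≋ a′ → c • a ≋ c • a′
  •-cong c e n = *-congˡ (e n)

  record Linear (L : Seq → Seq) : Set where
    field
      cong   : ∀ {a b} → a ≋ b → L a ≋ L b
      ⊕-homo : ∀ a b → L (a ⊕ b) ≋ L a ⊕ L b
      •-homo : ∀ c a → L (c • a) ≋ c • L a

  open Linear public

  id-linear : Linear (λ a → a)
  id-linear = record { cong = λ e → e ; ⊕-homo = λ a b n → refl ; •-homo = λ c a n → refl }

  ∘-linear : ∀ {L M} → Linear L → Linear M → Linear (λ a → L (M a))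
  ∘-linear l m = record
    { cong   = λ e → cong l (cong m e)
    ; ⊕-homo = λ a b → ≋.trans (cong l (⊕-homo m a b)) (⊕-homo l _ _)
    ; •-homo = λ c a → ≋.trans (cong l (•-homo m c a)) (•-homo l c _)
    }

  ⊕-linear : ∀ {L M} → Linear L → Linear M → Linear (λ a → L a ⊕ M a)
  ⊕-linear l m = record
    { cong   = λ e → ⊕-cong (cong l e) (cong m e)
    ; ⊕-homo = λ a b → ≋.trans (⊕-cong (⊕-homo l a b) (⊕-homo m a b)) λ n →
        solve 4 (λ s t u v → (s :+ t) :+ (u :+ v) := (s :+ u) :+ (t :+ v)) refl _ _ _ _
    ; •-homo = λ c a → ≋.trans (⊕-cong (•-homo l c a) (•-homo m c a)) λ n → sym (distribˡ c _ _)
    }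

  •-linear : ∀ x {L} → Linear L → Linear (λ a → x • L a)
  •-linear x l = record
    { cong   = λ e → •-cong x (cong l e)
    ; ⊕-homo = λ a b → ≋.trans (•-cong x (⊕-homo l a b)) λ n → distribˡ x _ _
    ; •-homo = λ c a → ≋.trans (•-cong x (•-homo l c a)) λ n →
        solve 3 (λ x c a → x :* (c :* a) := c :* (x :* a)) refl x c _
    }

  iterate-linear : ∀ n {L} → Linear L → Linear (iterate n L)
  iterate-linear zero    l = id-linear
  iterate-linear (suc n) l = ∘-linear l (iterate-linear n l)

  Σ≤ : Seq → Seq
  Σ≤ a zero    = a zero
  Σ≤ a (suc n) = Σ≤ a n + a (suc n)

  Σ≤-linear : Linear Σ≤
  Σ≤-linear = record { cong = Σ≤-cong ; ⊕-homo = Σ≤-⊕ ; •-homo = Σ≤-• }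
    where
    Σ≤-cong : ∀ {a b} → a ≋ b → Σ≤ a ≋ Σ≤ b
    Σ≤-cong e zero    = e zero
    Σ≤-cong e (suc n) = +-cong (Σ≤-cong e n) (e (suc n))
    Σ≤-⊕ : ∀ a b → Σ≤ (a ⊕ b) ≋ Σ≤ a ⊕ Σ≤ b
    Σ≤-⊕ a b zero    = refl
    Σ≤-⊕ a b (suc n) = trans (+-congʳ (Σ≤-⊕ a b n))
      (solve 4 (λ s t u v → (s :+ t) :+ (u :+ v) := (s :+ u) :+ (t :+ v)) refl
        (Σ≤ a n) (Σ≤ b n) (a (suc n)) (b (suc n)))
    Σ≤-• : ∀ c a → Σ≤ (c • a) ≋ c • Σ≤ a
    Σ≤-• c a zero    = refl
    Σ≤-• c a (suc n) = trans (+-congʳ (Σ≤-• c a n)) (sym (distribˡ c (Σ≤ a n) (a (suc n))))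

  mulTail : Seq → Seq → Seq
  mulTail r a zero    = 0#
  mulTail r a (suc n) = r n * a (suc n)

  mulTail-linear : ∀ r → Linear (mulTail r)
  mulTail-linear r = record
    { cong   = λ { e zero → refl ; e (suc n) → *-congˡ (e (suc n)) }
    ; ⊕-homo = λ { a b zero → sym (+-identityˡ 0#) ; a b (suc n) → distribˡ (r n) (a (suc n)) (b (suc n)) }
    ; •-homo = λ { c a zero → sym (zeroʳ c)
                 ; c a (suc n) → solve 3 (λ r c a → r :* (c :* a) := c :* (r :* a)) refl (r n) c (a (suc n)) }
    }

  mulSum : Seq → Seq → Seq
  mulSum q a n = q n * Σ≤ a n

  mulSum-linear : ∀ q → Linear (mulSum q)
  mulSum-linear q = record
    { cong   = λ e n → *-congˡ (cong Σ≤-linear e n)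
    ; ⊕-homo = λ a b n → trans (*-congˡ (⊕-homo Σ≤-linear a b n)) (distribˡ (q n) (Σ≤ a n) (Σ≤ b n))
    ; •-homo = λ c a n → trans (*-congˡ (•-homo Σ≤-linear c a n))
        (solve 3 (λ r c a → r :* (c :* a) := c :* (r :* a)) refl (q n) c (Σ≤ a n))
    }

  shift : Seq → Seq
  shift a zero    = 0#
  shift a (suc n) = a n

  shift-linear : Linear shift
  shift-linear = record
    { cong   = λ { e zero → refl ; e (suc n) → e n }
    ; ⊕-homo = λ { a b zero → sym (+-identityˡ 0#) ; a b (suc n) → refl }
    ; •-homo = λ { c a zero → sym (zeroʳ c) ; c a (suc n) → refl }
    }

  Σ≤-shift : ∀ a n → Σ≤ (shift a) (suc n) ≈ Σ≤ a n
  Σ≤-shift a zero    = +-identityˡ (a zero)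
  Σ≤-shift a (suc n) = +-congʳ (Σ≤-shift a n)

  δ₀ : Seq
  δ₀ zero    = 1#
  δ₀ (suc n) = 0#

  Σ≤-δ₀ : ∀ n → Σ≤ δ₀ n ≈ 1#
  Σ≤-δ₀ zero    = refl
  Σ≤-δ₀ (suc n) = trans (+-identityʳ (Σ≤ δ₀ n)) (Σ≤-δ₀ n)

  -- The n-th entry of act r q w δ₀ is the part n₁ = n of the nested sum of the word w,
  -- with r n and q n for 1 / (n + 1) and 1 / (n + 1 − λ); entry 0 stands for the empty sum.
  act : Seq → Seq → Word → Seq → Seq
  act r q []      a = a
  act r q (X ∷ w) a = mulTail r (act r q w a)
  act r q (Y ∷ w) a = shift (mulSum q (act r q w a))

  act-++ : ∀ r q v w a → act r q (v ++ w) a ≡ act r q v (act r q w a)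
  act-++ r q []      w a = ≡.refl
  act-++ r q (X ∷ v) w a = ≡.cong (mulTail r) (act-++ r q v w a)
  act-++ r q (Y ∷ v) w a = ≡.cong (λ b → shift (mulSum q b)) (act-++ r q v w a)

  act-Xs : ∀ r q k a → act r q (replicate k X) a ≡ iterate k (mulTail r) a
  act-Xs r q zero    a = ≡.refl
  act-Xs r q (suc k) a = ≡.cong (mulTail r) (act-Xs r q k a)

  act-Ys : ∀ r q k a → act r q (replicate k Y) a ≡ iterate k (λ b → shift (mulSum q b)) a
  act-Ys r q zero    a = ≡.refl
  act-Ys r q (suc k) a = ≡.cong (λ b → shift (mulSum q b)) (act-Ys r q k a)

  Block : Set
  Block = ℕ → ℕ → ℕ × ℕ → Seq → Seq

  -- One summand of an identity, as a composite of operators in which each pair (δᵢ, εᵢ) influences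
  -- a single factor. Only this independence allows the sum over all choices to factor.
  run : ∀ {n} → Block → Vec ℕ n → Vec ℕ n → Vec (ℕ × ℕ) n → Seq → Seq
  run b []       []       []      a = a
  run b (k ∷ ks) (l ∷ ls) (c ∷ p) a = b k l c (run b ks ls p a)

  -- The sum over p ∈ Iⁿ of ζ^(n − |p|) h(p).
  weighted : Carrier → ∀ n → (Vec (ℕ × ℕ) n → Carrier) → Carrier
  weighted ζ zero    h = h []
  weighted ζ (suc n) h = ζ * weighted ζ n (λ p → h ((0 , 0) ∷ p))
    + (weighted ζ n (λ p → h ((1 , 0) ∷ p)) + weighted ζ n (λ p → h ((0 , 1) ∷ p)))

  weighted-cong : ∀ ζ n {h h′} → (∀ p → h p ≈ h′ p) → weighted ζ n h ≈ weighted ζ n h′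
  weighted-cong ζ zero    e = e []
  weighted-cong ζ (suc n) e = +-cong (*-congˡ (weighted-cong ζ n λ p → e ((0 , 0) ∷ p)))
    (+-cong (weighted-cong ζ n λ p → e ((1 , 0) ∷ p)) (weighted-cong ζ n λ p → e ((0 , 1) ∷ p)))

  total : Carrier → (ℕ × ℕ → Seq → Seq) → Seq → Seq
  total ζ b a = ζ • b (0 , 0) a ⊕ b (1 , 0) a ⊕ b (0 , 1) a

  totals : ∀ {n} → Carrier → Block → Vec ℕ n → Vec ℕ n → Seq → Seq
  totals ζ b []       []       a = a
  totals ζ b (k ∷ ks) (l ∷ ls) a = total ζ (b k l) (totals ζ b ks ls a)

  -- Distributivity: since blocks are linear, the sum of the composites is the composite of the
  -- blockwise sums. The outer `L` is arbitrary so that the induction can move the first block into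
  -- it.
  weighted-run : ∀ {n} ζ b {L} (ks ls : Vec ℕ n) → (∀ k l c → Linear (b k l c)) → Linear L → ∀ a N →
                 weighted ζ n (λ p → L (run b ks ls p a) N) ≈ L (totals ζ b ks ls a) N
  weighted-run {zero}  ζ b     []       []       lin l a N = refl
  weighted-run {suc n} ζ b {L} (k ∷ ks) (m ∷ ms) lin l a N = begin
    ζ * weighted ζ n (λ p → L (b k m (0 , 0) (run b ks ms p a)) N)
      + (weighted ζ n (λ p → L (b k m (1 , 0) (run b ks ms p a)) N)
         + weighted ζ n (λ p → L (b k m (0 , 1) (run b ks ms p a)) N))
      ≈⟨ +-cong (*-congˡ (rec (0 , 0))) (+-cong (rec (1 , 0)) (rec (0 , 1))) ⟩
    ζ * L (b k m (0 , 0) t) N + (L (b k m (1 , 0) t) N + L (b k m (0 , 1) t) N)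
      ≈⟨ +-cong (•-homo l ζ (b k m (0 , 0) t) N) (⊕-homo l (b k m (1 , 0) t) (b k m (0 , 1) t) N) ⟨
    L (ζ • b k m (0 , 0) t) N + L (b k m (1 , 0) t ⊕ b k m (0 , 1) t) N
      ≈⟨ ⊕-homo l (ζ • b k m (0 , 0) t) (b k m (1 , 0) t ⊕ b k m (0 , 1) t) N ⟨
    L (total ζ (b k m) t) N ∎
    where
    open SetoidReasoning setoid
    t = totals ζ b ks ms a
    rec : ∀ c → weighted ζ n (λ p → L (b k m c (run b ks ms p a)) N) ≈ L (b k m c t) N
    rec c = weighted-run ζ b ks ms lin (∘-linear l (lin k m c)) a N

  run-linear : ∀ {n} b (ks ls : Vec ℕ n) → (∀ k l c → Linear (b k l c)) → ∀ p → Linear (run b ks ls p)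
  run-linear b []       []       lin []      = id-linear
  run-linear b (k ∷ ks) (l ∷ ls) lin (c ∷ p) = ∘-linear (lin k l c) (run-linear b ks ls lin p)

  -- The sum over δ ∈ {0, 1} of ζ^(1 − δ) t(δ).
  weighted₂ : Carrier → (ℕ → Carrier) → Carrier
  weighted₂ ζ t = ζ * t 0 + t 1

  weighted₂-cong : ∀ ζ {t t′} → (∀ i → t i ≈ t′ i) → weighted₂ ζ t ≈ weighted₂ ζ t′
  weighted₂-cong ζ e = +-cong (*-congˡ (e 0)) (e 1)

  weighted₂-linear : ∀ ζ {L} → Linear L → ∀ (v : ℕ → Seq) N →
                     weighted₂ ζ (λ i → L (v i) N) ≈ L (ζ • v 0 ⊕ v 1) N
  weighted₂-linear ζ {L} l v N = sym (trans (⊕-homo l (ζ • v 0) (v 1) N) (+-congʳ (•-homo l ζ (v 0) N)))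

  total-linear : ∀ ζ {L} → Linear L → ∀ a b c → ζ • L a ⊕ L b ⊕ L c ≋ L (ζ • a ⊕ b ⊕ c)
  total-linear ζ {L} l a b c n = sym (trans (⊕-homo l (ζ • a) (b ⊕ c) n)
    (+-cong (•-homo l ζ a n) (⊕-homo l b c n)))

  -- The evaluation `h` of words is left open because the same expressions are needed twice: with
  -- truncated sums for the finite identities, and with the values of the series for their limits.
  module Sides (ζ : Carrier) (h : Word → Carrier) where

    left-i right-i left-ii right-ii left-iii right-iii :
      ∀ {n} → Vec ℕ (suc n) → Vec ℕ (suc n) → Carrier
    left-i {n} k l = weighted ζ (suc n) λ p → h (shorten k l (δs p) (εs p))
    -- There are m + 1 choices here, so each power of ζ is one higher than in the statement; the
    -- factor 1/ζ is restored separately.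
    right-i {n} k l = weighted₂ ζ λ δ → weighted ζ n λ p → weighted₂ ζ λ ε →
      h (shorten k l (δ ∷ δs p) (εs p ∷ʳ ε))
    left-ii {n} k l = weighted₂ ζ λ ε → weighted ζ n λ p → h (shorten k l (0 ∷ δs p) (ε ∷ εs p))
    right-ii {n} k l = weighted ζ n λ p → weighted₂ ζ λ ε → h (shorten k l (0 ∷ δs p) (εs p ∷ʳ ε))
    left-iii {n} k l = weighted ζ n λ p → weighted₂ ζ λ δ → h (shorten k l (δs p ∷ʳ δ) (εs p ∷ʳ 0))
    right-iii {n} k l = weighted₂ ζ λ δ → weighted ζ n λ p → h (shorten k l (δ ∷ δs p) (εs p ∷ʳ 0))

    left-iv right-iv : ∀ {n} → Vec ℕ (suc (suc n)) → Vec ℕ (suc (suc n)) → Carrier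
    left-iv {n} k l = weighted₂ ζ λ ε → weighted ζ n λ p → weighted₂ ζ λ δ →
      h (shorten k l (0 ∷ (δs p ∷ʳ δ)) (ε ∷ (εs p ∷ʳ 0)))
    -- Only m - 1 pairs are chosen while the exponents count from m, hence the additional ζ.
    right-iv {n} k l = ζ * weighted ζ (suc n) λ p → h (shorten k l (0 ∷ δs p) (εs p ∷ʳ 0))

  -- r n, q n, q′ n, μ, μ′ stand for 1 / (n + 1), 1 / (n + 1 − λ), 1 / (n + 1 − λ′), −λ, −λ′, so
  -- that all identities are semiring identities.
  module Intertwining
    (r q q′ : Seq) (μ μ′ : Carrier)
    (q≈r  : ∀ n → q n * (1# + μ * r n) ≈ r n)
    (q⁺≈r : ∀ n → q (suc n) * (1# + μ′ * r n) ≈ r n)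
    (q₀   : q 0 * μ′ ≈ 1#)
    (q′≈q : ∀ n → q′ n ≈ q (suc n))
    where

    -- Operator identities between λ and λ′.

    𝒳 𝒴 𝒴′ 𝒬 𝒫 𝒯 𝒯′ : Seq → Seq
    𝒳    = mulTail r
    𝒴 a  = shift (mulSum q a)
    𝒴′ a = shift (mulSum q′ a)
    𝒬    = mulSum q
    𝒫 a  = a ⊕ μ′ • 𝒳 a
    𝒯 a  = μ • 𝒳 (𝒴 a) ⊕ 𝒴 a ⊕ 𝒳 a
    𝒯′ a = μ′ • 𝒴′ (𝒳 a) ⊕ 𝒴′ a ⊕ 𝒳 a

    𝒳-linear : Linear 𝒳
    𝒳-linear = mulTail-linear r

    𝒴-linear : Linear 𝒴
    𝒴-linear = ∘-linear shift-linear (mulSum-linear q)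

    𝒴′-linear : Linear 𝒴′
    𝒴′-linear = ∘-linear shift-linear (mulSum-linear q′)

    𝒫-linear : Linear 𝒫
    𝒫-linear = ⊕-linear id-linear (•-linear μ′ 𝒳-linear)

    𝒯-linear : Linear 𝒯
    𝒯-linear = ⊕-linear (•-linear μ (∘-linear 𝒳-linear 𝒴-linear)) (⊕-linear 𝒴-linear 𝒳-linear)

    𝒯′-linear : Linear 𝒯′
    𝒯′-linear = ⊕-linear (•-linear μ′ (∘-linear 𝒴′-linear 𝒳-linear)) (⊕-linear 𝒴′-linear 𝒳-linear)

    -- 𝒯 = 𝒫 𝒬 and 𝒯′ = 𝒬 𝒫 fail at entry 0, where 𝒳 kills δ₀ for want of an inverse of 0.
    Vanishing : Seq → Set
    Vanishing a = a 0 ≈ 0#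

    iterate-vanishing : ∀ n L {a} → (∀ b → Vanishing (L b)) → Vanishing a → Vanishing (iterate n L a)
    iterate-vanishing zero    L h v = v
    iterate-vanishing (suc n) L h v = h (iterate n L _)

    𝒳ⁿ-vanishing : ∀ n {a} → Vanishing a → Vanishing (iterate n 𝒳 a)
    𝒳ⁿ-vanishing n = iterate-vanishing n 𝒳 (λ _ → refl)

    𝒴ⁿ-vanishing : ∀ n {a} → Vanishing a → Vanishing (iterate n 𝒴 a)
    𝒴ⁿ-vanishing n = iterate-vanishing n 𝒴 (λ _ → refl)

    𝒬-vanishing : ∀ {a} → Vanishing a → Vanishing (𝒬 a)
    𝒬-vanishing v = trans (*-congˡ v) (zeroʳ (q 0))

    𝒫-vanishing : ∀ {a} → Vanishing a → Vanishing (𝒫 a)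
    𝒫-vanishing v = trans (+-cong v (zeroʳ μ′)) (+-identityˡ 0#)

    𝒯-vanishing : ∀ a → Vanishing (𝒯 a)
    𝒯-vanishing a = trans (+-cong (zeroʳ μ) (+-identityˡ 0#)) (+-identityˡ 0#)

    𝒯′-vanishing : ∀ a → Vanishing (𝒯′ a)
    𝒯′-vanishing a = trans (+-cong (zeroʳ μ′) (+-identityˡ 0#)) (+-identityˡ 0#)

    𝒴′≋𝒬∘shift : ∀ a → 𝒴′ a ≋ 𝒬 (shift a)
    𝒴′≋𝒬∘shift a zero    = sym (zeroʳ (q 0))
    𝒴′≋𝒬∘shift a (suc n) = *-cong (q′≈q n) (sym (Σ≤-shift a n))

    𝒬∘𝒴 : ∀ a → 𝒬 (𝒴 a) ≋ 𝒴′ (𝒬 a)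
    𝒬∘𝒴 a = ≋.sym (𝒴′≋𝒬∘shift (𝒬 a))

    𝒬∘𝒴ⁿ : ∀ n a → 𝒬 (iterate n 𝒴 a) ≋ iterate n 𝒴′ (𝒬 a)
    𝒬∘𝒴ⁿ zero    a = ≋.refl
    𝒬∘𝒴ⁿ (suc n) a = ≋.trans (𝒬∘𝒴 (iterate n 𝒴 a)) (cong 𝒴′-linear (𝒬∘𝒴ⁿ n a))

    𝒫∘𝒳 : ∀ a → 𝒫 (𝒳 a) ≋ 𝒳 (𝒫 a)
    𝒫∘𝒳 a = ≋.sym (≋.trans (⊕-homo 𝒳-linear a (μ′ • 𝒳 a))
      (⊕-cong ≋.refl (•-homo 𝒳-linear μ′ (𝒳 a))))

    𝒫∘𝒳ⁿ : ∀ n a → 𝒫 (iterate n 𝒳 a) ≋ iterate n 𝒳 (𝒫 a)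
    𝒫∘𝒳ⁿ zero    a = ≋.refl
    𝒫∘𝒳ⁿ (suc n) a = ≋.trans (𝒫∘𝒳 (iterate n 𝒳 a)) (cong 𝒳-linear (𝒫∘𝒳ⁿ n a))

    q⁺-split : ∀ n x → q (suc n) * x + μ′ * (r n * (q (suc n) * x)) ≈ r n * x
    q⁺-split n x = trans
      (solve 4 (λ m r q x → q :* x :+ m :* (r :* (q :* x)) := (q :* (con 1 :+ m :* r)) :* x) refl
        μ′ (r n) (q (suc n)) x)
      (*-congʳ (q⁺≈r n))

    q-split : ∀ n x → μ * (r n * (q n * x)) + q n * x ≈ r n * x
    q-split n x = trans
      (solve 4 (λ m r q x → m :* (r :* (q :* x)) :+ q :* x := (q :* (con 1 :+ m :* r)) :* x) refl
        μ (r n) (q n) x)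
      (*-congʳ (q≈r n))

    𝒯≋𝒫∘𝒬 : ∀ {a} → Vanishing a → 𝒯 a ≋ 𝒫 (𝒬 a)
    𝒯≋𝒫∘𝒬 {a} v zero    = trans (𝒯-vanishing a) (sym (𝒫-vanishing {𝒬 a} (𝒬-vanishing {a} v)))
    𝒯≋𝒫∘𝒬 {a} v (suc n) = begin
      μ * (r n * (q n * s)) + (q n * s + r n * b) ≈⟨ +-assoc _ _ _ ⟨
      μ * (r n * (q n * s)) + q n * s + r n * b   ≈⟨ +-congʳ (q-split n s) ⟩
      r n * s + r n * b                           ≈⟨ distribˡ (r n) s b ⟨
      r n * (s + b)                               ≈⟨ q⁺-split n (s + b) ⟨
      𝒫 (𝒬 a) (suc n)                             ∎
      where
      open SetoidReasoning setoid
      s = Σ≤ a n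
      b = a (suc n)

    𝒯′≋𝒬∘𝒫 : ∀ {a} → Vanishing a → 𝒯′ a ≋ 𝒬 (𝒫 a)
    𝒯′≋𝒬∘𝒫 {a} v zero    = trans (𝒯′-vanishing a) (sym (𝒬-vanishing {𝒫 a} (𝒫-vanishing {a} v)))
    𝒯′≋𝒬∘𝒫 {a} v (suc n) = begin
      μ′ * (q′ n * t) + (q′ n * s + r n * b)
        ≈⟨ +-cong (*-congˡ (*-congʳ (q′≈q n))) (+-cong (*-congʳ (q′≈q n)) (sym (q⁺-split n b))) ⟩
      μ′ * (q⁺ * t) + (q⁺ * s + (q⁺ * b + μ′ * (r n * (q⁺ * b))))
        ≈⟨ solve 6 (λ m r q s b t → m :* (q :* t) :+ (q :* s :+ (q :* b :+ m :* (r :* (q :* b))))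
                     := q :* ((s :+ m :* t) :+ (b :+ m :* (r :* b)))) refl μ′ (r n) q⁺ s b t ⟩
      q⁺ * ((s + μ′ * t) + (b + μ′ * (r n * b)))
        ≈⟨ *-congˡ (+-congʳ (trans (⊕-homo Σ≤-linear a (μ′ • 𝒳 a) n)
             (+-congˡ (•-homo Σ≤-linear μ′ (𝒳 a) n)))) ⟨
      𝒬 (𝒫 a) (suc n) ∎
      where
      open SetoidReasoning setoid
      s = Σ≤ a n
      t = Σ≤ (𝒳 a) n
      b = a (suc n)
      q⁺ = q (suc n)

    -- All partial sums of `δ₀` are 1, so 𝒬 δ₀ and 𝒴′ δ₀ agree beyond entry 0. Entry 0 of 𝒬 δ₀ is
    -- `q 0`, the inverse of μ′, which is taken out as a common factor.
    𝒬δ₀ : 𝒬 δ₀ ≋ q 0 • (δ₀ ⊕ μ′ • 𝒴′ δ₀)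
    𝒬δ₀ zero    = *-congˡ (sym (trans (+-congˡ (zeroʳ μ′)) (+-identityʳ 1#)))
    𝒬δ₀ (suc n) = begin
      q (suc n) * Σ≤ δ₀ (suc n)          ≈⟨ *-cong (sym (q′≈q n)) (+-identityʳ _) ⟩
      q′ n * Σ≤ δ₀ n                     ≈⟨ *-identityˡ _ ⟨
      1# * (q′ n * Σ≤ δ₀ n)              ≈⟨ *-congʳ q₀ ⟨
      q 0 * μ′ * (q′ n * Σ≤ δ₀ n)        ≈⟨ *-assoc _ _ _ ⟩
      q 0 * (μ′ * (q′ n * Σ≤ δ₀ n))      ≈⟨ *-congˡ (+-identityˡ _) ⟨
      q 0 * (0# + μ′ * (q′ n * Σ≤ δ₀ n)) ∎
      where open SetoidReasoning setoid

    -- At entry n ≥ 1 both (1 - λ/n)/(n - λ) and (1 - λ′/n)/(n - λ′) are 1/n.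
    𝒴δ₀ : 𝒴 δ₀ ⊕ μ • 𝒳 (𝒴 δ₀) ≋ 𝒫 (𝒴′ δ₀)
    𝒴δ₀ zero    = +-congˡ (trans (zeroʳ μ) (sym (zeroʳ μ′)))
    𝒴δ₀ (suc n) = begin
      q n * s + μ * (r n * (q n * s))               ≈⟨ +-comm _ _ ⟩
      μ * (r n * (q n * s)) + q n * s               ≈⟨ q-split n s ⟩
      r n * s                                       ≈⟨ q⁺-split n s ⟨
      q (suc n) * s + μ′ * (r n * (q (suc n) * s))  ≈⟨ +-cong (*-congʳ (q′≈q n))
                                                         (*-congˡ (*-congˡ (*-congʳ (q′≈q n)))) ⟨
      𝒫 (𝒴′ δ₀) (suc n)                             ∎
      where
      open SetoidReasoning setoid
      s = Σ≤ δ₀ n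

    Σ≤-𝒳𝒬 : ∀ {u} → Vanishing u → ∀ N →
             Σ≤ (𝒳 (u ⊕ μ • 𝒴 u)) N ≈ μ′ * Σ≤ (𝒳 (𝒬 u)) N + 𝒬 u N
    Σ≤-𝒳𝒬 {u} v zero    = sym (trans (+-cong (zeroʳ μ′) (𝒬-vanishing {u} v)) (+-identityˡ 0#))
    Σ≤-𝒳𝒬 {u} v (suc n) = begin
      Σ≤ (𝒳 (u ⊕ μ • 𝒴 u)) n + r n * (b + μ * (q n * s))
        ≈⟨ +-congʳ (Σ≤-𝒳𝒬 {u} v n) ⟩
      (μ′ * t + q n * s) + r n * (b + μ * (q n * s))
        ≈⟨ solve 6 (λ t q s r b m → (t :+ q :* s) :+ r :* (b :+ m :* (q :* s))
                    := (t :+ r :* b) :+ (m :* (r :* (q :* s)) :+ q :* s))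
             refl (μ′ * t) (q n) s (r n) b μ ⟩
      (μ′ * t + r n * b) + (μ * (r n * (q n * s)) + q n * s)
        -- The old boundary term `q n * s` combines with the new contribution of 𝒴 u to `r n * s`.
        -- Together with `r n * b` this is split again, now with q (suc n), and the next boundary
        -- term appears.
        ≈⟨ +-congˡ (q-split n s) ⟩
      (μ′ * t + r n * b) + r n * s
        ≈⟨ solve 4 (λ t r b s → (t :+ r :* b) :+ r :* s := t :+ r :* (s :+ b)) refl (μ′ * t) (r n) b s ⟩
      μ′ * t + r n * (s + b)
        ≈⟨ +-congˡ (q⁺-split n (s + b)) ⟨
      μ′ * t + (q⁺ * (s + b) + μ′ * (r n * (q⁺ * (s + b))))
        ≈⟨ solve 4 (λ m t x y → m :* t :+ (x :+ m :* y) := m :* (t :+ y) :+ x)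
             refl μ′ t (q⁺ * (s + b)) (r n * (q⁺ * (s + b))) ⟩
      μ′ * (t + r n * (q⁺ * (s + b))) + q⁺ * (s + b) ∎
      where
      open SetoidReasoning setoid
      s = Σ≤ u n
      b = u (suc n)
      t = Σ≤ (𝒳 (𝒬 u)) n
      q⁺ = q (suc n)

    -- Both vectors hold predecessors: the remaining x and y of each block, with the three ways to
    -- keep or remove them, are what 𝒯 sums up.
    left : ∀ {n} → Vec ℕ n → Vec ℕ n → Seq → Seq
    left []       []       a = a
    left (k ∷ ks) (l ∷ ls) a = iterate k 𝒳 (𝒯 (iterate l 𝒴 (left ks ls a)))

    right : ∀ {n} → Vec ℕ n → Vec ℕ n → Seq → Seq
    right []       []       a = a
    right (l ∷ ls) (k ∷ ks) a = iterate l 𝒴′ (𝒯′ (iterate k 𝒳 (right ls ks a)))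

    left-linear : ∀ {n} (ks ls : Vec ℕ n) → Linear (left ks ls)
    left-linear []       []       = id-linear
    left-linear (k ∷ ks) (l ∷ ls) = ∘-linear (iterate-linear k 𝒳-linear)
      (∘-linear 𝒯-linear (∘-linear (iterate-linear l 𝒴-linear) (left-linear ks ls)))

    right-linear : ∀ {n} (ls ks : Vec ℕ n) → Linear (right ls ks)
    right-linear []       []       = id-linear
    right-linear (l ∷ ls) (k ∷ ks) = ∘-linear (iterate-linear l 𝒴′-linear)
      (∘-linear 𝒯′-linear (∘-linear (iterate-linear k 𝒳-linear) (right-linear ls ks)))

    left-vanishing : ∀ {n} (ks ls : Vec ℕ n) {a} → Vanishing a → Vanishing (left ks ls a)
    left-vanishing []       []       v = v
    left-vanishing (k ∷ ks) (l ∷ ls) {a} v = 𝒳ⁿ-vanishing k (𝒯-vanishing (iterate l 𝒴 (left ks ls a)))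

    right-vanishing : ∀ {n} (ls ks : Vec ℕ n) {a} → Vanishing a → Vanishing (right ls ks a)
    right-vanishing []       []       v = v
    right-vanishing (l ∷ ls) (k ∷ ks) {a} v =
      iterate-vanishing l 𝒴′ (λ _ → refl) (𝒯′-vanishing (iterate k 𝒳 (right ls ks a)))

    -- The 𝒬 in front passes y^l₁ and is stopped by x^k. There the 𝒫 of the next 𝒯 = 𝒫 𝒬 comes to
    -- meet it, which gives 𝒬 𝒫 = 𝒯′, and the 𝒬 of that 𝒯 goes on to the right in the same way. Each
    -- l is thereby joined to the k after it, so the l's are read again with their last entry split
    -- off. Vanishing belongs to the conclusion because factoring the next 𝒯 outwards requires it.
    𝒬-left : ∀ {n} (ks ls : Vec ℕ n) l₁ ls⁻ lₘ {a} → l₁ ∷ ls ≡ ls⁻ ∷ʳ lₘ →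
             Vanishing (iterate lₘ 𝒴 a) →
             Vanishing (iterate l₁ 𝒴 (left ks ls a)) ×
             𝒬 (iterate l₁ 𝒴 (left ks ls a)) ≋ right ls⁻ ks (iterate lₘ 𝒴′ (𝒬 a))
    𝒬-left []       []       l₁ []        .l₁ {a} ≡.refl v = v , 𝒬∘𝒴ⁿ l₁ a
    𝒬-left (k ∷ ks) (l ∷ ls) l₁ (l₁′ ∷ ls⁻) lₘ {a} e v with Vecₚ.∷-injective e
    ... | ≡.refl , e′ with 𝒬-left ks ls l ls⁻ lₘ e′ v
    ... | v′ , ih = 𝒴ⁿ-vanishing l₁ {iterate k 𝒳 (𝒯 u)} (𝒳ⁿ-vanishing k {𝒯 u} (𝒯-vanishing u)) , (begin
      𝒬 (iterate l₁ 𝒴 (iterate k 𝒳 (𝒯 u)))       ≈⟨ 𝒬∘𝒴ⁿ l₁ _ ⟩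
      iterate l₁ 𝒴′ (𝒬 (iterate k 𝒳 (𝒯 u)))      ≈⟨ cong 𝒴ⁿ (cong (mulSum-linear q) (begin
        iterate k 𝒳 (𝒯 u)                        ≈⟨ cong 𝒳ⁿ (𝒯≋𝒫∘𝒬 {u} v′) ⟩
        iterate k 𝒳 (𝒫 (𝒬 u))                    ≈⟨ 𝒫∘𝒳ⁿ k (𝒬 u) ⟨
        𝒫 (iterate k 𝒳 (𝒬 u))                    ∎)) ⟩
      iterate l₁ 𝒴′ (𝒬 (𝒫 (iterate k 𝒳 (𝒬 u))))  ≈⟨ cong 𝒴ⁿ (𝒯′≋𝒬∘𝒫 (𝒳ⁿ-vanishing k {𝒬 u} (𝒬-vanishing {u} v′))) ⟨
      iterate l₁ 𝒴′ (𝒯′ (iterate k 𝒳 (𝒬 u)))     ≈⟨ cong 𝒴ⁿ (cong 𝒯′-linear (cong 𝒳ⁿ ih)) ⟩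
      right (l₁ ∷ ls⁻) (k ∷ ks) (iterate lₘ 𝒴′ (𝒬 a)) ∎)
      where
      open SetoidReasoning ≋-setoid
      u = iterate l 𝒴 (left ks ls a)
      𝒴ⁿ = iterate-linear l₁ 𝒴′-linear
      𝒳ⁿ = iterate-linear k 𝒳-linear

    𝒬∘𝒴ⁿ∘𝒫∘𝒳ⁿ : ∀ l k {a} → Vanishing a →
      𝒬 (iterate l 𝒴 (𝒫 (iterate k 𝒳 a))) ≋ iterate l 𝒴′ (𝒯′ (iterate k 𝒳 a))
    𝒬∘𝒴ⁿ∘𝒫∘𝒳ⁿ l k {a} v = ≋.trans (𝒬∘𝒴ⁿ l (𝒫 (iterate k 𝒳 a)))
      (cong (iterate-linear l 𝒴′-linear) (≋.sym (𝒯′≋𝒬∘𝒫 (𝒳ⁿ-vanishing k {a} v))))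

    -- The companion of `𝒬-left` for a 𝒫 that enters from the right: it passes x^kₘ, meets the 𝒬 of
    -- the 𝒯 before it to form 𝒬 𝒫 = 𝒯′, and the 𝒫 of that 𝒯 continues to the left.
    left-𝒫 : ∀ {n} (ks⁻ ls : Vec ℕ n) kₘ k₁ ks {a} → ks⁻ ∷ʳ kₘ ≡ k₁ ∷ ks → Vanishing a →
             left ks⁻ ls (iterate kₘ 𝒳 (𝒫 a)) ≋ 𝒫 (iterate k₁ 𝒳 (right ls ks a))
    left-𝒫 []        []       kₘ .kₘ []        {a} ≡.refl v = ≋.sym (𝒫∘𝒳ⁿ kₘ a)
    left-𝒫 (k₁′ ∷ ks⁻) (l ∷ ls) kₘ k₁ (k₂ ∷ ks) {a} e v with Vecₚ.∷-injective e
    ... | ≡.refl , e′ = begin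
      iterate k₁ 𝒳 (𝒯 (iterate l 𝒴 (left ks⁻ ls (iterate kₘ 𝒳 (𝒫 a)))))
        ≈⟨ cong 𝒳ⁿ (cong 𝒯-linear (cong (iterate-linear l 𝒴-linear) (left-𝒫 ks⁻ ls kₘ k₂ ks e′ v))) ⟩
      iterate k₁ 𝒳 (𝒯 (iterate l 𝒴 (𝒫 (iterate k₂ 𝒳 u))))
        ≈⟨ cong 𝒳ⁿ (𝒯≋𝒫∘𝒬 (𝒴ⁿ-vanishing l {𝒫 (iterate k₂ 𝒳 u)} (𝒫-vanishing {iterate k₂ 𝒳 u} (𝒳ⁿ-vanishing k₂ {u} v′)))) ⟩
      iterate k₁ 𝒳 (𝒫 (𝒬 (iterate l 𝒴 (𝒫 (iterate k₂ 𝒳 u)))))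
        ≈⟨ cong 𝒳ⁿ (cong 𝒫-linear (𝒬∘𝒴ⁿ∘𝒫∘𝒳ⁿ l k₂ {u} v′)) ⟩
      iterate k₁ 𝒳 (𝒫 (right (l ∷ ls) (k₂ ∷ ks) a))
        ≈⟨ 𝒫∘𝒳ⁿ k₁ _ ⟨
      𝒫 (iterate k₁ 𝒳 (right (l ∷ ls) (k₂ ∷ ks) a)) ∎
      where
      open SetoidReasoning ≋-setoid
      u = right ls ks a
      v′ = right-vanishing ls ks {a} v
      𝒳ⁿ = iterate-linear k₁ 𝒳-linear

    -- A primed pair (δ′ⱼ, ε′ⱼ) acts on kⱼ and lⱼ₋₁. These exponents belong to different index pairs
    -- but to neighbouring powers y^lⱼ₋₁ x^kⱼ, so a block on the right begins with y.
    blockˡ blockʳ : Block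
    blockˡ k l (δ , ε) a = iterate (suc k ∸ δ) 𝒳 (iterate (suc l ∸ ε) 𝒴 a)
    blockʳ l k (δ , ε) a = iterate (suc l ∸ ε) 𝒴′ (iterate (suc k ∸ δ) 𝒳 a)

    blockˡ-linear : ∀ k l c → Linear (blockˡ k l c)
    blockˡ-linear k l (δ , ε) =
      ∘-linear (iterate-linear (suc k ∸ δ) 𝒳-linear) (iterate-linear (suc l ∸ ε) 𝒴-linear)

    blockʳ-linear : ∀ l k c → Linear (blockʳ l k c)
    blockʳ-linear l k (δ , ε) =
      ∘-linear (iterate-linear (suc l ∸ ε) 𝒴′-linear) (iterate-linear (suc k ∸ δ) 𝒳-linear)

    totals-blockˡ : ∀ {n} (ks ls : Vec ℕ n) a → totals μ blockˡ ks ls a ≋ left ks ls a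
    totals-blockˡ []       []       a = ≋.refl
    totals-blockˡ (k ∷ ks) (l ∷ ls) a = begin
      μ • 𝒳 (𝒳ᵏ (𝒴 (𝒴ˡ t))) ⊕ 𝒳ᵏ (𝒴 (𝒴ˡ t)) ⊕ 𝒳 (𝒳ᵏ (𝒴ˡ t))
        -- The outermost x is moved inwards, to the junction of the powers of x and y, where the
        -- three choices add up to 𝒯.
        ≡⟨ ≡.cong₂ (λ x y → μ • x ⊕ 𝒳ᵏ (𝒴 (𝒴ˡ t)) ⊕ y)
             (iterate-suc k 𝒳 (𝒴 (𝒴ˡ t))) (iterate-suc k 𝒳 (𝒴ˡ t)) ⟨
      μ • 𝒳ᵏ (𝒳 (𝒴 (𝒴ˡ t))) ⊕ 𝒳ᵏ (𝒴 (𝒴ˡ t)) ⊕ 𝒳ᵏ (𝒳 (𝒴ˡ t))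
        ≈⟨ total-linear μ (iterate-linear k 𝒳-linear) (𝒳 (𝒴 (𝒴ˡ t))) (𝒴 (𝒴ˡ t)) (𝒳 (𝒴ˡ t)) ⟩
      𝒳ᵏ (𝒯 (𝒴ˡ t))
        ≈⟨ cong (iterate-linear k 𝒳-linear) (cong 𝒯-linear
             (cong (iterate-linear l 𝒴-linear) (totals-blockˡ ks ls a))) ⟩
      left (k ∷ ks) (l ∷ ls) a ∎
      where
      open SetoidReasoning ≋-setoid
      𝒳ᵏ = iterate k 𝒳
      𝒴ˡ = iterate l 𝒴
      t = totals μ blockˡ ks ls a

    totals-blockʳ : ∀ {n} (ls ks : Vec ℕ n) a → totals μ′ blockʳ ls ks a ≋ right ls ks a
    totals-blockʳ []       []       a = ≋.refl
    totals-blockʳ (l ∷ ls) (k ∷ ks) a = begin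
      μ′ • 𝒴′ (𝒴ˡ (𝒳 (𝒳ᵏ t))) ⊕ 𝒴′ (𝒴ˡ (𝒳ᵏ t)) ⊕ 𝒴ˡ (𝒳 (𝒳ᵏ t))
        ≡⟨ ≡.cong₂ (λ x y → μ′ • x ⊕ y ⊕ 𝒴ˡ (𝒳 (𝒳ᵏ t)))
             (iterate-suc l 𝒴′ (𝒳 (𝒳ᵏ t))) (iterate-suc l 𝒴′ (𝒳ᵏ t)) ⟨
      μ′ • 𝒴ˡ (𝒴′ (𝒳 (𝒳ᵏ t))) ⊕ 𝒴ˡ (𝒴′ (𝒳ᵏ t)) ⊕ 𝒴ˡ (𝒳 (𝒳ᵏ t))
        ≈⟨ total-linear μ′ (iterate-linear l 𝒴′-linear) (𝒴′ (𝒳 (𝒳ᵏ t))) (𝒴′ (𝒳ᵏ t)) (𝒳 (𝒳ᵏ t)) ⟩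
      𝒴ˡ (𝒯′ (𝒳ᵏ t))
        ≈⟨ cong (iterate-linear l 𝒴′-linear) (cong 𝒯′-linear
             (cong (iterate-linear k 𝒳-linear) (totals-blockʳ ls ks a))) ⟩
      right (l ∷ ls) (k ∷ ks) a ∎
      where
      open SetoidReasoning ≋-setoid
      𝒳ᵏ = iterate k 𝒳
      𝒴ˡ = iterate l 𝒴′
      t = totals μ′ blockʳ ls ks a

    act-block : ∀ y k l w a → act r y (replicate k X ++ replicate l Y ++ w) a
      ≡ iterate k 𝒳 (iterate l (λ b → shift (mulSum y b)) (act r y w a))
    act-block y k l w a = ≡.trans (act-++ r y (replicate k X) (replicate l Y ++ w) a)
      (≡.trans (act-Xs r y k _) (≡.cong (iterate k 𝒳)
        (≡.trans (act-++ r y (replicate l Y) w a) (act-Ys r y l (act r y w a)))))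

    act-left : ∀ {n} (ks ls : Vec ℕ n) p a →
      act r q (shorten (map suc ks) (map suc ls) (δs p) (εs p)) a ≡ run blockˡ ks ls p a
    act-left []       []       []            a = ≡.refl
    act-left (k ∷ ks) (l ∷ ls) (c@(δ , ε) ∷ p) a =
      ≡.trans (act-block q (suc k ∸ δ) (suc l ∸ ε) _ a) (≡.cong (blockˡ k l c) (act-left ks ls p a))

    act-left-last : ∀ {n} (ks ls : Vec ℕ n) kₘ lₘ p δ ε a →
      act r q (shorten (map suc (ks ∷ʳ kₘ)) (map suc (ls ∷ʳ lₘ)) (δs p ∷ʳ δ) (εs p ∷ʳ ε)) a
      ≡ run blockˡ ks ls p (blockˡ kₘ lₘ (δ , ε) a)
    act-left-last []       []       kₘ lₘ []            δ ε a = act-block q (suc kₘ ∸ δ) (suc lₘ ∸ ε) [] a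
    act-left-last (k ∷ ks) (l ∷ ls) kₘ lₘ (c@(δ′ , ε′) ∷ p) δ ε a =
      ≡.trans (act-block q (suc k ∸ δ′) (suc l ∸ ε′) _ a)
              (≡.cong (blockˡ k l c) (act-left-last ks ls kₘ lₘ p δ ε a))

    -- The word is cut inside each index pair instead of between pairs. This leaves x^k₁ and y^lₘ
    -- alone at the two ends, each with a choice of its own.
    act-right : ∀ {n} k₁ (ks ls : Vec ℕ n) lₘ δ p ε a →
      act r q′ (shorten (map suc (k₁ ∷ ks)) (map suc (ls ∷ʳ lₘ)) (δ ∷ δs p) (εs p ∷ʳ ε)) a
      ≡ iterate (suc k₁ ∸ δ) 𝒳 (run blockʳ ls ks p (iterate (suc lₘ ∸ ε) 𝒴′ a))
    act-right k₁ []       []       lₘ δ []              ε a = act-block q′ (suc k₁ ∸ δ) (suc lₘ ∸ ε) [] a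
    act-right k₁ (k ∷ ks) (l ∷ ls) lₘ δ ((δ′ , ε′) ∷ p) ε a =
      ≡.trans (act-block q′ (suc k₁ ∸ δ) (suc l ∸ ε′) _ a)
              (≡.cong (λ b → iterate (suc k₁ ∸ δ) 𝒳 (iterate (suc l ∸ ε′) 𝒴′ b))
                      (act-right k ks ls lₘ δ′ p ε a))

    -- A power at an end of the word has only two choices, keeping or removing one letter; their
    -- weighted sum is the shorter power times 1 + ζ L.
    absorb : ∀ ζ k {L} → Linear L → ∀ a → ζ • L (iterate k L a) ⊕ iterate k L a ≋ iterate k L (a ⊕ ζ • L a)
    absorb ζ k {L} l a = begin
      ζ • L (Lᵏ a) ⊕ Lᵏ a    ≡⟨ ≡.cong (λ b → ζ • b ⊕ Lᵏ a) (iterate-suc k L a) ⟨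
      ζ • Lᵏ (L a) ⊕ Lᵏ a    ≈⟨ (λ n → +-comm _ _) ⟩
      Lᵏ a ⊕ ζ • Lᵏ (L a)    ≈⟨ ⊕-cong ≋.refl (•-homo lᵏ ζ (L a)) ⟨
      Lᵏ a ⊕ Lᵏ (ζ • L a)    ≈⟨ ⊕-homo lᵏ a (ζ • L a) ⟨
      Lᵏ (a ⊕ ζ • L a)       ∎
      where
      open SetoidReasoning ≋-setoid
      Lᵏ = iterate k L
      lᵏ = iterate-linear k l

    weighted-left : ∀ {n L} → Linear L → ∀ (ks ls : Vec ℕ n) a N →
                    weighted μ n (λ p → L (run blockˡ ks ls p a) N) ≈ L (left ks ls a) N
    weighted-left l ks ls a N =
      trans (weighted-run μ blockˡ ks ls blockˡ-linear l a N) (cong l (totals-blockˡ ks ls a) N)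

    weighted-right : ∀ {n L} → Linear L → ∀ (ls ks : Vec ℕ n) a N →
                     weighted μ′ n (λ p → L (run blockʳ ls ks p a) N) ≈ L (right ls ks a) N
    weighted-right l ls ks a N =
      trans (weighted-run μ′ blockʳ ls ks blockʳ-linear l a N) (cong l (totals-blockʳ ls ks a) N)

    Σ≤-≡ : ∀ {a b} → a ≡ b → ∀ N → Σ≤ a N ≈ Σ≤ b N
    Σ≤-≡ ≡.refl N = refl

    -- The four identities for truncated sums.

    module _ (N : ℕ) where

      open Sides μ (λ w → Σ≤ (act r q w δ₀) N) using (left-i; left-ii; left-iii; left-iv)
      open Sides μ′ (λ w → Σ≤ (act r q′ w δ₀) N) using (right-i; right-ii; right-iii; right-iv)

      -- What the choice of ε′ₘ₊₁ leaves at the right end: the vector (1 - λ′ y′) δ₀, which is 𝒬 δ₀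
      -- up to the factor `q 0`.
      e : Seq
      e = δ₀ ⊕ μ′ • 𝒴′ δ₀

      eval-last : ∀ {n} k₁ (ks ls : Vec ℕ n) lₘ δ →
        weighted μ′ n (λ p → weighted₂ μ′ λ ε → Σ≤ (act r q′
          (shorten (map suc (k₁ ∷ ks)) (map suc (ls ∷ʳ lₘ)) (δ ∷ δs p) (εs p ∷ʳ ε)) δ₀) N)
        ≈ Σ≤ (iterate (suc k₁ ∸ δ) 𝒳 (right ls ks (iterate lₘ 𝒴′ e))) N
      eval-last {n} k₁ ks ls lₘ δ = begin
        weighted μ′ n (λ p → weighted₂ μ′ λ ε → Σ≤ (act r q′ (w p ε) δ₀) N)
          ≈⟨ weighted-cong μ′ n (λ p → trans
               (weighted₂-cong μ′ (λ ε → Σ≤-≡ (act-right k₁ ks ls lₘ δ p ε δ₀) N))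
               (weighted₂-linear μ′ (∘-linear lin (run-linear blockʳ ls ks blockʳ-linear p))
                 (λ ε → iterate (suc lₘ ∸ ε) 𝒴′ δ₀) N)) ⟩
        weighted μ′ n (λ p → L (run blockʳ ls ks p (μ′ • 𝒴′ (iterate lₘ 𝒴′ δ₀) ⊕ iterate lₘ 𝒴′ δ₀)) N)
          ≈⟨ weighted-right lin ls ks _ N ⟩
        L (right ls ks (μ′ • 𝒴′ (iterate lₘ 𝒴′ δ₀) ⊕ iterate lₘ 𝒴′ δ₀)) N
          ≈⟨ cong lin (cong (right-linear ls ks) (absorb μ′ lₘ 𝒴′-linear δ₀)) N ⟩
        L (right ls ks (iterate lₘ 𝒴′ e)) N ∎
        where
        open SetoidReasoning setoid
        w : Vec (ℕ × ℕ) n → ℕ → Word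
        w p ε = shorten (map suc (k₁ ∷ ks)) (map suc (ls ∷ʳ lₘ)) (δ ∷ δs p) (εs p ∷ʳ ε)
        L : Seq → Seq
        L a = Σ≤ (iterate (suc k₁ ∸ δ) 𝒳 a)
        lin : Linear L
        lin = ∘-linear Σ≤-linear (iterate-linear (suc k₁ ∸ δ) 𝒳-linear)

      eval-last₁ : ∀ {n} k₁ (ks ls : Vec ℕ n) δ →
        weighted μ′ n (λ p → Σ≤ (act r q′
          (shorten (map suc (k₁ ∷ ks)) (map suc (ls ∷ʳ 0)) (δ ∷ δs p) (εs p ∷ʳ 0)) δ₀) N)
        ≈ Σ≤ (iterate (suc k₁ ∸ δ) 𝒳 (right ls ks (𝒴′ δ₀))) N
      eval-last₁ {n} k₁ ks ls δ = trans
        (weighted-cong μ′ n λ p → Σ≤-≡ (act-right k₁ ks ls 0 δ p 0 δ₀) N)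
        (weighted-right (∘-linear Σ≤-linear (iterate-linear (suc k₁ ∸ δ) 𝒳-linear)) ls ks (𝒴′ δ₀) N)

      eval-first : ∀ k a →
        weighted₂ μ′ (λ δ → Σ≤ (iterate (suc k ∸ δ) 𝒳 a) N) ≈ Σ≤ (𝒫 (iterate k 𝒳 a)) N
      eval-first k a = trans (weighted₂-linear μ′ Σ≤-linear (λ δ → iterate (suc k ∸ δ) 𝒳 a) N)
        (cong Σ≤-linear (λ n → +-comm (μ′ * 𝒳 (iterate k 𝒳 a) n) (iterate k 𝒳 a n)) N)

      -- The 𝒫 arriving at the left end is the sum over δ′₁, and 𝒬 δ₀ at the right end is `q 0`
      -- times the sum over ε′ₘ₊₁. As `q 0` inverts μ′, it removes the surplus power in `right-i`.
      finite-i : ∀ {n} k₁ (ks : Vec ℕ n) l₁ ls ls⁻ lₘ → l₁ ∷ ls ≡ ls⁻ ∷ʳ suc lₘ →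
        left-i (map suc (k₁ ∷ ks)) (map suc (l₁ ∷ ls))
        ≈ q 0 * right-i (map suc (k₁ ∷ ks)) (map suc (ls⁻ ∷ʳ suc lₘ))
      finite-i {n} k₁ ks l₁ ls ls⁻ lₘ eq = begin
        left-i (map suc (k₁ ∷ ks)) (map suc (l₁ ∷ ls))
          ≈⟨ trans (weighted-cong μ (suc n) λ p → Σ≤-≡ (act-left (k₁ ∷ ks) (l₁ ∷ ls) p δ₀) N)
                   (weighted-left Σ≤-linear (k₁ ∷ ks) (l₁ ∷ ls) δ₀ N) ⟩
        Σ≤ (𝒳ᵏ (𝒯 u)) N
          ≈⟨ cong Σ≤-linear (cong lᵏ (𝒯≋𝒫∘𝒬 {u} (proj₁ key))) N ⟩
        Σ≤ (𝒳ᵏ (𝒫 (𝒬 u))) N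
          ≈⟨ cong Σ≤-linear (𝒫∘𝒳ⁿ k₁ (𝒬 u)) N ⟨
        Σ≤ (𝒫 (𝒳ᵏ (𝒬 u))) N
          ≈⟨ cong (∘-linear Σ≤-linear (∘-linear 𝒫-linear lᵏ))
               (≋.trans (proj₂ key) (cong (∘-linear (right-linear ls⁻ ks) lʸ) 𝒬δ₀)) N ⟩
        Σ≤ (𝒫 (𝒳ᵏ (right ls⁻ ks (iterate (suc lₘ) 𝒴′ (q 0 • e))))) N
          ≈⟨ •-homo (∘-linear Σ≤-linear (∘-linear 𝒫-linear (∘-linear lᵏ
               (∘-linear (right-linear ls⁻ ks) lʸ)))) (q 0) e N ⟩
        q 0 * Σ≤ (𝒫 (𝒳ᵏ (right ls⁻ ks (iterate (suc lₘ) 𝒴′ e)))) N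
          ≈⟨ *-congˡ (trans (weighted₂-cong μ′ (eval-last k₁ ks ls⁻ (suc lₘ)))
               (eval-first k₁ (right ls⁻ ks (iterate (suc lₘ) 𝒴′ e)))) ⟨
        q 0 * right-i (map suc (k₁ ∷ ks)) (map suc (ls⁻ ∷ʳ suc lₘ)) ∎
        where
        open SetoidReasoning setoid
        𝒳ᵏ = iterate k₁ 𝒳
        lᵏ = iterate-linear k₁ 𝒳-linear
        lʸ = iterate-linear (suc lₘ) 𝒴′-linear
        u = iterate l₁ 𝒴 (left ks ls δ₀)
        -- Here lₘ ≠ 1 enters: at least one 𝒴 is applied to `δ₀` before the first 𝒯, so `refl`
        -- proves the required vanishing although `δ₀` itself does not vanish at 0.
        key = 𝒬-left ks ls l₁ ls⁻ (suc lₘ) {δ₀} eq refl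

      finite-ii : ∀ {n} (ks : Vec ℕ n) l₁ ls ls⁻ lₘ → l₁ ∷ ls ≡ ls⁻ ∷ʳ suc lₘ →
        left-ii (map suc (0 ∷ ks)) (map suc (l₁ ∷ ls))
        ≈ right-ii (map suc (0 ∷ ks)) (map suc (ls⁻ ∷ʳ suc lₘ))
          + 𝒬 (iterate l₁ 𝒴 (left ks ls δ₀)) N
      finite-ii {n} ks l₁ ls ls⁻ lₘ eq = begin
        left-ii (map suc (0 ∷ ks)) (map suc (l₁ ∷ ls))
          ≈⟨ weighted₂-cong μ (λ ε → trans
               (weighted-cong μ n λ p → Σ≤-≡ (≡.trans (act-block q 1 (suc l₁ ∸ ε)
                   (shorten (map suc ks) (map suc ls) (δs p) (εs p)) δ₀)
                 (≡.cong (λ b → 𝒳 (iterate (suc l₁ ∸ ε) 𝒴 b)) (act-left ks ls p δ₀))) N)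
               (weighted-left (∘-linear Σ≤-linear (∘-linear 𝒳-linear
                 (iterate-linear (suc l₁ ∸ ε) 𝒴-linear))) ks ls δ₀ N)) ⟩
        weighted₂ μ (λ ε → Σ≤ (𝒳 (iterate (suc l₁ ∸ ε) 𝒴 (left ks ls δ₀))) N)
          ≈⟨ weighted₂-linear μ Σ𝒳 (λ ε → iterate (suc l₁ ∸ ε) 𝒴 (left ks ls δ₀)) N ⟩
        Σ≤ (𝒳 (μ • 𝒴 u ⊕ u)) N
          ≈⟨ cong Σ𝒳 (λ n → +-comm (μ * 𝒴 u n) (u n)) N ⟩
        Σ≤ (𝒳 (u ⊕ μ • 𝒴 u)) N
          ≈⟨ Σ≤-𝒳𝒬 {u} (proj₁ key) N ⟩
        μ′ * Σ≤ (𝒳 (𝒬 u)) N + 𝒬 u N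
          ≈⟨ +-congʳ (*-congˡ (cong Σ𝒳 (≋.trans (proj₂ key) (cong lin 𝒬δ₀)) N)) ⟩
        μ′ * Σ≤ (𝒳 (right ls⁻ ks (iterate (suc lₘ) 𝒴′ (q 0 • e)))) N + 𝒬 u N
          ≈⟨ +-congʳ (*-congˡ (•-homo (∘-linear Σ𝒳 lin) (q 0) e N)) ⟩
        μ′ * (q 0 * Σ≤ (𝒳 (right ls⁻ ks (iterate (suc lₘ) 𝒴′ e))) N) + 𝒬 u N
          -- The μ′ produced at the left end cancels the `q 0` produced at the right end.
          ≈⟨ +-congʳ (trans (sym (*-assoc _ _ _)) (trans (*-congʳ (trans (*-comm μ′ (q 0)) q₀))
               (*-identityˡ _))) ⟩
        Σ≤ (𝒳 (right ls⁻ ks (iterate (suc lₘ) 𝒴′ e))) N + 𝒬 u N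
          ≈⟨ +-congʳ (eval-last 0 ks ls⁻ (suc lₘ) 0) ⟨
        right-ii (map suc (0 ∷ ks)) (map suc (ls⁻ ∷ʳ suc lₘ)) + 𝒬 u N ∎
        where
        open SetoidReasoning setoid
        Σ𝒳 = ∘-linear Σ≤-linear 𝒳-linear
        lin = ∘-linear (right-linear ls⁻ ks) (iterate-linear (suc lₘ) 𝒴′-linear)
        u = iterate l₁ 𝒴 (left ks ls δ₀)
        key = 𝒬-left ks ls l₁ ls⁻ (suc lₘ) {δ₀} eq refl

      eval-left-last : ∀ {n L} → Linear L → ∀ (ks ls : Vec ℕ n) kₘ →
        weighted μ n (λ p → weighted₂ μ λ δ → L (run blockˡ ks ls p (blockˡ kₘ 0 (δ , 0) δ₀)) N)
        ≈ L (left ks ls (iterate kₘ 𝒳 (𝒫 (𝒴′ δ₀)))) N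
      eval-left-last {n} {L} lin ks ls kₘ = begin
        weighted μ n (λ p → weighted₂ μ λ δ → L (run blockˡ ks ls p (blockˡ kₘ 0 (δ , 0) δ₀)) N)
          ≈⟨ weighted-cong μ n (λ p → weighted₂-linear μ
               (∘-linear lin (run-linear blockˡ ks ls blockˡ-linear p))
               (λ δ → blockˡ kₘ 0 (δ , 0) δ₀) N) ⟩
        weighted μ n (λ p → L (run blockˡ ks ls p (μ • 𝒳 (𝒳ᵏ (𝒴 δ₀)) ⊕ 𝒳ᵏ (𝒴 δ₀))) N)
          ≈⟨ weighted-left lin ks ls _ N ⟩
        L (left ks ls (μ • 𝒳 (𝒳ᵏ (𝒴 δ₀)) ⊕ 𝒳ᵏ (𝒴 δ₀))) N
          ≈⟨ cong (∘-linear lin (left-linear ks ls)) (≋.trans (absorb μ kₘ 𝒳-linear (𝒴 δ₀))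
               (cong (iterate-linear kₘ 𝒳-linear) 𝒴δ₀)) N ⟩
        L (left ks ls (𝒳ᵏ (𝒫 (𝒴′ δ₀)))) N ∎
        where
        open SetoidReasoning setoid
        𝒳ᵏ = iterate kₘ 𝒳

      -- For lₘ = 1 the last block offers only δₘ, and the sum over it supplies 𝒫 𝒴′ δ₀. The 𝒫 that
      -- comes out on the left is the sum over δ′₁, so no boundary term is left over.
      finite-iii : ∀ {n} k₁ (ks ks⁻ : Vec ℕ n) kₘ ls → ks⁻ ∷ʳ kₘ ≡ k₁ ∷ ks →
        left-iii (map suc (ks⁻ ∷ʳ kₘ)) (map suc (ls ∷ʳ 0))
        ≈ right-iii (map suc (k₁ ∷ ks)) (map suc (ls ∷ʳ 0))
      finite-iii {n} k₁ ks ks⁻ kₘ ls eq = begin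
        left-iii (map suc (ks⁻ ∷ʳ kₘ)) (map suc (ls ∷ʳ 0))
          ≈⟨ weighted-cong μ n (λ p → weighted₂-cong μ λ δ →
               Σ≤-≡ (act-left-last ks⁻ ls kₘ 0 p δ 0 δ₀) N) ⟩
        weighted μ n (λ p → weighted₂ μ λ δ → Σ≤ (run blockˡ ks⁻ ls p (blockˡ kₘ 0 (δ , 0) δ₀)) N)
          ≈⟨ eval-left-last Σ≤-linear ks⁻ ls kₘ ⟩
        Σ≤ (left ks⁻ ls (iterate kₘ 𝒳 (𝒫 (𝒴′ δ₀)))) N
          ≈⟨ cong Σ≤-linear (left-𝒫 ks⁻ ls kₘ k₁ ks {𝒴′ δ₀} eq refl) N ⟩
        Σ≤ (𝒫 (iterate k₁ 𝒳 (right ls ks (𝒴′ δ₀)))) N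
          ≈⟨ trans (weighted₂-cong μ′ (eval-last₁ k₁ ks ls)) (eval-first k₁ (right ls ks (𝒴′ δ₀))) ⟨
        right-iii (map suc (k₁ ∷ ks)) (map suc (ls ∷ʳ 0)) ∎
        where open SetoidReasoning setoid

      -- The right end is treated as in (iii) and the left end as in (ii): the 𝒫 that travels to the
      -- left is consumed by the 𝒬 of the left end. This gives m - 1 complete factors 𝒯′, with one
      -- μ′ uncancelled.
      finite-iv : ∀ {n} k₂ (ks ks⁻ : Vec ℕ n) kₘ l₁ ls → ks⁻ ∷ʳ kₘ ≡ k₂ ∷ ks →
        left-iv (map suc (0 ∷ (ks⁻ ∷ʳ kₘ))) (map suc (l₁ ∷ (ls ∷ʳ 0)))
        ≈ right-iv (map suc (0 ∷ k₂ ∷ ks)) (map suc ((l₁ ∷ ls) ∷ʳ 0))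
          + 𝒬 (iterate l₁ 𝒴 (left ks⁻ ls (iterate kₘ 𝒳 (𝒫 (𝒴′ δ₀))))) N
      finite-iv {n} k₂ ks ks⁻ kₘ l₁ ls eq = begin
        left-iv (map suc (0 ∷ (ks⁻ ∷ʳ kₘ))) (map suc (l₁ ∷ (ls ∷ʳ 0)))
          ≈⟨ weighted₂-cong μ (λ ε → trans
               (weighted-cong μ n λ p → weighted₂-cong μ λ δ →
                 Σ≤-≡ (≡.trans (act-block q 1 (suc l₁ ∸ ε)
                     (shorten (map suc (ks⁻ ∷ʳ kₘ)) (map suc (ls ∷ʳ 0)) (δs p ∷ʳ δ) (εs p ∷ʳ 0)) δ₀)
                   (≡.cong (λ b → 𝒳 (iterate (suc l₁ ∸ ε) 𝒴 b)) (act-left-last ks⁻ ls kₘ 0 p δ 0 δ₀))) N)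
               (eval-left-last (∘-linear Σ𝒳 (iterate-linear (suc l₁ ∸ ε) 𝒴-linear)) ks⁻ ls kₘ)) ⟩
        weighted₂ μ (λ ε → Σ≤ (𝒳 (iterate (suc l₁ ∸ ε) 𝒴 t)) N)
          ≈⟨ weighted₂-linear μ Σ𝒳 (λ ε → iterate (suc l₁ ∸ ε) 𝒴 t) N ⟩
        Σ≤ (𝒳 (μ • 𝒴 u ⊕ u)) N
          ≈⟨ cong Σ𝒳 (λ n → +-comm (μ * 𝒴 u n) (u n)) N ⟩
        Σ≤ (𝒳 (u ⊕ μ • 𝒴 u)) N
          ≈⟨ Σ≤-𝒳𝒬 {u} (𝒴ⁿ-vanishing l₁ {t} (left-vanishing ks⁻ ls (𝒳ⁿ-vanishing kₘ {𝒫 (𝒴′ δ₀)}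
               (𝒫-vanishing {𝒴′ δ₀} refl)))) N ⟩
        μ′ * Σ≤ (𝒳 (𝒬 u)) N + 𝒬 u N
          ≈⟨ +-congʳ (*-congˡ (cong Σ𝒳 (≋.trans
               (cong (∘-linear (mulSum-linear q) (iterate-linear l₁ 𝒴-linear))
                 (left-𝒫 ks⁻ ls kₘ k₂ ks {𝒴′ δ₀} eq refl))
               (𝒬∘𝒴ⁿ∘𝒫∘𝒳ⁿ l₁ k₂ {right ls ks (𝒴′ δ₀)} (right-vanishing ls ks {𝒴′ δ₀} refl))) N)) ⟩
        μ′ * Σ≤ (𝒳 (right (l₁ ∷ ls) (k₂ ∷ ks) (𝒴′ δ₀))) N + 𝒬 u N
          ≈⟨ +-congʳ (*-congˡ (eval-last₁ 0 (k₂ ∷ ks) (l₁ ∷ ls) 0)) ⟨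
        right-iv (map suc (0 ∷ k₂ ∷ ks)) (map suc ((l₁ ∷ ls) ∷ʳ 0)) + 𝒬 u N ∎
        where
        open SetoidReasoning setoid
        Σ𝒳 = ∘-linear Σ≤-linear 𝒳-linear
        t = left ks⁻ ls (iterate kₘ 𝒳 (𝒫 (𝒴′ δ₀)))
        u = iterate l₁ 𝒴 t

-- Normed rings and limits.

Small : ∀ {n} → Vec (ℕ × ℕ) n → Set
Small = All (λ (δ , ε) → δ ℕ.+ ε ≤ 1)

-- The argument uses ℂ only through this interface: equality in ℂ itself would unfold to a
-- statement on representatives, from which no implicit argument can be inferred.
record NormedRing : Set₁ where
  field
    commutativeRing : CommutativeRing 0ℓ 0ℓ
  open CommutativeRing commutativeRing public hiding (zero)
  infix 4 _⊴ᵣ_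
  field
    _⊴ᵣ_        : Carrier → ℚ → Set
    resp        : ∀ {x y b} → x ≈ y → x ⊴ᵣ b → y ⊴ᵣ b
    mono        : ∀ {x b c} → b ℚ.≤ c → x ⊴ᵣ b → x ⊴ᵣ c
    +-bound     : ∀ {x y b c} → x ⊴ᵣ b → y ⊴ᵣ c → x + y ⊴ᵣ b ℚ.+ c
    *-bound     : ∀ {x y b c} → 0ℚ ℚ.≤ b → 0ℚ ℚ.≤ c → x ⊴ᵣ b → y ⊴ᵣ c → x * y ⊴ᵣ b ℚ.* c
    neg-bound   : ∀ {x b} → x ⊴ᵣ b → - x ⊴ᵣ b
    bounds      : ∀ x → ∃ λ b → 0ℚ ℚ.≤ b × x ⊴ᵣ b
    separated   : ∀ {x y} → (∀ ε → 0ℚ ℚ.< ε → x - y ⊴ᵣ ε) → x ≈ y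
    -- This bounds 1/(n - λ) without a lower bound for |n - λ|. The constant is ¼ because a bound
    -- holds for representatives only up to a margin; a margin of another ¼ still leaves the
    -- contraction factor ½.
    contraction : ∀ {x a c α} → x ≈ a + c * x → a ⊴ᵣ α → c ⊴ᵣ ½ ℚ.* ½ → x ⊴ᵣ α ℚ.+ α
    rational    : ℚ → Carrier
    rational-*  : ∀ p q → rational (p ℚ.* q) ≈ rational p * rational q
    rational-+  : ∀ p q → rational (p ℚ.+ q) ≈ rational p + rational q
    rational-0  : rational 0ℚ ≈ 0#
    rational-1  : rational 1ℚ ≈ 1#
    rational-⊴  : ∀ {p} → 0ℚ ℚ.≤ p → rational p ⊴ᵣ p
    converges   : ∀ (s : ℕ → Carrier) (β : ℕ → ℚ) →
                  (∀ ε → 0ℚ ℚ.< ε → Eventually λ n → β n ℚ.≤ ε) →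
                  (∀ N n → N ≤ n → s n - s N ⊴ᵣ β N) →
                  ∃ λ S → ∀ ε → 0ℚ ℚ.< ε → Eventually λ n → s n - S ⊴ᵣ ε

module Limits (R : NormedRing) where

  open NormedRing R
  open Sequences commutativeRing
  open RingProperties ring using (-‿distribʳ-*; -‿+-comm; -‿involutive; -0#≈0#)
  open SemiringSolver commutativeSemiring using (solve; con; _:=_; _:+_; _:*_)

  infix 4 _⇝ᵣ_
  _⇝ᵣ_ : Seq → Carrier → Set
  s ⇝ᵣ S = ∀ ε → 0ℚ ℚ.< ε → Eventually λ n → s n - S ⊴ᵣ ε

  zero-bound : ∀ {b} → 0ℚ ℚ.≤ b → 0# ⊴ᵣ b
  zero-bound 0≤b = mono 0≤b (resp rational-0 (rational-⊴ ℚₚ.≤-refl))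

  ⇝-cong : ∀ {s t S} → s ≋ t → s ⇝ᵣ S → t ⇝ᵣ S
  ⇝-cong e h ε 0<ε = eventually-map (λ n → resp (+-congʳ (e n))) (h ε 0<ε)

  ⇝-resp : ∀ {s S T} → S ≈ T → s ⇝ᵣ S → s ⇝ᵣ T
  ⇝-resp e h ε 0<ε = eventually-map (λ n → resp (+-congˡ (-‿cong e))) (h ε 0<ε)

  +-gap : ∀ x y u v → (x - u) + (y - v) ≈ (x + y) - (u + v)
  +-gap x y u v = trans
    (solve 4 (λ x y u v → (x :+ u) :+ (y :+ v) := (x :+ y) :+ (u :+ v)) refl x y (- u) (- v))
    (+-congˡ (-‿+-comm u v))

  ⇝-⊕ : ∀ {s t S T} → s ⇝ᵣ S → t ⇝ᵣ T → s ⊕ t ⇝ᵣ S + T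
  ⇝-⊕ {s} {t} {S} {T} h k ε 0<ε = eventually-map₂
    (λ n l m → subst (_ ⊴ᵣ_) (half-half ε) (resp (+-gap (s n) (t n) S T) (+-bound l m)))
    (h (½ ℚ.* ε) (half-pos 0<ε)) (k (½ ℚ.* ε) (half-pos 0<ε))

  ⇝-• : ∀ x {s S} → s ⇝ᵣ S → x • s ⇝ᵣ x * S
  ⇝-• x {s} {S} h ε 0<ε =
    let b , 0≤b , x⊴b = bounds x
        -- `1 + b` is used because `b` may be 0 and `shrink` needs a positive factor.
        δ , 0<δ , e   = shrink (ℚₚ.<-≤-trans 0<1 (p≤p+q {1ℚ} 0≤b)) 0<ε
    in eventually-map (λ n l → resp
         (trans (distribˡ x (s n) (- S)) (+-congˡ (sym (-‿distribʳ-* x S))))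
         (subst (_ ⊴ᵣ_) e (*-bound (+-nonNeg (ℚₚ.<⇒≤ 0<1) 0≤b) (ℚₚ.<⇒≤ 0<δ)
           (mono (p≤q+p (ℚₚ.<⇒≤ 0<1)) x⊴b) l)))
       (h δ 0<δ)

  ⇝-unique : ∀ {s S T} → s ⇝ᵣ S → s ⇝ᵣ T → S ≈ T
  ⇝-unique {s} {S} {T} h k = separated λ ε 0<ε →
    let N , l = eventually-map₂ {Q = λ n → s n - T ⊴ᵣ ½ ℚ.* ε} {R = λ _ → S - T ⊴ᵣ ε}
          (λ n l m → subst (S - T ⊴ᵣ_) (half-half ε) (resp (gap (s n)) (+-bound (neg-bound l) m)))
          (h (½ ℚ.* ε) (half-pos 0<ε)) (k (½ ℚ.* ε) (half-pos 0<ε))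
    in l N ℕₚ.≤-refl
    where
    gap : ∀ x → - (x - S) + (x - T) ≈ S - T
    gap x = begin
      - (x - S) + (x - T)         ≈⟨ +-congʳ (sym (-‿+-comm x (- S))) ⟩
      (- x + - - S) + (x - T)     ≈⟨ solve 4 (λ x y s t → (x :+ s) :+ (y :+ t) := (x :+ y) :+ (s :+ t))
                                       refl (- x) x (- - S) (- T) ⟩
      (- x + x) + (- - S - T)     ≈⟨ +-cong (-‿inverseˡ x) (+-congʳ (-‿involutive S)) ⟩
      0# + (S - T)                ≈⟨ +-identityˡ (S - T) ⟩
      S - T                       ∎
      where open SetoidReasoning setoid

  null : ∀ {s} (β : ℕ → ℚ) → (∀ ε → 0ℚ ℚ.< ε → Eventually λ n → β n ℚ.≤ ε) →
         (∀ n → s n ⊴ᵣ β n) → s ⇝ᵣ 0#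
  null {s} β β→0 h ε 0<ε = eventually-map
    (λ n l → resp (sym (trans (+-congˡ -0#≈0#) (+-identityʳ (s n)))) (mono l (h n))) (β→0 ε 0<ε)

  weighted₂-⇝ : ∀ ζ {h : ℕ → Seq} {H} → (∀ i → i ≤ 1 → h i ⇝ᵣ H i) →
                (λ N → weighted₂ ζ (λ i → h i N)) ⇝ᵣ weighted₂ ζ H
  weighted₂-⇝ ζ l = ⇝-⊕ (⇝-• ζ (l 0 z≤n)) (l 1 ℕₚ.≤-refl)

  weighted-⇝ : ∀ ζ n {h : Vec (ℕ × ℕ) n → Seq} {H} → (∀ p → Small p → h p ⇝ᵣ H p) →
               (λ N → weighted ζ n (λ p → h p N)) ⇝ᵣ weighted ζ n H
  weighted-⇝ ζ zero    l = l [] []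
  weighted-⇝ ζ (suc n) l = ⇝-⊕ (⇝-• ζ (weighted-⇝ ζ n λ p s → l ((0 , 0) ∷ p) (z≤n ∷ s)))
    (⇝-⊕ (weighted-⇝ ζ n λ p s → l ((1 , 0) ∷ p) (ℕₚ.≤-refl ∷ s))
         (weighted-⇝ ζ n λ p s → l ((0 , 1) ∷ p) (ℕₚ.≤-refl ∷ s)))

-- Growth estimates and convergence.

module Estimates (R : NormedRing) where

  open NormedRing R
  open Sequences commutativeRing
  open Limits R
  open SemiringSolver commutativeSemiring using (solve; con; _:=_; _:+_; _:*_)

  r : Seq
  r n = rational (ρ n)

  -- The class of order n^(-1/2), closed under x, y and linear combinations. Entry n + 1 is compared
  -- with `ψ n` because both operators put the factors with index n there; entry 0 stands apart, for
  -- the sake of `δ₀`.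
  record Moderate (a : Seq) : Set where
    field
      constant : ℚ
      nonNeg   : 0ℚ ℚ.≤ constant
      head≤    : a 0 ⊴ᵣ constant
      tail≤    : ∀ n → a (suc n) ⊴ᵣ constant ℚ.* ψ n

  open Moderate

  δ₀-moderate : Moderate δ₀
  δ₀-moderate = record
    { constant = 1ℚ
    ; nonNeg   = ℚₚ.<⇒≤ 0<1
    ; head≤    = resp rational-1 (rational-⊴ (ℚₚ.<⇒≤ 0<1))
    ; tail≤    = λ n → zero-bound (*-nonNeg (ℚₚ.<⇒≤ 0<1) (ψ-nonNeg n))
    }

  ⊕-moderate : ∀ {a b} → Moderate a → Moderate b → Moderate (a ⊕ b)
  ⊕-moderate {a} {b} m m′ = record
    { constant = constant m ℚ.+ constant m′
    ; nonNeg   = +-nonNeg (nonNeg m) (nonNeg m′)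
    ; head≤    = +-bound (head≤ m) (head≤ m′)
    ; tail≤    = λ n → subst (a (suc n) + b (suc n) ⊴ᵣ_)
        (≡.sym (ℚₚ.*-distribʳ-+ (ψ n) (constant m) (constant m′))) (+-bound (tail≤ m n) (tail≤ m′ n))
    }

  •-moderate : ∀ x {a} → Moderate a → Moderate (x • a)
  •-moderate x {a} m =
    let b , 0≤b , x⊴b = bounds x
    in record
    { constant = b ℚ.* constant m
    ; nonNeg   = *-nonNeg 0≤b (nonNeg m)
    ; head≤    = *-bound 0≤b (nonNeg m) x⊴b (head≤ m)
    ; tail≤    = λ n → subst (x * a (suc n) ⊴ᵣ_) (≡.sym (ℚₚ.*-assoc b (constant m) (ψ n)))
        (*-bound 0≤b (*-nonNeg (nonNeg m) (ψ-nonNeg n)) x⊴b (tail≤ m n))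
    }

  mulTail-bound : ∀ {a} (m : Moderate a) n → mulTail r a (suc n) ⊴ᵣ ρ n ℚ.* (constant m ℚ.* ψ n)
  mulTail-bound m n = *-bound (ρ-nonNeg n) (*-nonNeg (nonNeg m) (ψ-nonNeg n))
    (rational-⊴ (ρ-nonNeg n)) (tail≤ m n)

  mulTail-moderate : ∀ {a} → Moderate a → Moderate (mulTail r a)
  mulTail-moderate {a} m = record
    { constant = constant m
    ; nonNeg   = nonNeg m
    ; head≤    = zero-bound (nonNeg m)
    ; tail≤    = λ n → mono (subst (ρ n ℚ.* (constant m ℚ.* ψ n) ℚ.≤_) (ℚₚ.*-identityˡ _)
        (ℚₚ.*-monoʳ-≤-nonNeg (constant m ℚ.* ψ n)
          {{ℚ.nonNegative (*-nonNeg (nonNeg m) (ψ-nonNeg n))}} (ρ≤1 n)))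
        (mulTail-bound m n)
    }

  -- The sums of ψ telescope to 2 φ(n) with φ(n) = (n + 1) ψ(n); the value 2 φ(0) = 2 also covers
  -- entry 0.
  Σ≤-bound : ∀ {a} (m : Moderate a) n → Σ≤ a n ⊴ᵣ constant m ℚ.* 2× (ν (suc n) ℚ.* ψ n)
  Σ≤-bound {a} m zero    = mono (subst (ℚ._≤ B ℚ.* 2× (ν 1 ℚ.* ψ 0)) (ℚₚ.*-identityʳ B)
    (ℚₚ.*-monoˡ-≤-nonNeg B {{ℚ.nonNegative (nonNeg m)}} (p≤p+q {1ℚ} (ℚₚ.<⇒≤ 0<1)))) (head≤ m)
    where B = constant m
  Σ≤-bound {a} m (suc n) = subst (Σ≤ a (suc n) ⊴ᵣ_)
    (≡.trans (≡.sym (ℚₚ.*-distribˡ-+ B (2× (ν (suc n) ℚ.* ψ n)) (ψ n))) (≡.cong (B ℚ.*_) (≡.sym (φ-step n))))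
    (+-bound (Σ≤-bound m n) (tail≤ m n))
    where B = constant m

  -- By `ψ-step` each new entry is at most a multiple of a decrement of ψ, so any stretch of the
  -- series is bounded by the total decrement, independently of its length.
  Σ≤-mulTail-tail : ∀ {a} (m : Moderate a) N k →
    Σ≤ (mulTail r a) (k ℕ.+ N) - Σ≤ (mulTail r a) N ⊴ᵣ constant m ℚ.* 4× (ψ N ℚ.- ψ (k ℕ.+ N))
  Σ≤-mulTail-tail {a} m N zero    = resp (sym (-‿inverseʳ _)) (zero-bound
    (ℚₚ.≤-reflexive (shape (constant m) (ψ N))))
    where
    shape : ∀ c x → 0ℚ ≡ c ℚ.* 4× (x ℚ.- x)
    shape = S.solve 2 (λ c x → let d = x S.:- x in
      S.con 0ℚ S.:= c S.:* ((d S.:+ d) S.:+ (d S.:+ d))) ≡.refl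
      where module S = ℚ-Solver
  Σ≤-mulTail-tail {a} m N (suc k) = resp
    (solve 3 (λ s x t → (s :+ t) :+ x := (s :+ x) :+ t) refl _ _ _)
    (subst (_ ⊴ᵣ_) (shape B (ψ N) (ψ n) (ψ (suc n)))
      (+-bound (Σ≤-mulTail-tail m N k) (mono (ℚₚ.≤-trans
        (ℚₚ.≤-reflexive (regroup (ρ n) B (ψ n)))
        (ℚₚ.*-monoˡ-≤-nonNeg B {{ℚ.nonNegative (nonNeg m)}} (ψ-step n)))
        (mulTail-bound m n))))
    where
    n = k ℕ.+ N
    B = constant m
    module S = ℚ-Solver
    regroup : ∀ r b p → r ℚ.* (b ℚ.* p) ≡ b ℚ.* (r ℚ.* p)
    regroup = S.solve 3 (λ r b p → r S.:* (b S.:* p) S.:= b S.:* (r S.:* p)) ≡.refl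
    shape : ∀ b x y z → b ℚ.* 4× (x ℚ.- y) ℚ.+ b ℚ.* 4× (y ℚ.- z) ≡ b ℚ.* 4× (x ℚ.- z)
    shape = S.solve 4 (λ b x y z →
      let d = x S.:- y ; e = y S.:- z ; f = x S.:- z in
      b S.:* ((d S.:+ d) S.:+ (d S.:+ d)) S.:+ b S.:* ((e S.:+ e) S.:+ (e S.:+ e))
      S.:= b S.:* ((f S.:+ f) S.:+ (f S.:+ f))) ≡.refl

  scaled-ψ→0 : ∀ {B} → 0ℚ ℚ.≤ B → ∀ ε → 0ℚ ℚ.< ε → Eventually λ n → B ℚ.* ψ n ℚ.≤ ε
  scaled-ψ→0 {B} 0≤B ε 0<ε =
    let δ , 0<δ , e = shrink (ℚₚ.<-≤-trans 0<1 (p≤q+p {1ℚ} 0≤B)) 0<ε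
    in eventually-map (λ n l → subst (B ℚ.* ψ n ℚ.≤_) e
         (*-mono-≤ 0≤B (ℚₚ.<⇒≤ 0<δ) (p≤p+q (ℚₚ.<⇒≤ 0<1)) l)) (ψ→0 δ 0<δ)

  Σ≤-mulTail-converges : ∀ {a} → Moderate a → ∃ λ S → Σ≤ (mulTail r a) ⇝ᵣ S
  Σ≤-mulTail-converges {a} m = converges (Σ≤ (mulTail r a)) (λ N → 4× B ℚ.* ψ N)
    (scaled-ψ→0 (+-nonNeg (+-nonNeg 0≤B 0≤B) (+-nonNeg 0≤B 0≤B)))
    λ N n N≤n → subst (λ i → Σ≤ (mulTail r a) i - Σ≤ (mulTail r a) N ⊴ᵣ 4× B ℚ.* ψ N) (ℕₚ.m∸n+n≡m N≤n)
      (mono (ℚₚ.≤-trans (p≤p+q (*-nonNeg (+-nonNeg (+-nonNeg 0≤B 0≤B) (+-nonNeg 0≤B 0≤B)) (ψ-nonNeg (n ∸ N ℕ.+ N))))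
        (ℚₚ.≤-reflexive (shape B (ψ N) (ψ (n ∸ N ℕ.+ N)))))
        (Σ≤-mulTail-tail m N (n ∸ N)))
    where
    B = constant m
    0≤B = nonNeg m
    module S = ℚ-Solver
    shape : ∀ b x y → b ℚ.* 4× (x ℚ.- y) ℚ.+ 4× b ℚ.* y ≡ 4× b ℚ.* x
    shape = S.solve 3 (λ b x y → let d = x S.:- y in
      b S.:* ((d S.:+ d) S.:+ (d S.:+ d)) S.:+ ((b S.:+ b) S.:+ (b S.:+ b)) S.:* y
      S.:= ((b S.:+ b) S.:+ (b S.:+ b)) S.:* x) ≡.refl

  iterate-moderate : ∀ n {L} → (∀ {a} → Moderate a → Moderate (L a)) → ∀ {a} → Moderate a → Moderate (iterate n L a)
  iterate-moderate zero    h m = m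
  iterate-moderate (suc n) h m = h (iterate-moderate n h m)

  HarmonicBound : Seq → ℚ → Set
  HarmonicBound q C = 0ℚ ℚ.≤ C × ∀ n → q n ⊴ᵣ C ℚ.* ρ n

  -- As soon as |c| ρ(n) ≤ ¼, the equation is a contraction and yields the bound 2 ρ(n). The
  -- finitely many earlier entries are bounded one by one, and all the constants are simply added.
  harmonicBound : ∀ q c → (∀ n → q n ≈ r n + (c * r n) * q n) → ∃ (HarmonicBound q)
  harmonicBound q c e =
    let b , 0≤b , c⊴b = bounds c
        δ , 0<δ , bδ  = shrink (ℚₚ.<-≤-trans 0<1 (p≤q+p {1ℚ} 0≤b)) (*-pos (ℚₚ.positive⁻¹ ½) (ℚₚ.positive⁻¹ ½))
        M , ρ≤δ       = ρ≤ δ 0<δ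
        C , 0≤C , low = initial M
        0≤2           = +-nonNeg (ℚₚ.<⇒≤ 0<1) (ℚₚ.<⇒≤ 0<1)
    in C ℚ.+ (1ℚ ℚ.+ 1ℚ) , +-nonNeg 0≤C 0≤2 , λ n → [ (λ n<M → widen n C (C ℚ.+ (1ℚ ℚ.+ 1ℚ)) (p≤p+q 0≤2) (low n n<M))
         , (λ M≤n → widen n (1ℚ ℚ.+ 1ℚ) (C ℚ.+ (1ℚ ℚ.+ 1ℚ)) (p≤q+p 0≤C) (subst (q n ⊴ᵣ_) (double (ρ n))
             (contraction (e n) (rational-⊴ (ρ-nonNeg n))
               (subst (c * r n ⊴ᵣ_) bδ (mono (*-mono-≤ 0≤b (ℚₚ.<⇒≤ 0<δ) (p≤p+q (ℚₚ.<⇒≤ 0<1)) (ρ≤δ n M≤n))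
                 (*-bound 0≤b (ρ-nonNeg n) c⊴b (rational-⊴ (ρ-nonNeg n)))))))) ]′ (ℕₚ.<-≤-connex n M)
    where
    double : ∀ x → x ℚ.+ x ≡ (1ℚ ℚ.+ 1ℚ) ℚ.* x
    double = S.solve 1 (λ x → x S.:+ x S.:= (S.con 1ℚ S.:+ S.con 1ℚ) S.:* x) ≡.refl
      where module S = ℚ-Solver
    widen : ∀ n C D {x} → C ℚ.≤ D → x ⊴ᵣ C ℚ.* ρ n → x ⊴ᵣ D ℚ.* ρ n
    widen n C D C≤D = mono (ℚₚ.*-monoʳ-≤-nonNeg (ρ n) {{ℚ.nonNegative (ρ-nonNeg n)}} C≤D)
    rescale : ∀ b n → b ≡ (b ℚ.* ν (suc n)) ℚ.* ρ n
    rescale b n = ≡.trans (≡.sym (ℚₚ.*-identityʳ b)) (≡.trans (≡.cong (b ℚ.*_) (≡.sym (ρ-inverse n)))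
      (S.solve 3 (λ b r v → b S.:* (r S.:* v) S.:= (b S.:* v) S.:* r) ≡.refl b (ρ n) (ν (suc n))))
      where module S = ℚ-Solver
    initial : ∀ M → ∃ λ C → 0ℚ ℚ.≤ C × ∀ n → n ℕ.< M → q n ⊴ᵣ C ℚ.* ρ n
    initial zero    = 0ℚ , ℚₚ.≤-refl , λ n ()
    initial (suc M) =
      let C , 0≤C , low = initial M
          b , 0≤b , q⊴b = bounds (q M)
          0≤bν          = *-nonNeg 0≤b (ν-nonNeg (suc M))
      in C ℚ.+ b ℚ.* ν (suc M) , +-nonNeg 0≤C 0≤bν , λ n n<1+M →
           [ (λ n<M → widen n C (C ℚ.+ b ℚ.* ν (suc M)) (p≤p+q 0≤bν) (low n n<M))
           , (λ { ≡.refl → widen n (b ℚ.* ν (suc M)) (C ℚ.+ b ℚ.* ν (suc M)) (p≤q+p 0≤C) (subst (q n ⊴ᵣ_) (rescale b n) q⊴b) })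
           ]′ (ℕₚ.m≤n⇒m<n∨m≡n (ℕₚ.≤-pred n<1+M))

  module _ {q C} (q⊴ : HarmonicBound q C) where

    -- The partial sums have order (n + 1) ψ(n), and `q n` of order 1/(n + 1) cancels the first
    -- factor. This is what keeps the class closed under y.
    mulSum-bound : ∀ {a} (m : Moderate a) n → mulSum q a n ⊴ᵣ 2× (C ℚ.* constant m) ℚ.* ψ n
    mulSum-bound {a} m n = subst (mulSum q a n ⊴ᵣ_)
      (≡.trans (regroup C (ρ n) B (ν (suc n)) (ψ n))
        (≡.trans (≡.cong (λ x → 2× (C ℚ.* B) ℚ.* (x ℚ.* ψ n)) (ρ-inverse n))
          (≡.cong (2× (C ℚ.* B) ℚ.*_) (ℚₚ.*-identityˡ (ψ n)))))
      (*-bound (*-nonNeg (proj₁ q⊴) (ρ-nonNeg n))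
        (*-nonNeg (nonNeg m) (+-nonNeg 0≤νψ 0≤νψ)) (proj₂ q⊴ n) (Σ≤-bound m n))
      where
      B = constant m
      0≤νψ = *-nonNeg (ν-nonNeg (suc n)) (ψ-nonNeg n)
      module S = ℚ-Solver
      regroup : ∀ c r b v p → (c ℚ.* r) ℚ.* (b ℚ.* 2× (v ℚ.* p)) ≡ 2× (c ℚ.* b) ℚ.* ((r ℚ.* v) ℚ.* p)
      regroup = S.solve 5 (λ c r b v p → let d = v S.:* p ; e = c S.:* b in
        (c S.:* r) S.:* (b S.:* (d S.:+ d)) S.:= (e S.:+ e) S.:* ((r S.:* v) S.:* p)) ≡.refl

    shift-mulSum-moderate : ∀ {a} → Moderate a → Moderate (shift (mulSum q a))
    shift-mulSum-moderate {a} m = record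
      { constant = 2× (C ℚ.* constant m)
      ; nonNeg   = 0≤
      ; head≤    = zero-bound 0≤
      ; tail≤    = mulSum-bound m
      }
      where 0≤ = +-nonNeg (*-nonNeg (proj₁ q⊴) (nonNeg m)) (*-nonNeg (proj₁ q⊴) (nonNeg m))

    mulSum→0 : ∀ {a} → Moderate a → mulSum q a ⇝ᵣ 0#
    mulSum→0 {a} m = null (λ n → 2× (C ℚ.* constant m) ℚ.* ψ n)
      (scaled-ψ→0 (+-nonNeg (*-nonNeg (proj₁ q⊴) (nonNeg m)) (*-nonNeg (proj₁ q⊴) (nonNeg m))))
      (mulSum-bound m)

    act-moderate : ∀ w {a} → Moderate a → Moderate (act r q w a)
    act-moderate []      m = m
    act-moderate (X ∷ w) m = mulTail-moderate (act-moderate w m)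
    act-moderate (Y ∷ w) m = shift-mulSum-moderate (act-moderate w m)

-- Truncated series in terms of the operators.

mutual
  -- The local function of exponents, which counts from an arbitrary start.
  runs : ℕ → Word → List ℕ
  runs = _

  exponents≡runs : ∀ w → exponents w ≡ runs 0 w
  -- Abstracting the start value turns the constraint on `runs` into one with the distinct variables
  -- `n` and `w` as arguments, which unification can solve.
  exponents≡runs w with 0
  ... | n = ≡.refl {x = runs n w}

module TruncatedSums (R : CommutativeRing 0ℓ 0ℓ) where

  open CommutativeRing R hiding (zero)
  open Exp semiring using (_^_)
  open Sequences R
  open SemiringSolver commutativeSemiring using (solve; _:=_; _:*_)

  module _ (r q : Seq) (T : List ℕ → ℕ → Carrier)
    (T-[]   : ∀ N → T [] N ≡ 1#)
    (T-zero : ∀ a as → T (a ∷ as) 0 ≡ 0#)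
    (T-suc  : ∀ a as N → T (a ∷ as) (suc N) ≡ T (a ∷ as) N + (r N ^ a * q N) * T as N) where

    iterate-mulTail-0 : ∀ a {b} → b 0 ≈ 0# → iterate a (mulTail r) b 0 ≈ 0#
    iterate-mulTail-0 zero    e = e
    iterate-mulTail-0 (suc a) e = refl

    iterate-mulTail-suc : ∀ a b N → iterate a (mulTail r) b (suc N) ≈ r N ^ a * b (suc N)
    iterate-mulTail-suc zero    b N = sym (*-identityˡ (b (suc N)))
    iterate-mulTail-suc (suc a) b N = trans (*-congˡ (iterate-mulTail-suc a b N))
      (sym (*-assoc (r N) (r N ^ a) (b (suc N))))

    -- The recursion of the truncated sum on whether n₁ ≤ N is that of partial sums. The new summand
    -- has n₁ = N + 1, and `shift` is what makes n₂ < n₁ strict.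
    T-∷ : ∀ a as c → (∀ N → T as N ≈ Σ≤ c N) → ∀ N →
          T (a ∷ as) N ≈ Σ≤ (iterate a (mulTail r) (shift (mulSum q c))) N
    T-∷ a as c h zero    = trans (reflexive (T-zero a as))
      (sym (iterate-mulTail-0 a {shift (mulSum q c)} refl))
    T-∷ a as c h (suc N) = begin
      T (a ∷ as) (suc N)                              ≡⟨ T-suc a as N ⟩
      T (a ∷ as) N + (r N ^ a * q N) * T as N         ≈⟨ +-cong (T-∷ a as c h N)
                                                          (trans (*-assoc _ _ _) (*-congˡ (*-congˡ (h N)))) ⟩
      Σ≤ s N + r N ^ a * (q N * Σ≤ c N)               ≈⟨ +-congˡ (iterate-mulTail-suc a (shift (mulSum q c)) N) ⟨
      Σ≤ s (suc N)                                    ∎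
      where
      open SetoidReasoning setoid
      s = iterate a (mulTail r) (shift (mulSum q c))

    -- The counter `a` holds the letters x read since the last y; on the operator side they are
    -- still waiting outside.
    T-runs : ∀ a u N →
      T (runs a (u ++ Y ∷ [])) N ≈ Σ≤ (iterate a (mulTail r) (act r q (u ++ Y ∷ []) δ₀)) N
    T-runs a []      N = T-∷ a [] δ₀ (λ M → trans (reflexive (T-[] M)) (sym (Σ≤-δ₀ M))) N
    T-runs a (X ∷ u) N = trans (T-runs (suc a) u N)
      (reflexive (≡.cong (λ b → Σ≤ b N) (≡.sym (iterate-suc a (mulTail r) (act r q (u ++ Y ∷ []) δ₀)))))
    T-runs a (Y ∷ u) N = T-∷ a (runs 0 (u ++ Y ∷ [])) (act r q (u ++ Y ∷ []) δ₀) (T-runs 0 u) N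

    T-exponents : ∀ u N → T (exponents (u ++ Y ∷ [])) N ≈ Σ≤ (act r q (u ++ Y ∷ []) δ₀) N
    T-exponents u N = trans (reflexive (≡.cong (λ as → T as N) (exponents≡runs (u ++ Y ∷ [])))) (T-runs 0 u N)

-- Admissibility of shortened words.

Last≤ : ∀ {n} → Vec ℕ (suc n) → Vec ℕ (suc n) → Set
Last≤ (e ∷ [])          (l ∷ [])          = e ≤ l
Last≤ (_ ∷ es@(_ ∷ _)) (_ ∷ ls@(_ ∷ _)) = Last≤ es ls

last≤-∷ʳ : ∀ {n} (es ls : Vec ℕ n) {e l} → e ≤ l → Last≤ (es ∷ʳ e) (ls ∷ʳ l)
last≤-∷ʳ []            []            h = h
last≤-∷ʳ (_ ∷ [])      (_ ∷ [])      h = h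
last≤-∷ʳ (_ ∷ _ ∷ es)  (_ ∷ l ∷ ls)  h = last≤-∷ʳ (_ ∷ es) (l ∷ ls) h

last≤-all : ∀ {n} {es : Vec ℕ (suc n)} ls⁻ l → All (_≤ 1) es → Last≤ es (ls⁻ ∷ʳ suc l)
last≤-all []             l (h ∷ [])      = ℕₚ.≤-trans h (s≤s z≤n)
last≤-all (_ ∷ [])       l (_ ∷ h ∷ [])  = ℕₚ.≤-trans h (s≤s z≤n)
last≤-all (_ ∷ m ∷ ls⁻)  l (_ ∷ h ∷ hs)  = last≤-all (m ∷ ls⁻) l (h ∷ hs)

EndsInY : Word → Set
EndsInY w = ∃ λ u → w ≡ u ++ Y ∷ []

endsInY-++ : ∀ v {w} → EndsInY w → EndsInY (v ++ w)
endsInY-++ v (u , ≡.refl) = v ++ u , ≡.sym (Listₚ.++-assoc v u (Y ∷ []))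

endsInY-replicate : ∀ n → EndsInY (replicate (suc n) Y ++ [])
endsInY-replicate zero    = [] , ≡.refl
endsInY-replicate (suc n) = endsInY-++ (Y ∷ []) (endsInY-replicate n)

endsInY-word : ∀ {n} (k : Vec ℕ (suc n)) l ε → Last≤ ε l → EndsInY (word k (zipWith _∸_ (map suc l) ε))
endsInY-word (k ∷ [])          (l ∷ [])         (e ∷ [])         h
  rewrite ℕₚ.+-∸-assoc 1 h = endsInY-++ (replicate k X) (endsInY-replicate (l ∸ e))
endsInY-word (k ∷ ks@(_ ∷ _)) (l ∷ ls@(_ ∷ _)) (e ∷ es@(_ ∷ _)) h =
  endsInY-++ (replicate k X) (endsInY-++ (replicate (suc l ∸ e) Y) (endsInY-word ks ls es h))

word-suc : ∀ {n} k (ks : Vec ℕ n) l → word (suc k ∷ ks) l ≡ X ∷ word (k ∷ ks) l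
word-suc k ks (l ∷ ls) = ≡.refl

-- Inner exponents may drop to 0; only the first x and the last y have to survive. As the vectors
-- hold predecessors, this means `δ ≤ k₁` at the head and `Last≤ ε l` at the end.
admissible-shorten : ∀ {n} k₁ (ks : Vec ℕ n) l δ δ⃗ ε → δ ≤ k₁ → Last≤ ε l →
  Admissible (shorten (map suc (k₁ ∷ ks)) (map suc l) (δ ∷ δ⃗) ε)
admissible-shorten k₁ ks l δ δ⃗ ε δ≤k₁ h rewrite ℕₚ.+-∸-assoc 1 δ≤k₁
  with endsInY-word (k₁ ∸ δ ∷ zipWith _∸_ (map suc ks) δ⃗) l ε h
... | u , e = u , ≡.trans (word-suc (k₁ ∸ δ) (zipWith _∸_ (map suc ks) δ⃗) (zipWith _∸_ (map suc l) ε))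
                    (≡.cong (X ∷_) e)

-- Finite sums and their weights.

σ : ∀ {n} → Vec (ℕ × ℕ) n → ℕ
σ p = sum (δs p) ℕ.+ sum (εs p)

sum-∷ʳ : ∀ {n} (xs : Vec ℕ n) x → sum (xs ∷ʳ x) ≡ x ℕ.+ sum xs
sum-∷ʳ []       x = ≡.refl
sum-∷ʳ (y ∷ xs) x = ≡.trans (≡.cong (y ℕ.+_) (sum-∷ʳ xs x))
  (solve 3 (λ y x s → y :+ (x :+ s) := x :+ (y :+ s)) ≡.refl y x (sum xs))
  where open ℕ-Solver

small-εs : ∀ {n} {p : Vec (ℕ × ℕ) n} → Small p → All (_≤ 1) (εs p)
small-εs []       = []
small-εs (_∷_ {x = δ , ε} h s) = ℕₚ.≤-trans (ℕₚ.m≤n+m ε δ) h ∷ small-εs s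

σ≤ : ∀ {n} {p : Vec (ℕ × ℕ) n} → Small p → σ p ≤ n
σ≤ []      = z≤n
σ≤ {suc n} {(δ , ε) ∷ p} (h ∷ s) = subst (_≤ suc n)
  (solve 4 (λ a b c d → (a :+ b) :+ (c :+ d) := (a :+ c) :+ (b :+ d)) ≡.refl δ ε (sum (δs p)) (sum (εs p)))
  (ℕₚ.+-mono-≤ h (σ≤ s))
  where open ℕ-Solver

module FiniteSums (R : CommutativeRing 0ℓ 0ℓ) where

  open CommutativeRing R hiding (zero)
  open SemiringSolver commutativeSemiring using (solve; con; _:=_; _:+_; _:*_)
  open Sequences R

  ∑ : {A : Set} → List A → (A → Carrier) → Carrier
  ∑ xs t = List.foldr (λ x s → t x + s) 0# xs

  ∑-cong : ∀ {A : Set} (xs : List A) {t t′ : A → Carrier} → (∀ x → t x ≈ t′ x) → ∑ xs t ≈ ∑ xs t′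
  ∑-cong []       e = refl
  ∑-cong (x ∷ xs) e = +-cong (e x) (∑-cong xs e)

  ∑-++ : ∀ {A : Set} (xs ys : List A) (t : A → Carrier) → ∑ (xs ++ ys) t ≈ ∑ xs t + ∑ ys t
  ∑-++ []       ys t = sym (+-identityˡ (∑ ys t))
  ∑-++ (x ∷ xs) ys t = trans (+-congˡ (∑-++ xs ys t)) (sym (+-assoc (t x) (∑ xs t) (∑ ys t)))

  ∑-map : ∀ {A B : Set} (f : A → B) xs (t : B → Carrier) → ∑ (List.map f xs) t ≈ ∑ xs (λ x → t (f x))
  ∑-map f []       t = refl
  ∑-map f (x ∷ xs) t = +-congˡ (∑-map f xs t)

  ∑-+ : ∀ {A : Set} (xs : List A) (s t : A → Carrier) → ∑ xs (λ x → s x + t x) ≈ ∑ xs s + ∑ xs t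
  ∑-+ []       s t = sym (+-identityˡ 0#)
  ∑-+ (x ∷ xs) s t = trans (+-congˡ (∑-+ xs s t))
    (solve 4 (λ a b c d → (a :+ b) :+ (c :+ d) := (a :+ c) :+ (b :+ d)) refl (s x) (t x) (∑ xs s) (∑ xs t))

  ∑-0 : ∀ {A : Set} (xs : List A) → ∑ xs (λ _ → 0#) ≈ 0#
  ∑-0 []       = refl
  ∑-0 (x ∷ xs) = trans (+-identityˡ (∑ xs (λ _ → 0#))) (∑-0 xs)

  ∑-swap : ∀ {A B : Set} (xs : List A) (ys : List B) (t : A → B → Carrier) →
           ∑ xs (λ x → ∑ ys (t x)) ≈ ∑ ys (λ y → ∑ xs (λ x → t x y))
  ∑-swap []       ys t = sym (∑-0 ys)
  ∑-swap (x ∷ xs) ys t = trans (+-congˡ (∑-swap xs ys t))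
    (sym (∑-+ ys (t x) (λ y → ∑ xs (λ x → t x y))))

  ∑-cartesian : ∀ {A B C : Set} (f : A → B → C) xs ys (t : C → Carrier) →
                ∑ (cartesianProductWith f xs ys) t ≈ ∑ xs (λ x → ∑ ys (λ y → t (f x y)))
  ∑-cartesian f []       ys t = refl
  ∑-cartesian f (x ∷ xs) ys t = trans (∑-++ (List.map (f x) ys) (cartesianProductWith f xs ys) t)
    (+-cong (∑-map (f x) ys t) (∑-cartesian f xs ys t))

  weight : ∀ {n} → Carrier → Vec (ℕ × ℕ) n → Carrier
  weight ζ []                   = 1#
  weight ζ ((zero , zero) ∷ p)  = ζ * weight ζ p
  weight ζ ((zero , suc _) ∷ p) = weight ζ p
  weight ζ ((suc _ , _) ∷ p)    = weight ζ p

  -- The prefactor `x` is general so that it can collect the factors ζ of the coordinates already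
  -- summed.
  ∑-I^ : ∀ ζ x n {t H} → (∀ p → Small p → t p ≈ (x * weight ζ p) * H p) →
         ∑ (I^ n) t ≈ x * weighted ζ n H
  ∑-I^ ζ x zero    {t} {H} e = trans (+-identityʳ (t [])) (trans (e [] []) (*-congʳ (*-identityʳ x)))
  ∑-I^ ζ x (suc n) {t} {H} e = begin
    ∑ (I^ (suc n)) t
      ≈⟨ ∑-cartesian _∷_ I (I^ n) t ⟩
    S (0 , 0) + (S (1 , 0) + (S (0 , 1) + 0#))
      ≈⟨ +-cong (∑-I^ ζ (x * ζ) n λ p s → trans (e ((0 , 0) ∷ p) (z≤n ∷ s)) (*-congʳ (sym (*-assoc x ζ (weight ζ p)))))
           (+-cong (∑-I^ ζ x n λ p s → e ((1 , 0) ∷ p) (ℕₚ.≤-refl ∷ s))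
             (trans (+-identityʳ _) (∑-I^ ζ x n λ p s → e ((0 , 1) ∷ p) (ℕₚ.≤-refl ∷ s)))) ⟩
    (x * ζ) * W (0 , 0) + (x * W (1 , 0) + x * W (0 , 1))
      ≈⟨ solve 5 (λ x z a b c → (x :* z) :* a :+ (x :* b :+ x :* c) := x :* (z :* a :+ (b :+ c)))
           refl x ζ (W (0 , 0)) (W (1 , 0)) (W (0 , 1)) ⟩
    x * weighted ζ (suc n) H ∎
    where
    open SetoidReasoning setoid
    S W : ℕ × ℕ → Carrier
    S c = ∑ (I^ n) (λ p → t (c ∷ p))
    W c = weighted ζ n (λ p → H (c ∷ p))

  ∑-O : ∀ ζ x {t H} → t 0 ≈ (x * ζ) * H 0 → t 1 ≈ x * H 1 → ∑ O t ≈ x * weighted₂ ζ H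
  ∑-O ζ x {t} {H} e₀ e₁ = trans (+-cong e₀ (trans (+-identityʳ (t 1)) e₁))
    (solve 4 (λ x z a b → (x :* z) :* a :+ x :* b := x :* (z :* a :+ b)) refl x ζ (H 0) (H 1))

  -- co m s stands for ζ^(m − s), which is only used for s ≤ slack + m.
  record Powers (ζ : Carrier) (slack : ℕ) : Set where
    field
      co      : ℕ → ℕ → Carrier
      co-both : ∀ m s → co (suc m) (suc s) ≈ co m s
      co-suc  : ∀ m s → s ≤ slack ℕ.+ m → co (suc m) s ≈ ζ * co m s
      co-0    : co 0 0 ≈ 1#

    -- Each coordinate of `p` raises `m` by one and `s` by at most one, so the difference never
    -- falls below its initial value. This keeps `co-suc` applicable when an exponent starts at -1.
    co-weight : ∀ {n} {p : Vec (ℕ × ℕ) n} m s → Small p → s ≤ slack ℕ.+ m →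
                co (m ℕ.+ n) (s ℕ.+ σ p) ≈ co m s * weight ζ p
    co-weight m s [] h = trans
      (reflexive (≡.cong₂ co (ℕₚ.+-identityʳ m) (ℕₚ.+-identityʳ s))) (sym (*-identityʳ (co m s)))
    co-weight {suc n} {(zero , zero) ∷ p} m s (_ ∷ sm) h = begin
      co (m ℕ.+ suc n) (s ℕ.+ σ p)      ≡⟨ ≡.cong (λ k → co k (s ℕ.+ σ p)) (ℕₚ.+-suc m n) ⟩
      co (suc (m ℕ.+ n)) (s ℕ.+ σ p)    ≈⟨ co-suc (m ℕ.+ n) (s ℕ.+ σ p) (subst (s ℕ.+ σ p ≤_)
                                             (ℕₚ.+-assoc slack m n) (ℕₚ.+-mono-≤ h (σ≤ sm))) ⟩
      ζ * co (m ℕ.+ n) (s ℕ.+ σ p)      ≈⟨ *-congˡ (co-weight m s sm h) ⟩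
      ζ * (co m s * weight ζ p)         ≈⟨ solve 3 (λ z c w → z :* (c :* w) := c :* (z :* w)) refl ζ (co m s) (weight ζ p) ⟩
      co m s * (ζ * weight ζ p)         ∎
      where open SetoidReasoning setoid
    co-weight {suc n} {(suc zero , zero) ∷ p} m s (_ ∷ sm) h = trans
      (reflexive (≡.cong₂ co (ℕₚ.+-suc m n) (ℕₚ.+-suc s (σ p))))
      (trans (co-both (m ℕ.+ n) (s ℕ.+ σ p)) (co-weight m s sm h))
    co-weight {suc n} {(zero , suc zero) ∷ p} m s (_ ∷ sm) h = trans
      (reflexive (≡.cong₂ co (ℕₚ.+-suc m n)
        (≡.trans (≡.cong (s ℕ.+_) (ℕₚ.+-suc (sum (δs p)) (sum (εs p)))) (ℕₚ.+-suc s (σ p)))))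
      (trans (co-both (m ℕ.+ n) (s ℕ.+ σ p)) (co-weight m s sm h))
    co-weight {suc n} {(suc (suc _) , _) ∷ p} m s (s≤s () ∷ sm) h
    co-weight {suc n} {(suc zero , suc _) ∷ p} m s (s≤s () ∷ sm) h
    co-weight {suc n} {(zero , suc (suc _)) ∷ p} m s (s≤s () ∷ sm) h

    co-1-0 : co 1 0 ≈ ζ
    co-1-0 = trans (co-suc 0 0 z≤n) (trans (*-congˡ co-0) (*-identityʳ ζ))

    co-1-1 : co 1 1 ≈ 1#
    co-1-1 = trans (co-both 0 0) co-0

  module SideSums {ζ slack} (pow : Powers ζ slack) (h : Word → Carrier) where

    open Powers pow
    open Sides ζ h

    term : ∀ {m} → Vec ℕ m → Vec ℕ m → Vec ℕ m → Vec ℕ m → Carrier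
    term {m} k l δ ε = co m (sum δ ℕ.+ sum ε) * h (shorten k l δ ε)

    weigh : ∀ {n} d s x (p : Vec (ℕ × ℕ) n) y {s′} → Small p → s ≤ slack ℕ.+ d →
      s′ ≡ s ℕ.+ σ p → co d s ≈ x → co (d ℕ.+ n) s′ * y ≈ (x * weight ζ p) * y
    weigh {n} d s x p y sm s≤ e co≈ = *-congʳ (trans (reflexive (≡.cong (co (d ℕ.+ n)) e))
      (trans (co-weight d s sm s≤) (*-congʳ co≈)))

    ∑-I^-O : ∀ x n {t H : Vec (ℕ × ℕ) n → ℕ → Carrier} →
      (∀ p → Small p → t p 0 ≈ ((x * ζ) * weight ζ p) * H p 0) →
      (∀ p → Small p → t p 1 ≈ (x * weight ζ p) * H p 1) →
      ∑ (I^ n) (λ p → ∑ O (t p)) ≈ x * weighted ζ n (λ p → weighted₂ ζ (H p))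
    ∑-I^-O x n {t} {H} e₀ e₁ = ∑-I^ ζ x n {λ p → ∑ O (t p)} λ p s → ∑-O ζ (x * weight ζ p) {t p} {H p}
      (trans (e₀ p s) (*-congʳ (solve 3 (λ x z w → (x :* z) :* w := (x :* w) :* z) refl x ζ (weight ζ p))))
      (e₁ p s)

    sum-cons : ∀ {n} (p : Vec (ℕ × ℕ) n) δ ε → sum (δ ∷ δs p) ℕ.+ sum (ε ∷ εs p) ≡ (δ ℕ.+ ε) ℕ.+ σ p
    sum-cons p δ ε = N.solve 4 (λ a b c d → (a N.:+ c) N.:+ (b N.:+ d) N.:= (a N.:+ b) N.:+ (c N.:+ d))
      ≡.refl δ ε (sum (δs p)) (sum (εs p))
      where module N = ℕ-Solver

    sum-snoc : ∀ {n} (p : Vec (ℕ × ℕ) n) δ ε → sum (δs p ∷ʳ δ) ℕ.+ sum (εs p ∷ʳ ε) ≡ (δ ℕ.+ ε) ℕ.+ σ p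
    sum-snoc p δ ε = ≡.trans (≡.cong₂ ℕ._+_ (sum-∷ʳ (δs p) δ) (sum-∷ʳ (εs p) ε)) (sum-cons p δ ε)

    sum-rotate : ∀ {n} (p : Vec (ℕ × ℕ) n) δ ε → sum (δ ∷ δs p) ℕ.+ sum (εs p ∷ʳ ε) ≡ (δ ℕ.+ ε) ℕ.+ σ p
    sum-rotate p δ ε = ≡.trans (≡.cong (sum (δ ∷ δs p) ℕ.+_) (sum-∷ʳ (εs p) ε)) (sum-cons p δ ε)

    sum-both : ∀ {n} (p : Vec (ℕ × ℕ) n) δ ε →
      sum (0 ∷ (δs p ∷ʳ δ)) ℕ.+ sum (ε ∷ (εs p ∷ʳ 0)) ≡ (ε ℕ.+ δ) ℕ.+ σ p
    sum-both p δ ε = ≡.trans (≡.cong₂ (λ a b → a ℕ.+ (ε ℕ.+ b)) (sum-∷ʳ (δs p) δ) (sum-∷ʳ (εs p) 0))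
      (N.solve 4 (λ a b c d → (a N.:+ c) N.:+ (b N.:+ d) N.:= (b N.:+ a) N.:+ (c N.:+ d))
        ≡.refl δ ε (sum (δs p)) (sum (εs p)))
      where module N = ℕ-Solver

    1≤slack+1 : 1 ≤ slack ℕ.+ 1
    1≤slack+1 = ℕₚ.m≤n+m 1 slack

    co-1-0′ : co 1 0 ≈ 1# * ζ
    co-1-0′ = trans co-1-0 (sym (*-identityˡ ζ))

    ∑-left-i : ∀ {n} (k l : Vec ℕ (suc n)) → ∑ (I^ (suc n)) (λ p → term k l (δs p) (εs p)) ≈ left-i k l
    ∑-left-i {n} k l = trans
      (∑-I^ ζ 1# (suc n) {λ p → term k l (δs p) (εs p)} {H} λ p sm → weigh 0 0 1# p (H p) sm z≤n ≡.refl co-0)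
      (*-identityˡ (weighted ζ (suc n) H))
      where
      H : Vec (ℕ × ℕ) (suc n) → Carrier
      H p = h (shorten k l (δs p) (εs p))

    ∑-left-ii : ∀ {n} (k l : Vec ℕ (suc n)) →
      ∑ O (λ i → ∑ (I^ n) λ p → term k l (0 ∷ δs p) (i ∷ εs p)) ≈ left-ii k l
    ∑-left-ii {n} k l = trans (∑-O ζ 1# {λ i → ∑ (I^ n) (t i)} {λ i → weighted ζ n (H i)}
      (∑-I^ ζ (1# * ζ) n {t 0} {H 0} λ p sm → weigh 1 0 (1# * ζ) p (H 0 p) sm z≤n (sum-cons p 0 0) co-1-0′)
      (∑-I^ ζ 1# n {t 1} {H 1} λ p sm → weigh 1 1 1# p (H 1 p) sm 1≤slack+1 (sum-cons p 0 1) co-1-1))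
      (*-identityˡ (weighted₂ ζ λ i → weighted ζ n (H i)))
      where
      t H : ℕ → Vec (ℕ × ℕ) n → Carrier
      t i p = term k l (0 ∷ δs p) (i ∷ εs p)
      H i p = h (shorten k l (0 ∷ δs p) (i ∷ εs p))

    ∑-left-iii : ∀ {n} (k l : Vec ℕ (suc n)) →
      ∑ (I^ n) (λ p → ∑ O λ i → term k l (δs p ∷ʳ i) (εs p ∷ʳ 0)) ≈ left-iii k l
    ∑-left-iii {n} k l = trans (∑-I^-O 1# n {t} {H}
      (λ p sm → weigh 1 0 (1# * ζ) p (H p 0) sm z≤n (sum-snoc p 0 0) co-1-0′)
      (λ p sm → weigh 1 1 1# p (H p 1) sm 1≤slack+1 (sum-snoc p 1 0) co-1-1))
      (*-identityˡ (weighted ζ n λ p → weighted₂ ζ (H p)))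
      where
      t H : Vec (ℕ × ℕ) n → ℕ → Carrier
      t p i = term k l (δs p ∷ʳ i) (εs p ∷ʳ 0)
      H p i = h (shorten k l (δs p ∷ʳ i) (εs p ∷ʳ 0))

    ∑-left-iv : ∀ {n} (k l : Vec ℕ (suc (suc n))) →
      ∑ O (λ i → ∑ (I^ n) λ p → ∑ O λ j → term k l (0 ∷ (δs p ∷ʳ j)) (i ∷ (εs p ∷ʳ 0))) ≈ left-iv k l
    ∑-left-iv {n} k l = trans
      (∑-O ζ 1# {λ i → ∑ (I^ n) λ p → ∑ O (t i p)} {λ i → weighted ζ n λ p → weighted₂ ζ (H i p)}
        (∑-I^-O (1# * ζ) n {t 0} {H 0}
          (λ p sm → weigh 2 0 (1# * ζ * ζ) p (H 0 p 0) sm z≤n (sum-both p 0 0)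
            (trans (co-suc 1 0 z≤n) (trans (*-congˡ co-1-0′) (*-comm ζ (1# * ζ)))))
          (λ p sm → weigh 2 1 (1# * ζ) p (H 0 p 1) sm 1≤slack+2 (sum-both p 1 0) co-2-1))
        (∑-I^-O 1# n {t 1} {H 1}
          (λ p sm → weigh 2 1 (1# * ζ) p (H 1 p 0) sm 1≤slack+2 (sum-both p 0 1) co-2-1)
          (λ p sm → weigh 2 2 1# p (H 1 p 1) sm (ℕₚ.m≤n+m 2 slack) (sum-both p 1 1)
            (trans (co-both 1 1) co-1-1))))
      (*-identityˡ (weighted₂ ζ λ i → weighted ζ n λ p → weighted₂ ζ (H i p)))
      where
      t H : ℕ → Vec (ℕ × ℕ) n → ℕ → Carrier
      t i p j = term k l (0 ∷ (δs p ∷ʳ j)) (i ∷ (εs p ∷ʳ 0))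
      H i p j = h (shorten k l (0 ∷ (δs p ∷ʳ j)) (i ∷ (εs p ∷ʳ 0)))
      1≤slack+2 : 1 ≤ slack ℕ.+ 2
      1≤slack+2 = ℕₚ.≤-trans 1≤slack+1 (ℕₚ.+-monoʳ-≤ slack (s≤s z≤n))
      co-2-1 : co 2 1 ≈ 1# * ζ
      co-2-1 = trans (co-both 1 0) co-1-0′

    -- The only side in which the exponent -1 occurs, when letters are removed at both ends and in
    -- every block. The sum is therefore built up from `u`, the inverse of ζ, each choice that keeps
    -- its letters contributing a factor ζ.
    ∑-right-i : ∀ {n} (k l : Vec ℕ (suc n)) u → u * ζ ≈ 1# → co 0 1 ≈ u → 1 ≤ slack →
      ∑ O (λ i → ∑ (I^ n) λ p → ∑ O λ j → term k l (i ∷ δs p) (εs p ∷ʳ j)) ≈ u * right-i k l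
    ∑-right-i {n} k l u uζ co≈u 1≤s =
      ∑-O ζ u {λ i → ∑ (I^ n) λ p → ∑ O (t i p)} {λ i → weighted ζ n λ p → weighted₂ ζ (H i p)}
        (∑-I^-O (u * ζ) n {t 0} {H 0}
          (λ p sm → weigh 1 0 (u * ζ * ζ) p (H 0 p 0) sm z≤n (sum-rotate p 0 0)
            (trans co-1-0 (sym (trans (*-congʳ uζ) (*-identityˡ ζ)))))
          (λ p sm → weigh 1 1 (u * ζ) p (H 0 p 1) sm 1≤slack+1 (sum-rotate p 0 1) co-1-1′))
        (∑-I^-O u n {t 1} {H 1}
          (λ p sm → weigh 1 1 (u * ζ) p (H 1 p 0) sm 1≤slack+1 (sum-rotate p 1 0) co-1-1′)
          (λ p sm → weigh 1 2 u p (H 1 p 1) sm (ℕₚ.+-monoˡ-≤ 1 1≤s) (sum-rotate p 1 1)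
            (trans (co-both 0 1) co≈u)))
      where
      t H : ℕ → Vec (ℕ × ℕ) n → ℕ → Carrier
      t i p j = term k l (i ∷ δs p) (εs p ∷ʳ j)
      H i p j = h (shorten k l (i ∷ δs p) (εs p ∷ʳ j))
      co-1-1′ : co 1 1 ≈ u * ζ
      co-1-1′ = trans co-1-1 (sym uζ)

    ∑-right-ii : ∀ {n} (k l : Vec ℕ (suc n)) →
      ∑ (I^ n) (λ p → ∑ O λ i → term k l (0 ∷ δs p) (εs p ∷ʳ i)) ≈ right-ii k l
    ∑-right-ii {n} k l = trans (∑-I^-O 1# n {t} {H}
      (λ p sm → weigh 1 0 (1# * ζ) p (H p 0) sm z≤n (sum-rotate p 0 0) co-1-0′)
      (λ p sm → weigh 1 1 1# p (H p 1) sm 1≤slack+1 (sum-rotate p 0 1) co-1-1))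
      (*-identityˡ (weighted ζ n λ p → weighted₂ ζ (H p)))
      where
      t H : Vec (ℕ × ℕ) n → ℕ → Carrier
      t p i = term k l (0 ∷ δs p) (εs p ∷ʳ i)
      H p i = h (shorten k l (0 ∷ δs p) (εs p ∷ʳ i))

    ∑-right-iii : ∀ {n} (k l : Vec ℕ (suc n)) →
      ∑ O (λ i → ∑ (I^ n) λ p → term k l (i ∷ δs p) (εs p ∷ʳ 0)) ≈ right-iii k l
    ∑-right-iii {n} k l = trans (∑-O ζ 1# {λ i → ∑ (I^ n) (t i)} {λ i → weighted ζ n (H i)}
      (∑-I^ ζ (1# * ζ) n {t 0} {H 0} λ p sm → weigh 1 0 (1# * ζ) p (H 0 p) sm z≤n (sum-rotate p 0 0) co-1-0′)
      (∑-I^ ζ 1# n {t 1} {H 1} λ p sm → weigh 1 1 1# p (H 1 p) sm 1≤slack+1 (sum-rotate p 1 0) co-1-1))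
      (*-identityˡ (weighted₂ ζ λ i → weighted ζ n (H i)))
      where
      t H : ℕ → Vec (ℕ × ℕ) n → Carrier
      t i p = term k l (i ∷ δs p) (εs p ∷ʳ 0)
      H i p = h (shorten k l (i ∷ δs p) (εs p ∷ʳ 0))

    ∑-right-iv : ∀ {n} (k l : Vec ℕ (suc (suc n))) →
      ∑ (I^ (suc n)) (λ p → term k l (0 ∷ δs p) (εs p ∷ʳ 0)) ≈ right-iv k l
    ∑-right-iv {n} k l = ∑-I^ ζ ζ (suc n) {λ p → term k l (0 ∷ δs p) (εs p ∷ʳ 0)} {H}
      λ p sm → weigh 1 0 ζ p (H p) sm z≤n (sum-rotate p 0 0) co-1-0
      where
      H : Vec (ℕ × ℕ) (suc n) → Carrier
      H p = h (shorten k l (0 ∷ δs p) (εs p ∷ʳ 0))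

-- Reading words backwards with x and y exchanged.

reverse-∷ʳ : ∀ {A : Set} {n} (xs : Vec A n) x → reverse (xs ∷ʳ x) ≡ x ∷ reverse xs
reverse-∷ʳ xs x = Vecₚ.reverse-reverse (≡.trans (Vecₚ.reverse-∷ x (reverse xs))
  (≡.cong (_∷ʳ x) (Vecₚ.reverse-involutive xs)))

zipWith-∷ʳ : ∀ {A B C : Set} (f : A → B → C) {n} (xs : Vec A n) ys x y →
             zipWith f (xs ∷ʳ x) (ys ∷ʳ y) ≡ zipWith f xs ys ∷ʳ f x y
zipWith-∷ʳ f []        []        x y = ≡.refl
zipWith-∷ʳ f (x′ ∷ xs) (y′ ∷ ys) x y = ≡.cong (f x′ y′ ∷_) (zipWith-∷ʳ f xs ys x y)

zipWith-reverse : ∀ {A B C : Set} (f : A → B → C) {n} (xs : Vec A n) ys →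
                  reverse (zipWith f xs ys) ≡ zipWith f (reverse xs) (reverse ys)
zipWith-reverse f []       []       = ≡.refl
zipWith-reverse f (x ∷ xs) (y ∷ ys) = begin
  reverse (f x y ∷ zipWith f xs ys)                ≡⟨ Vecₚ.reverse-∷ (f x y) (zipWith f xs ys) ⟩
  reverse (zipWith f xs ys) ∷ʳ f x y               ≡⟨ ≡.cong (_∷ʳ f x y) (zipWith-reverse f xs ys) ⟩
  zipWith f (reverse xs) (reverse ys) ∷ʳ f x y     ≡⟨ zipWith-∷ʳ f (reverse xs) (reverse ys) x y ⟨
  zipWith f (reverse xs ∷ʳ x) (reverse ys ∷ʳ y)    ≡⟨ ≡.cong₂ (zipWith f) (Vecₚ.reverse-∷ x xs) (Vecₚ.reverse-∷ y ys) ⟨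
  zipWith f (reverse (x ∷ xs)) (reverse (y ∷ ys))  ∎
  where open ≡.≡-Reasoning

sum-reverse : ∀ {n} (xs : Vec ℕ n) → sum (reverse xs) ≡ sum xs
sum-reverse []       = ≡.refl
sum-reverse (x ∷ xs) = ≡.trans (≡.cong sum (Vecₚ.reverse-∷ x xs))
  (≡.trans (sum-∷ʳ (reverse xs) x) (≡.cong (x ℕ.+_) (sum-reverse xs)))

All-∷ʳ : ∀ {A : Set} {P : A → Set} {n} {xs : Vec A n} {x} → All P xs → P x → All P (xs ∷ʳ x)
All-∷ʳ []         p = p ∷ []
All-∷ʳ (q ∷ qs)   p = q ∷ All-∷ʳ qs p

All-reverse : ∀ {A : Set} {P : A → Set} {n} {xs : Vec A n} → All P xs → All P (reverse xs)
All-reverse []                            = []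
All-reverse {P = P} (_∷_ {x = x} {xs = xs} p ps) =
  subst (All P) (≡.sym (Vecₚ.reverse-∷ x xs)) (All-∷ʳ (All-reverse ps) p)

-- The symmetry of I^ m under reading a word backwards with x and y exchanged.
reflect : ∀ {m} → Vec (ℕ × ℕ) m → Vec (ℕ × ℕ) m
reflect p = reverse (map swap p)

δs-reflect : ∀ {m} (p : Vec (ℕ × ℕ) m) → δs (reflect p) ≡ reverse (εs p)
δs-reflect p = ≡.trans (Vecₚ.map-reverse proj₁ (map swap p))
  (≡.cong reverse (≡.sym (Vecₚ.map-∘ proj₁ swap p)))

εs-reflect : ∀ {m} (p : Vec (ℕ × ℕ) m) → εs (reflect p) ≡ reverse (δs p)
εs-reflect p = ≡.trans (Vecₚ.map-reverse proj₂ (map swap p))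
  (≡.cong reverse (≡.sym (Vecₚ.map-∘ proj₂ swap p)))

module Reflection (R : CommutativeRing 0ℓ 0ℓ) where

  open CommutativeRing R hiding (zero)
  open SemiringSolver commutativeSemiring using (solve; con; _:=_; _:+_; _:*_)
  open FiniteSums R

  -- `I^` branches on the first coordinate, whereas a reversed vector has to be branched on its last
  -- one.
  ∑-I^-∷ʳ : ∀ m (t : Vec (ℕ × ℕ) (suc m) → Carrier) →
            ∑ (I^ (suc m)) t ≈ ∑ (I^ m) (λ p → ∑ I (λ c → t (p ∷ʳ c)))
  ∑-I^-∷ʳ zero    t = trans (∑-cartesian _∷_ I (I^ 0) t) (∑-swap I (I^ 0) (λ c p → t (c ∷ p)))
  ∑-I^-∷ʳ (suc m) t = begin
    ∑ (I^ (suc (suc m))) t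
      ≈⟨ ∑-cartesian _∷_ I (I^ (suc m)) t ⟩
    ∑ I (λ c → ∑ (I^ (suc m)) (λ p → t (c ∷ p)))
      ≈⟨ ∑-cong I (λ c → ∑-I^-∷ʳ m (λ p → t (c ∷ p))) ⟩
    ∑ I (λ c → ∑ (I^ m) (λ p → ∑ I (λ d → t (c ∷ (p ∷ʳ d)))))
      ≈⟨ ∑-cartesian _∷_ I (I^ m) (λ p → ∑ I (λ d → t (p ∷ʳ d))) ⟨
    ∑ (I^ (suc m)) (λ p → ∑ I (λ d → t (p ∷ʳ d))) ∎
    where open SetoidReasoning setoid

  ∑-I-swap : ∀ (t : ℕ × ℕ → Carrier) → ∑ I (λ c → t (swap c)) ≈ ∑ I t
  ∑-I-swap t = +-congˡ (trans (sym (+-assoc _ _ 0#)) (trans (+-congʳ (+-comm _ _)) (+-assoc _ _ 0#)))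

  ∑-I^-reflect : ∀ m (t : Vec (ℕ × ℕ) m → Carrier) → ∑ (I^ m) (λ p → t (reflect p)) ≈ ∑ (I^ m) t
  ∑-I^-reflect zero    t = refl
  ∑-I^-reflect (suc m) t = begin
    ∑ (I^ (suc m)) (λ p → t (reflect p))
      ≈⟨ ∑-cartesian _∷_ I (I^ m) (λ p → t (reflect p)) ⟩
    ∑ I (λ c → ∑ (I^ m) (λ p → t (reflect (c ∷ p))))
      ≈⟨ ∑-cong I (λ c → ∑-cong (I^ m) (λ p →
           reflexive (≡.cong t (Vecₚ.reverse-∷ (swap c) (map swap p))))) ⟩
    ∑ I (λ c → ∑ (I^ m) (λ p → t (reflect p ∷ʳ swap c)))
      ≈⟨ ∑-cong I (λ c → ∑-I^-reflect m (λ p → t (p ∷ʳ swap c))) ⟩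
    ∑ I (λ c → ∑ (I^ m) (λ p → t (p ∷ʳ swap c)))
      ≈⟨ ∑-swap I (I^ m) (λ c p → t (p ∷ʳ swap c)) ⟩
    ∑ (I^ m) (λ p → ∑ I (λ c → t (p ∷ʳ swap c)))
      ≈⟨ ∑-cong (I^ m) (λ p → ∑-I-swap (λ c → t (p ∷ʳ c))) ⟩
    ∑ (I^ m) (λ p → ∑ I (λ c → t (p ∷ʳ c)))
      ≈⟨ ∑-I^-∷ʳ m t ⟨
    ∑ (I^ (suc m)) t ∎
    where open SetoidReasoning setoid

  -- `s` is meant as a summand for g and `t` as the summand for f at the reversed vectors, where δ
  -- and ε have changed roles. Prepending and appending are thus exchanged, which interchanges (ii)
  -- with (iii) and preserves (i) and (iv).
  module _ {n} (s t : Vec ℕ (suc n) → Vec ℕ (suc n) → Carrier)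
           (s≡t : ∀ δ ε → s δ ε ≡ t (reverse ε) (reverse δ)) where

    reflect-cons-snoc : ∀ (p : Vec (ℕ × ℕ) n) i j →
      s (i ∷ δs p) (εs p ∷ʳ j) ≡ t (j ∷ δs (reflect p)) (εs (reflect p) ∷ʳ i)
    reflect-cons-snoc p i j = ≡.trans (s≡t (i ∷ δs p) (εs p ∷ʳ j)) (≡.cong₂ t
      (≡.trans (reverse-∷ʳ (εs p) j) (≡.cong (j ∷_) (≡.sym (δs-reflect p))))
      (≡.trans (Vecₚ.reverse-∷ i (δs p)) (≡.cong (_∷ʳ i) (≡.sym (εs-reflect p)))))

    reflect-cons-cons : ∀ (p : Vec (ℕ × ℕ) n) i j →
      s (i ∷ δs p) (j ∷ εs p) ≡ t (δs (reflect p) ∷ʳ j) (εs (reflect p) ∷ʳ i)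
    reflect-cons-cons p i j = ≡.trans (s≡t (i ∷ δs p) (j ∷ εs p)) (≡.cong₂ t
      (≡.trans (Vecₚ.reverse-∷ j (εs p)) (≡.cong (_∷ʳ j) (≡.sym (δs-reflect p))))
      (≡.trans (Vecₚ.reverse-∷ i (δs p)) (≡.cong (_∷ʳ i) (≡.sym (εs-reflect p)))))

    reflect-snoc-snoc : ∀ (p : Vec (ℕ × ℕ) n) i j →
      s (δs p ∷ʳ i) (εs p ∷ʳ j) ≡ t (j ∷ δs (reflect p)) (i ∷ εs (reflect p))
    reflect-snoc-snoc p i j = ≡.trans (s≡t (δs p ∷ʳ i) (εs p ∷ʳ j)) (≡.cong₂ t
      (≡.trans (reverse-∷ʳ (εs p) j) (≡.cong (j ∷_) (≡.sym (δs-reflect p))))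
      (≡.trans (reverse-∷ʳ (δs p) i) (≡.cong (i ∷_) (≡.sym (εs-reflect p)))))

    reflect-left-i : ∑ (I^ (suc n)) (λ p → s (δs p) (εs p)) ≈ ∑ (I^ (suc n)) (λ p → t (δs p) (εs p))
    reflect-left-i = trans
      (∑-cong (I^ (suc n)) (λ p → reflexive (≡.trans (s≡t (δs p) (εs p))
        (≡.cong₂ t (≡.sym (δs-reflect p)) (≡.sym (εs-reflect p))))))
      (∑-I^-reflect (suc n) (λ p → t (δs p) (εs p)))

    reflect-right-i : ∑ O (λ i → ∑ (I^ n) λ p → ∑ O λ j → s (i ∷ δs p) (εs p ∷ʳ j))
                    ≈ ∑ O (λ i → ∑ (I^ n) λ p → ∑ O λ j → t (i ∷ δs p) (εs p ∷ʳ j))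
    reflect-right-i = begin
      ∑ O (λ i → ∑ (I^ n) λ p → ∑ O λ j → s (i ∷ δs p) (εs p ∷ʳ j))
        ≈⟨ ∑-cong O (λ i → trans
             (∑-cong (I^ n) (λ p → ∑-cong O λ j → reflexive (reflect-cons-snoc p i j)))
             (∑-I^-reflect n (λ p → ∑ O λ j → t (j ∷ δs p) (εs p ∷ʳ i)))) ⟩
      ∑ O (λ i → ∑ (I^ n) λ p → ∑ O λ j → t (j ∷ δs p) (εs p ∷ʳ i))
        -- The two end choices now occur in the wrong order; the three interchanges that follow move
        -- the outer one past the inner one.
        ≈⟨ ∑-swap O (I^ n) (λ i p → ∑ O λ j → t (j ∷ δs p) (εs p ∷ʳ i)) ⟩
      ∑ (I^ n) (λ p → ∑ O λ i → ∑ O λ j → t (j ∷ δs p) (εs p ∷ʳ i))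
        ≈⟨ ∑-cong (I^ n) (λ p → ∑-swap O O (λ i j → t (j ∷ δs p) (εs p ∷ʳ i))) ⟩
      ∑ (I^ n) (λ p → ∑ O λ j → ∑ O λ i → t (j ∷ δs p) (εs p ∷ʳ i))
        ≈⟨ ∑-swap (I^ n) O (λ p j → ∑ O λ i → t (j ∷ δs p) (εs p ∷ʳ i)) ⟩
      ∑ O (λ j → ∑ (I^ n) λ p → ∑ O λ i → t (j ∷ δs p) (εs p ∷ʳ i)) ∎
      where open SetoidReasoning setoid

    reflect-left-ii : ∑ O (λ i → ∑ (I^ n) λ p → s (0 ∷ δs p) (i ∷ εs p))
                    ≈ ∑ (I^ n) (λ p → ∑ O λ i → t (δs p ∷ʳ i) (εs p ∷ʳ 0))
    reflect-left-ii = trans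
      (∑-cong O λ i → trans (∑-cong (I^ n) λ p → reflexive (reflect-cons-cons p 0 i))
        (∑-I^-reflect n λ p → t (δs p ∷ʳ i) (εs p ∷ʳ 0)))
      (∑-swap O (I^ n) λ i p → t (δs p ∷ʳ i) (εs p ∷ʳ 0))

    reflect-right-ii : ∑ (I^ n) (λ p → ∑ O λ i → s (0 ∷ δs p) (εs p ∷ʳ i))
                     ≈ ∑ O (λ i → ∑ (I^ n) λ p → t (i ∷ δs p) (εs p ∷ʳ 0))
    reflect-right-ii = trans
      (trans (∑-cong (I^ n) λ p → ∑-cong O λ i → reflexive (reflect-cons-snoc p 0 i))
        (∑-I^-reflect n λ p → ∑ O λ i → t (i ∷ δs p) (εs p ∷ʳ 0)))
      (∑-swap (I^ n) O λ p i → t (i ∷ δs p) (εs p ∷ʳ 0))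

    reflect-left-iii : ∑ (I^ n) (λ p → ∑ O λ i → s (δs p ∷ʳ i) (εs p ∷ʳ 0))
                     ≈ ∑ O (λ i → ∑ (I^ n) λ p → t (0 ∷ δs p) (i ∷ εs p))
    reflect-left-iii = trans
      (trans (∑-cong (I^ n) λ p → ∑-cong O λ i → reflexive (reflect-snoc-snoc p i 0))
        (∑-I^-reflect n λ p → ∑ O λ i → t (0 ∷ δs p) (i ∷ εs p)))
      (∑-swap (I^ n) O λ p i → t (0 ∷ δs p) (i ∷ εs p))

    reflect-right-iii : ∑ O (λ i → ∑ (I^ n) λ p → s (i ∷ δs p) (εs p ∷ʳ 0))
                      ≈ ∑ (I^ n) (λ p → ∑ O λ i → t (0 ∷ δs p) (εs p ∷ʳ i))
    reflect-right-iii = trans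
      (∑-cong O λ i → trans (∑-cong (I^ n) λ p → reflexive (reflect-cons-snoc p i 0))
        (∑-I^-reflect n λ p → t (0 ∷ δs p) (εs p ∷ʳ i)))
      (∑-swap O (I^ n) λ i p → t (0 ∷ δs p) (εs p ∷ʳ i))

    reflect-right-iv : ∑ (I^ n) (λ p → s (0 ∷ δs p) (εs p ∷ʳ 0)) ≈ ∑ (I^ n) (λ p → t (0 ∷ δs p) (εs p ∷ʳ 0))
    reflect-right-iv = trans (∑-cong (I^ n) λ p → reflexive (reflect-cons-snoc p 0 0))
      (∑-I^-reflect n λ p → t (0 ∷ δs p) (εs p ∷ʳ 0))

  reflect-left-iv : ∀ {n} (s t : Vec ℕ (suc (suc n)) → Vec ℕ (suc (suc n)) → Carrier) →
    (∀ δ ε → s δ ε ≡ t (reverse ε) (reverse δ)) →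
    ∑ O (λ i → ∑ (I^ n) λ p → ∑ O λ j → s (0 ∷ (δs p ∷ʳ j)) (i ∷ (εs p ∷ʳ 0)))
    ≈ ∑ O (λ i → ∑ (I^ n) λ p → ∑ O λ j → t (0 ∷ (δs p ∷ʳ j)) (i ∷ (εs p ∷ʳ 0)))
  reflect-left-iv {n} s t s≡t = begin
    ∑ O (λ i → ∑ (I^ n) λ p → ∑ O λ j → s (0 ∷ (δs p ∷ʳ j)) (i ∷ (εs p ∷ʳ 0)))
      ≈⟨ ∑-cong O (λ i → trans
           (∑-cong (I^ n) (λ p → ∑-cong O λ j → reflexive (≡.trans (s≡t (0 ∷ (δs p ∷ʳ j)) (i ∷ (εs p ∷ʳ 0))) (≡.cong₂ t
             (≡.trans (Vecₚ.reverse-∷ i (εs p ∷ʳ 0)) (≡.cong (_∷ʳ i)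
               (≡.trans (reverse-∷ʳ (εs p) 0) (≡.cong (0 ∷_) (≡.sym (δs-reflect p))))))
             (≡.trans (Vecₚ.reverse-∷ 0 (δs p ∷ʳ j)) (≡.cong (_∷ʳ 0)
               (≡.trans (reverse-∷ʳ (δs p) j) (≡.cong (j ∷_) (≡.sym (εs-reflect p))))))))))
           (∑-I^-reflect n (λ p → ∑ O λ j → t (0 ∷ (δs p ∷ʳ i)) (j ∷ (εs p ∷ʳ 0))))) ⟩
    ∑ O (λ i → ∑ (I^ n) λ p → ∑ O λ j → t (0 ∷ (δs p ∷ʳ i)) (j ∷ (εs p ∷ʳ 0)))
      ≈⟨ ∑-swap O (I^ n) (λ i p → ∑ O λ j → t (0 ∷ (δs p ∷ʳ i)) (j ∷ (εs p ∷ʳ 0))) ⟩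
    ∑ (I^ n) (λ p → ∑ O λ i → ∑ O λ j → t (0 ∷ (δs p ∷ʳ i)) (j ∷ (εs p ∷ʳ 0)))
      ≈⟨ ∑-cong (I^ n) (λ p → ∑-swap O O (λ i j → t (0 ∷ (δs p ∷ʳ i)) (j ∷ (εs p ∷ʳ 0)))) ⟩
    ∑ (I^ n) (λ p → ∑ O λ j → ∑ O λ i → t (0 ∷ (δs p ∷ʳ i)) (j ∷ (εs p ∷ʳ 0)))
      ≈⟨ ∑-swap (I^ n) O (λ p j → ∑ O λ i → t (0 ∷ (δs p ∷ʳ i)) (j ∷ (εs p ∷ʳ 0))) ⟩
    ∑ O (λ j → ∑ (I^ n) λ p → ∑ O λ i → t (0 ∷ (δs p ∷ʳ i)) (j ∷ (εs p ∷ʳ 0))) ∎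
    where open SetoidReasoning setoid

  module _ {n} (s t s′ t′ : Vec ℕ (suc n) → Vec ℕ (suc n) → Carrier)
           (s≡t : ∀ δ ε → s δ ε ≡ t (reverse ε) (reverse δ))
           (s′≡t′ : ∀ δ ε → s′ δ ε ≡ t′ (reverse ε) (reverse δ)) where

    reflected-i :
      ∑ (I^ (suc n)) (λ p → t (δs p) (εs p)) ≈ ∑ O (λ i → ∑ (I^ n) λ p → ∑ O λ j → t′ (i ∷ δs p) (εs p ∷ʳ j)) →
      ∑ (I^ (suc n)) (λ p → s (δs p) (εs p)) ≈ ∑ O (λ i → ∑ (I^ n) λ p → ∑ O λ j → s′ (i ∷ δs p) (εs p ∷ʳ j))
    reflected-i e = trans (reflect-left-i s t s≡t) (trans e (sym (reflect-right-i s′ t′ s′≡t′)))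

    reflected-ii :
      ∑ (I^ n) (λ p → ∑ O λ i → t (δs p ∷ʳ i) (εs p ∷ʳ 0)) ≈ ∑ O (λ i → ∑ (I^ n) λ p → t′ (i ∷ δs p) (εs p ∷ʳ 0)) →
      ∑ O (λ i → ∑ (I^ n) λ p → s (0 ∷ δs p) (i ∷ εs p)) ≈ ∑ (I^ n) (λ p → ∑ O λ i → s′ (0 ∷ δs p) (εs p ∷ʳ i))
    reflected-ii e = trans (reflect-left-ii s t s≡t) (trans e (sym (reflect-right-ii s′ t′ s′≡t′)))

    reflected-iii :
      ∑ O (λ i → ∑ (I^ n) λ p → t (0 ∷ δs p) (i ∷ εs p)) ≈ ∑ (I^ n) (λ p → ∑ O λ i → t′ (0 ∷ δs p) (εs p ∷ʳ i)) →
      ∑ (I^ n) (λ p → ∑ O λ i → s (δs p ∷ʳ i) (εs p ∷ʳ 0)) ≈ ∑ O (λ i → ∑ (I^ n) λ p → s′ (i ∷ δs p) (εs p ∷ʳ 0))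
    reflected-iii e = trans (reflect-left-iii s t s≡t) (trans e (sym (reflect-right-iii s′ t′ s′≡t′)))

  module _ {n} (s t s′ t′ : Vec ℕ (suc (suc n)) → Vec ℕ (suc (suc n)) → Carrier)
           (s≡t : ∀ δ ε → s δ ε ≡ t (reverse ε) (reverse δ))
           (s′≡t′ : ∀ δ ε → s′ δ ε ≡ t′ (reverse ε) (reverse δ)) where

    reflected-iv :
      ∑ O (λ i → ∑ (I^ n) λ p → ∑ O λ j → t (0 ∷ (δs p ∷ʳ j)) (i ∷ (εs p ∷ʳ 0)))
      ≈ ∑ (I^ (suc n)) (λ p → t′ (0 ∷ δs p) (εs p ∷ʳ 0)) →
      ∑ O (λ i → ∑ (I^ n) λ p → ∑ O λ j → s (0 ∷ (δs p ∷ʳ j)) (i ∷ (εs p ∷ʳ 0)))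
      ≈ ∑ (I^ (suc n)) (λ p → s′ (0 ∷ δs p) (εs p ∷ʳ 0))
    reflected-iv e = trans (reflect-left-iv s t s≡t) (trans e (sym (reflect-right-iv s′ t′ s′≡t′)))

-- Termwise limits of both sides.

module SideLimits (R : NormedRing) where

  open NormedRing R
  open Limits R
  open Sequences commutativeRing

  module Termwise (ζ : Carrier) (h : ℕ → Word → Carrier) (F : Word → Carrier)
    (lim : ∀ w → Admissible w → (λ N → h N w) ⇝ᵣ F w) where

    private module S N = Sides ζ (h N)
    open Sides ζ F

    module _ {n} (k₁ : ℕ) (ks : Vec ℕ n) (l : Vec ℕ (suc n)) where

      private
        K L : Vec ℕ (suc n)
        K = map suc (k₁ ∷ ks)
        L = map suc l

      -- With k₁ and lₘ above 1, removing one letter at an end still leaves an admissible word. The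
      -- condition on the end is a parameter, so that `l` can be given with its first entry split
      -- off.
      left-i-⇝ : 1 ≤ k₁ → (∀ {es} → All (_≤ 1) es → Last≤ es l) → (λ N → S.left-i N K L) ⇝ᵣ left-i K L
      left-i-⇝ 1≤k₁ last = weighted-⇝ ζ (suc n)
        {λ p N → h N (shorten K L (δs p) (εs p))} {λ p → F (shorten K L (δs p) (εs p))}
        λ { ((δ , ε) ∷ p) sm@(δ+ε≤1 ∷ _) → lim _ (admissible-shorten k₁ ks l δ (δs p) (ε ∷ εs p)
              (ℕₚ.≤-trans (ℕₚ.≤-trans (ℕₚ.m≤m+n δ ε) δ+ε≤1) 1≤k₁) (last (small-εs sm))) }

      left-ii-⇝ : (∀ {es} → All (_≤ 1) es → Last≤ es l) → (λ N → S.left-ii N K L) ⇝ᵣ left-ii K L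
      left-ii-⇝ last = weighted₂-⇝ ζ
        {λ i N → weighted ζ n λ p → h N (shorten K L (0 ∷ δs p) (i ∷ εs p))}
        {λ i → weighted ζ n λ p → F (shorten K L (0 ∷ δs p) (i ∷ εs p))}
        λ i i≤1 → weighted-⇝ ζ n
          {λ p N → h N (shorten K L (0 ∷ δs p) (i ∷ εs p))} {λ p → F (shorten K L (0 ∷ δs p) (i ∷ εs p))}
          λ p sm → lim _ (admissible-shorten k₁ ks l 0 (δs p) (i ∷ εs p) z≤n (last (i≤1 ∷ small-εs sm)))

    module _ {n} (k₁ : ℕ) (ks ls : Vec ℕ n) (lₘ : ℕ) where

      private
        K L : Vec ℕ (suc n)
        K = map suc (k₁ ∷ ks)
        L = map suc (ls ∷ʳ lₘ)

        summand-⇝ : ∀ i j p → i ≤ k₁ → j ≤ lₘ →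
          (λ N → h N (shorten K L (i ∷ δs p) (εs p ∷ʳ j))) ⇝ᵣ F (shorten K L (i ∷ δs p) (εs p ∷ʳ j))
        summand-⇝ i j p i≤ j≤ = lim _ (admissible-shorten k₁ ks (ls ∷ʳ lₘ) i (δs p) (εs p ∷ʳ j)
          i≤ (last≤-∷ʳ (εs p) ls j≤))

      right-i-⇝ : 1 ≤ k₁ → 1 ≤ lₘ → (λ N → S.right-i N K L) ⇝ᵣ right-i K L
      right-i-⇝ 1≤k₁ 1≤lₘ = weighted₂-⇝ ζ
        {λ i N → weighted ζ n λ p → weighted₂ ζ λ j → h N (shorten K L (i ∷ δs p) (εs p ∷ʳ j))}
        {λ i → weighted ζ n λ p → weighted₂ ζ λ j → F (shorten K L (i ∷ δs p) (εs p ∷ʳ j))}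
        λ i i≤1 → weighted-⇝ ζ n
          {λ p N → weighted₂ ζ λ j → h N (shorten K L (i ∷ δs p) (εs p ∷ʳ j))}
          {λ p → weighted₂ ζ λ j → F (shorten K L (i ∷ δs p) (εs p ∷ʳ j))}
          λ p sm → weighted₂-⇝ ζ {λ j N → h N (shorten K L (i ∷ δs p) (εs p ∷ʳ j))}
            {λ j → F (shorten K L (i ∷ δs p) (εs p ∷ʳ j))}
            λ j j≤1 → summand-⇝ i j p (ℕₚ.≤-trans i≤1 1≤k₁) (ℕₚ.≤-trans j≤1 1≤lₘ)

      right-ii-⇝ : 1 ≤ lₘ → (λ N → S.right-ii N K L) ⇝ᵣ right-ii K L
      right-ii-⇝ 1≤lₘ = weighted-⇝ ζ n
        {λ p N → weighted₂ ζ λ j → h N (shorten K L (0 ∷ δs p) (εs p ∷ʳ j))}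
        {λ p → weighted₂ ζ λ j → F (shorten K L (0 ∷ δs p) (εs p ∷ʳ j))}
        λ p sm → weighted₂-⇝ ζ {λ j N → h N (shorten K L (0 ∷ δs p) (εs p ∷ʳ j))}
          {λ j → F (shorten K L (0 ∷ δs p) (εs p ∷ʳ j))}
          λ j j≤1 → summand-⇝ 0 j p z≤n (ℕₚ.≤-trans j≤1 1≤lₘ)

      right-iii-⇝ : 1 ≤ k₁ → (λ N → S.right-iii N K L) ⇝ᵣ right-iii K L
      right-iii-⇝ 1≤k₁ = weighted₂-⇝ ζ
        {λ i N → weighted ζ n λ p → h N (shorten K L (i ∷ δs p) (εs p ∷ʳ 0))}
        {λ i → weighted ζ n λ p → F (shorten K L (i ∷ δs p) (εs p ∷ʳ 0))}
        λ i i≤1 → weighted-⇝ ζ n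
          {λ p N → h N (shorten K L (i ∷ δs p) (εs p ∷ʳ 0))} {λ p → F (shorten K L (i ∷ δs p) (εs p ∷ʳ 0))}
          λ p sm → summand-⇝ i 0 p (ℕₚ.≤-trans i≤1 1≤k₁) z≤n

      right-iv-⇝ : (λ N → weighted ζ n λ p → h N (shorten K L (0 ∷ δs p) (εs p ∷ʳ 0)))
                   ⇝ᵣ weighted ζ n λ p → F (shorten K L (0 ∷ δs p) (εs p ∷ʳ 0))
      right-iv-⇝ = weighted-⇝ ζ n
        {λ p N → h N (shorten K L (0 ∷ δs p) (εs p ∷ʳ 0))} {λ p → F (shorten K L (0 ∷ δs p) (εs p ∷ʳ 0))}
        λ p sm → summand-⇝ 0 0 p z≤n z≤n

    -- Admissibility concerns the first entry of δ, which here is built from its end: for m = 1 that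
    -- entry is the separate choice δₘ, otherwise it comes from `p`.
    uncons-δs : ∀ {n k} (p : Vec (ℕ × ℕ) n) i → Small p → i ≤ 1 → 1 ≤ k →
                ∃ λ δ → ∃ λ δ⃗ → δs p ∷ʳ i ≡ δ ∷ δ⃗ × δ ≤ k
    uncons-δs []            i []      i≤1 1≤k = i , [] , ≡.refl , ℕₚ.≤-trans i≤1 1≤k
    uncons-δs ((δ , ε) ∷ p) i (h ∷ _) i≤1 1≤k =
      δ , δs p ∷ʳ i , ≡.refl , ℕₚ.≤-trans (ℕₚ.≤-trans (ℕₚ.m≤m+n δ ε) h) 1≤k

    left-iii-⇝ : ∀ {n} k₁ (ks ks⁻ : Vec ℕ n) kₘ ls → ks⁻ ∷ʳ kₘ ≡ k₁ ∷ ks → 1 ≤ k₁ →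
      (λ N → S.left-iii N (map suc (ks⁻ ∷ʳ kₘ)) (map suc (ls ∷ʳ 0)))
      ⇝ᵣ left-iii (map suc (ks⁻ ∷ʳ kₘ)) (map suc (ls ∷ʳ 0))
    left-iii-⇝ {n} k₁ ks ks⁻ kₘ ls e 1≤k₁ = weighted-⇝ ζ n
      {λ p N → weighted₂ ζ λ i → h N (w p i)} {λ p → weighted₂ ζ λ i → F (w p i)}
      λ p sm → weighted₂-⇝ ζ {λ i N → h N (w p i)} {λ i → F (w p i)} λ i i≤1 → lim _ (admissible p i sm i≤1)
      where
      w : Vec (ℕ × ℕ) n → ℕ → Word
      w p i = shorten (map suc (ks⁻ ∷ʳ kₘ)) (map suc (ls ∷ʳ 0)) (δs p ∷ʳ i) (εs p ∷ʳ 0)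
      admissible : ∀ p i → Small p → i ≤ 1 → Admissible (w p i)
      admissible p i sm i≤1 with uncons-δs p i sm i≤1 1≤k₁
      ... | δ , δ⃗ , e′ , δ≤ = ≡.subst₂
        (λ k d → Admissible (shorten (map suc k) (map suc (ls ∷ʳ 0)) d (εs p ∷ʳ 0)))
        (≡.sym e) (≡.sym e′)
        (admissible-shorten k₁ ks (ls ∷ʳ 0) δ δ⃗ (εs p ∷ʳ 0) δ≤ (last≤-∷ʳ (εs p) ls z≤n))

    left-iv-⇝ : ∀ {n} (ks ls : Vec ℕ n) kₘ l₁ →
      (λ N → S.left-iv N (map suc (0 ∷ (ks ∷ʳ kₘ))) (map suc (l₁ ∷ (ls ∷ʳ 0))))
      ⇝ᵣ left-iv (map suc (0 ∷ (ks ∷ʳ kₘ))) (map suc (l₁ ∷ (ls ∷ʳ 0)))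
    left-iv-⇝ {n} ks ls kₘ l₁ = weighted₂-⇝ ζ
      {λ i N → weighted ζ n λ p → weighted₂ ζ λ j → h N (w i p j)}
      {λ i → weighted ζ n λ p → weighted₂ ζ λ j → F (w i p j)}
      λ i i≤1 → weighted-⇝ ζ n {λ p N → weighted₂ ζ λ j → h N (w i p j)} {λ p → weighted₂ ζ λ j → F (w i p j)}
        λ p sm → weighted₂-⇝ ζ {λ j N → h N (w i p j)} {λ j → F (w i p j)}
          λ j j≤1 → lim _ (admissible-shorten 0 (ks ∷ʳ kₘ) (l₁ ∷ (ls ∷ʳ 0)) 0 (δs p ∷ʳ j) (i ∷ (εs p ∷ʳ 0))
            z≤n (last≤-∷ʳ (i ∷ εs p) (l₁ ∷ ls) z≤n))
      where
      w : ℕ → Vec (ℕ × ℕ) n → ℕ → Word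
      w i p j = shorten (map suc (0 ∷ (ks ∷ʳ kₘ))) (map suc (l₁ ∷ (ls ∷ʳ 0)))
                        (0 ∷ (δs p ∷ʳ j)) (i ∷ (εs p ∷ʳ 0))

-- Passage to the limit in the four identities.

module Equations (R : NormedRing) where

  open NormedRing R
  open Sequences commutativeRing
  open FiniteSums commutativeRing
  open Estimates R
  open Limits R

  module Shifted
    (q q′ : Seq) (μ μ′ : Carrier)
    (q≈r  : ∀ n → q n * (1# + μ * r n) ≈ r n)
    (q⁺≈r : ∀ n → q (suc n) * (1# + μ′ * r n) ≈ r n)
    (q₀   : q 0 * μ′ ≈ 1#)
    (q′≈q : ∀ n → q′ n ≈ q (suc n))
    {C C′} (q⊴ : HarmonicBound q C) (q′⊴ : HarmonicBound q′ C′)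
    (F F′ : Word → Carrier)
    (lim  : ∀ w → Admissible w → Σ≤ (act r q w δ₀) ⇝ᵣ F w)
    (lim′ : ∀ w → Admissible w → Σ≤ (act r q′ w δ₀) ⇝ᵣ F′ w)
    (pow : Powers μ 0) (pow′ : Powers μ′ 1) (co-0-1 : Powers.co pow′ 0 1 ≈ q 0)
    where

    open Intertwining r q q′ μ μ′ q≈r q⁺≈r q₀ q′≈q
    private
      module L  = SideSums pow F
      module L⇝ = SideLimits.Termwise R μ (λ N w → Σ≤ (act r q w δ₀) N) F lim
      module R  = SideSums pow′ F′
      module R⇝ = SideLimits.Termwise R μ′ (λ N w → Σ≤ (act r q′ w δ₀) N) F′ lim′

    𝒴-moderate : ∀ {a} → Moderate a → Moderate (𝒴 a)
    𝒴-moderate = shift-mulSum-moderate q⊴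

    left-moderate : ∀ {n} (ks ls : Vec ℕ n) {a} → Moderate a → Moderate (left ks ls a)
    left-moderate []       []       m = m
    left-moderate (k ∷ ks) (l ∷ ls) m = iterate-moderate k mulTail-moderate
      (⊕-moderate (•-moderate μ (mulTail-moderate (𝒴-moderate u))) (⊕-moderate (𝒴-moderate u) (mulTail-moderate u)))
      where u = iterate-moderate l 𝒴-moderate (left-moderate ks ls m)

    𝒫𝒴′δ₀-moderate : Moderate (𝒫 (𝒴′ δ₀))
    𝒫𝒴′δ₀-moderate = ⊕-moderate u (•-moderate μ′ (mulTail-moderate u))
      where u = shift-mulSum-moderate q′⊴ δ₀-moderate

    last-all : ∀ {n} {l₁ lₘ} {ls ls⁻ : Vec ℕ n} → l₁ ∷ ls ≡ ls⁻ ∷ʳ suc lₘ →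
               ∀ {es} → All (_≤ 1) es → Last≤ es (l₁ ∷ ls)
    last-all {lₘ = lₘ} {ls⁻ = ls⁻} e {es} h = subst (Last≤ es) (≡.sym e) (last≤-all ls⁻ lₘ h)

    -- Both sides are limits of the same sequence of truncations. The factor `q 0` of the finite
    -- identity is the value at exponent -1 supplied by `co-0-1`.
    equation-i : ∀ {n} k₁ (ks : Vec ℕ n) l₁ ls ls⁻ lₘ → l₁ ∷ ls ≡ ls⁻ ∷ʳ suc lₘ → 1 ≤ k₁ →
      let K = map suc (k₁ ∷ ks) ; L = map suc (l₁ ∷ ls) ; L′ = map suc (ls⁻ ∷ʳ suc lₘ) in
      ∑ (I^ (suc n)) (λ p → L.term K L (δs p) (εs p))
      ≈ ∑ O (λ i → ∑ (I^ n) λ p → ∑ O λ j → R.term K L′ (i ∷ δs p) (εs p ∷ʳ j))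
    equation-i {n} k₁ ks l₁ ls ls⁻ lₘ e 1≤k₁ = trans (L.∑-left-i K L) (trans
      (⇝-unique (L⇝.left-i-⇝ k₁ ks (l₁ ∷ ls) 1≤k₁ (last-all e))
        (⇝-cong (λ N → sym (finite-i N k₁ ks l₁ ls ls⁻ lₘ e))
          (⇝-• (q 0) (R⇝.right-i-⇝ k₁ ks ls⁻ (suc lₘ) 1≤k₁ (s≤s z≤n)))))
      (sym (R.∑-right-i K L′ (q 0) q₀ co-0-1 ℕₚ.≤-refl)))
      where
      K L L′ : Vec ℕ (suc n)
      K = map suc (k₁ ∷ ks)
      L = map suc (l₁ ∷ ls)
      L′ = map suc (ls⁻ ∷ʳ suc lₘ)

    ⇝-+0 : ∀ {s t S} → s ⇝ᵣ S → t ⇝ᵣ 0# → s ⊕ t ⇝ᵣ S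
    ⇝-+0 {S = S} h k = ⇝-resp (+-identityʳ S) (⇝-⊕ h k)

    equation-ii : ∀ {n} (ks : Vec ℕ n) l₁ ls ls⁻ lₘ → l₁ ∷ ls ≡ ls⁻ ∷ʳ suc lₘ →
      let K = map suc (0 ∷ ks) ; L = map suc (l₁ ∷ ls) ; L′ = map suc (ls⁻ ∷ʳ suc lₘ) in
      ∑ O (λ i → ∑ (I^ n) λ p → L.term K L (0 ∷ δs p) (i ∷ εs p))
      ≈ ∑ (I^ n) (λ p → ∑ O λ i → R.term K L′ (0 ∷ δs p) (εs p ∷ʳ i))
    equation-ii {n} ks l₁ ls ls⁻ lₘ e = trans (L.∑-left-ii K L) (trans
      (⇝-unique (L⇝.left-ii-⇝ 0 ks (l₁ ∷ ls) (last-all e))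
        (⇝-cong (λ N → sym (finite-ii N ks l₁ ls ls⁻ lₘ e))
          (⇝-+0 (R⇝.right-ii-⇝ 0 ks ls⁻ (suc lₘ) (s≤s z≤n))
                (mulSum→0 q⊴ (iterate-moderate l₁ 𝒴-moderate (left-moderate ks ls δ₀-moderate))))))
      (sym (R.∑-right-ii K L′)))
      where
      K L L′ : Vec ℕ (suc n)
      K = map suc (0 ∷ ks)
      L = map suc (l₁ ∷ ls)
      L′ = map suc (ls⁻ ∷ʳ suc lₘ)

    equation-iii : ∀ {n} k₁ (ks ks⁻ : Vec ℕ n) kₘ ls → ks⁻ ∷ʳ kₘ ≡ k₁ ∷ ks → 1 ≤ k₁ →
      let K = map suc (ks⁻ ∷ʳ kₘ) ; K′ = map suc (k₁ ∷ ks) ; L = map suc (ls ∷ʳ 0) in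
      ∑ (I^ n) (λ p → ∑ O λ i → L.term K L (δs p ∷ʳ i) (εs p ∷ʳ 0))
      ≈ ∑ O (λ i → ∑ (I^ n) λ p → R.term K′ L (i ∷ δs p) (εs p ∷ʳ 0))
    equation-iii {n} k₁ ks ks⁻ kₘ ls e 1≤k₁ = trans (L.∑-left-iii K L) (trans
      (⇝-unique (L⇝.left-iii-⇝ k₁ ks ks⁻ kₘ ls e 1≤k₁)
        (⇝-cong (λ N → sym (finite-iii N k₁ ks ks⁻ kₘ ls e)) (R⇝.right-iii-⇝ k₁ ks ls 0 1≤k₁)))
      (sym (R.∑-right-iii K′ L)))
      where
      K K′ L : Vec ℕ (suc n)
      K = map suc (ks⁻ ∷ʳ kₘ)
      K′ = map suc (k₁ ∷ ks)
      L = map suc (ls ∷ʳ 0)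

    equation-iv : ∀ {n} k₂ (ks ks⁻ : Vec ℕ n) kₘ l₁ ls → ks⁻ ∷ʳ kₘ ≡ k₂ ∷ ks →
      let K = map suc (0 ∷ (ks⁻ ∷ʳ kₘ)) ; K′ = map suc (0 ∷ k₂ ∷ ks) ; L = map suc (l₁ ∷ (ls ∷ʳ 0)) in
      ∑ O (λ i → ∑ (I^ n) λ p → ∑ O λ j → L.term K L (0 ∷ (δs p ∷ʳ j)) (i ∷ (εs p ∷ʳ 0)))
      ≈ ∑ (I^ (suc n)) (λ p → R.term K′ L (0 ∷ δs p) (εs p ∷ʳ 0))
    equation-iv {n} k₂ ks ks⁻ kₘ l₁ ls e = trans (L.∑-left-iv K L) (trans
      (⇝-unique (L⇝.left-iv-⇝ ks⁻ ls kₘ l₁)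
        (⇝-cong (λ N → sym (finite-iv N k₂ ks ks⁻ kₘ l₁ ls e))
          (⇝-+0 (⇝-• μ′ (R⇝.right-iv-⇝ 0 (k₂ ∷ ks) (l₁ ∷ ls) 0))
                (mulSum→0 q⊴ (iterate-moderate l₁ 𝒴-moderate (left-moderate ks⁻ ls
                  (iterate-moderate kₘ mulTail-moderate 𝒫𝒴′δ₀-moderate)))))))
      (sym (R.∑-right-iv K′ L)))
      where
      K K′ L : Vec ℕ (suc (suc n))
      K = map suc (0 ∷ (ks⁻ ∷ʳ kₘ))
      K′ = map suc (0 ∷ k₂ ∷ ks)
      L = map suc (l₁ ∷ (ls ∷ʳ 0))

-- The reciprocals 1/(n - λ) and their shift.

module Resolvent (R : NormedRing) where

  open NormedRing R
  open Estimates R using (r)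
  open SemiringSolver commutativeSemiring using (solve; con; _:=_; _:+_; _:*_)
  open SetoidReasoning setoid

  module _ (l : Carrier) (q : ℕ → Carrier)
    (q-inverse : ∀ n → (rational (ν (suc n)) - l) * q n ≈ 1#) where

    r-inverse : ∀ n → r n * rational (ν (suc n)) ≈ 1#
    r-inverse n = trans (sym (rational-* (ρ n) (ν (suc n))))
      (trans (reflexive (≡.cong rational (ρ-inverse n))) rational-1)

    q≈r : ∀ n → q n * (1# + - l * r n) ≈ r n
    q≈r n = begin
      q n * (1# + - l * r n)         ≈⟨ *-congˡ (+-congʳ (r-inverse n)) ⟨
      q n * (r n * d + - l * r n)    ≈⟨ solve 4 (λ x r d m → x :* (r :* d :+ m :* r) := r :* ((d :+ m) :* x))
                                          refl (q n) (r n) d (- l) ⟩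
      r n * ((d - l) * q n)          ≈⟨ *-congˡ (q-inverse n) ⟩
      r n * 1#                       ≈⟨ *-identityʳ (r n) ⟩
      r n                            ∎
      where d = rational (ν (suc n))

    -- The resolvent identity 1/(n - λ) = 1/n + (λ/n) · 1/(n - λ), in the fixed-point form that
    -- `harmonicBound` expects.
    q≈r+lrq : ∀ n → q n ≈ r n + (l * r n) * q n
    q≈r+lrq n = begin
      q n                                          ≈⟨ +-identityʳ (q n) ⟨
      q n + 0#                                     ≈⟨ +-congˡ (zeroˡ (r n * q n)) ⟨
      q n + 0# * (r n * q n)                       ≈⟨ +-congˡ (*-congʳ (-‿inverseˡ l)) ⟨
      q n + (- l + l) * (r n * q n)                ≈⟨ solve 4 (λ x m l r → x :+ (m :+ l) :* (r :* x)
                                                        := x :* (con 1 :+ m :* r) :+ (l :* r) :* x)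
                                                        refl (q n) (- l) l (r n) ⟩
      q n * (1# + - l * r n) + (l * r n) * q n     ≈⟨ +-congʳ (q≈r n) ⟩
      r n + (l * r n) * q n                        ∎

module ShiftedResolvent (R : NormedRing) where

  open NormedRing R
  open Estimates R using (r)
  open RingProperties ring using (-‿+-comm; -‿involutive)
  open SemiringSolver commutativeSemiring using (solve; _:=_; _:+_; _:*_)
  open SetoidReasoning setoid

  module From (l : Carrier) (q q′ : ℕ → Carrier)
    (q-inverse  : ∀ n → (rational (ν (suc n)) - l) * q n ≈ 1#)
    (q′-inverse : ∀ n → (rational (ν (suc n)) - (l - 1#)) * q′ n ≈ 1#) where

    -‿pred : - (l - 1#) ≈ 1# - l
    -‿pred = trans (sym (-‿+-comm l (- 1#))) (trans (+-congˡ (-‿involutive 1#)) (+-comm (- l) 1#))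

    -- n + 1 - λ′ and n + 2 - λ are the same number, so `q (suc n)` is a reciprocal for λ′ as well.
    q⁺-inverse : ∀ n → (rational (ν (suc n)) - (l - 1#)) * q (suc n) ≈ 1#
    q⁺-inverse n = trans (*-congʳ (begin
      d n - (l - 1#)      ≈⟨ +-congˡ -‿pred ⟩
      d n + (1# - l)      ≈⟨ solve 3 (λ x y m → x :+ (y :+ m) := (y :+ x) :+ m) refl (d n) 1# (- l) ⟩
      (1# + d n) - l      ≈⟨ +-congʳ (trans (reflexive (≡.cong rational (ν-suc (suc n))))
                               (trans (rational-+ 1ℚ (ν (suc n))) (+-congʳ rational-1))) ⟨
      d (suc n) - l       ∎)) (q-inverse (suc n))
      where
      d : ℕ → Carrier
      d n = rational (ν (suc n))

    q⁺≈r : ∀ n → q (suc n) * (1# + - (l - 1#) * r n) ≈ r n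
    q⁺≈r = Resolvent.q≈r R (l - 1#) (λ n → q (suc n)) q⁺-inverse

    q₀ : q 0 * - (l - 1#) ≈ 1#
    q₀ = begin
      q 0 * - (l - 1#)              ≈⟨ *-comm (q 0) (- (l - 1#)) ⟩
      - (l - 1#) * q 0              ≈⟨ *-congʳ (trans -‿pred (+-congʳ (sym rational-1))) ⟩
      (rational (ν 1) - l) * q 0    ≈⟨ q-inverse 0 ⟩
      1#                            ∎

    inverse-unique : ∀ {x y z} → x * y ≈ 1# → x * z ≈ 1# → y ≈ z
    inverse-unique {x} {y} {z} e e′ = begin
      y             ≈⟨ *-identityʳ y ⟨
      y * 1#        ≈⟨ *-congˡ e′ ⟨
      y * (x * z)   ≈⟨ solve 3 (λ x y z → y :* (x :* z) := (x :* y) :* z) refl x y z ⟩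
      (x * y) * z   ≈⟨ *-congʳ e ⟩
      1# * z        ≈⟨ *-identityˡ z ⟩
      z             ∎

    q′≈q : ∀ n → q′ n ≈ q (suc n)
    q′≈q n = inverse-unique (q′-inverse n) (q⁺-inverse n)

    reciprocal≈q₀ : ∀ {u} → - (l - 1#) * u ≈ 1# → u * 1# ≈ q 0
    reciprocal≈q₀ {u} e = trans (*-identityʳ u) (inverse-unique e (trans (*-comm (- (l - 1#)) (q 0)) q₀))

-- Powers with natural and with integer exponents.

module PowerSequences (R : CommutativeRing 0ℓ 0ℓ) where

  open CommutativeRing R hiding (zero)
  open Exp semiring using (_^_)
  open FiniteSums R
  open SemiringSolver commutativeSemiring using (solve; con; _:=_; _:+_; _:*_)

  powers : ∀ ζ → Powers ζ 0
  powers ζ = record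
    { co      = λ m s → ζ ^ (m ∸ s)
    ; co-both = λ m s → refl
    ; co-suc  = λ m s s≤m → reflexive (≡.cong (ζ ^_) (ℕₚ.+-∸-assoc 1 s≤m))
    ; co-0    = refl
    }

  module _ (ζ u : Carrier) (ζ*u : ζ * u ≈ 1#) (zp : ℤ → Carrier)
    (zp-+ : ∀ n → zp (ℤ.+ n) ≡ ζ ^ n) (zp-- : ∀ n → zp ℤ.-[1+ n ] ≡ u ^ suc n) where

    zp-suc : ∀ i → zp (ℤ.suc i) ≈ ζ * zp i
    zp-suc (ℤ.+ n) = trans (reflexive (zp-+ (suc n))) (*-congˡ (sym (reflexive (zp-+ n))))
    zp-suc ℤ.-[1+ zero ] = trans (reflexive (zp-+ 0)) (sym (trans (*-congˡ (reflexive (zp-- 0)))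
      (trans (sym (*-assoc ζ u 1#)) (trans (*-identityʳ (ζ * u)) ζ*u))))
    zp-suc ℤ.-[1+ suc n ] = trans (reflexive (zp-- n)) (sym (trans (*-congˡ (reflexive (zp-- (suc n))))
      (trans (sym (*-assoc ζ u (u ^ suc n))) (trans (*-congʳ ζ*u)
        (*-identityˡ (u ^ suc n))))))

    zpowers : Powers ζ 1
    zpowers = record
      { co      = λ m s → zp (ℤ.+ m ℤ.- ℤ.+ s)
      ; co-both = λ m s → reflexive (≡.cong zp (≡.trans (ℤₚ.m-n≡m⊖n (suc m) (suc s))
          (≡.trans (ℤₚ.[1+m]⊖[1+n]≡m⊖n m s) (≡.sym (ℤₚ.m-n≡m⊖n m s)))))
      ; co-suc  = λ m s _ → trans
          (reflexive (≡.cong zp (ℤₚ.+-assoc (ℤ.+ 1) (ℤ.+ m) (ℤ.- (ℤ.+ s)))))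
          (zp-suc (ℤ.+ m ℤ.- ℤ.+ s))
      ; co-0    = reflexive (zp-+ 0)
      }

open import Defs

-- The complex numbers as a complete normed ring.

module _ where

  open ℝ
  open ℂ
  open ℚ-Solver

  ‖_‖ : ℂ → ℕ → ℚ
  ‖ z ‖ i = ℚ.∣ seq (re z) i ∣ ℚ.+ ℚ.∣ seq (im z) i ∣

  infix 4 _⊴_
  -- |z| ≤ b in the ℓ¹-norm |re z| + |im z|.
  record _⊴_ (z : ℂ) (b : ℚ) : Set where
    constructor bound
    field
      within : ∀ ε → 0ℚ ℚ.< ε → Eventually λ i → ‖ z ‖ i ℚ.≤ b ℚ.+ ε

  open _⊴_

  ‖‖-nonNeg : ∀ z i → 0ℚ ℚ.≤ ‖ z ‖ i
  ‖‖-nonNeg z i = +-nonNeg (ℚₚ.0≤∣p∣ (seq (re z) i)) (ℚₚ.0≤∣p∣ (seq (im z) i))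

  interchange : ∀ a b c d → (a ℚ.+ b) ℚ.+ (c ℚ.+ d) ≡ (a ℚ.+ c) ℚ.+ (b ℚ.+ d)
  interchange = solve 4 (λ a b c d → (a :+ b) :+ (c :+ d) := (a :+ c) :+ (b :+ d)) ≡.refl

  ‖+‖ : ∀ z w i → ‖ z + w ‖ i ℚ.≤ ‖ z ‖ i ℚ.+ ‖ w ‖ i
  ‖+‖ z w i = ℚₚ.≤-trans
    (ℚₚ.+-mono-≤ (ℚₚ.∣p+q∣≤∣p∣+∣q∣ (seq (re z) i) (seq (re w) i))
                 (ℚₚ.∣p+q∣≤∣p∣+∣q∣ (seq (im z) i) (seq (im w) i)))
    (ℚₚ.≤-reflexive (interchange ℚ.∣ seq (re z) i ∣ ℚ.∣ seq (re w) i ∣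
                                 ℚ.∣ seq (im z) i ∣ ℚ.∣ seq (im w) i ∣))

  ‖-‖ : ∀ z i → ‖ - z ‖ i ≡ ‖ z ‖ i
  ‖-‖ z i = ≡.cong₂ ℚ._+_ (ℚₚ.∣-p∣≡∣p∣ (seq (re z) i)) (ℚₚ.∣-p∣≡∣p∣ (seq (im z) i))

  ‖*‖ : ∀ z w i → ‖ z * w ‖ i ℚ.≤ ‖ z ‖ i ℚ.* ‖ w ‖ i
  ‖*‖ z w i = begin
    ℚ.∣ a ℚ.* c ℚ.- b ℚ.* d ∣ ℚ.+ ℚ.∣ a ℚ.* d ℚ.+ b ℚ.* c ∣
      ≤⟨ ℚₚ.+-mono-≤ (ℚₚ.∣p-q∣≤∣p∣+∣q∣ (a ℚ.* c) (b ℚ.* d)) (ℚₚ.∣p+q∣≤∣p∣+∣q∣ (a ℚ.* d) (b ℚ.* c)) ⟩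
    (ℚ.∣ a ℚ.* c ∣ ℚ.+ ℚ.∣ b ℚ.* d ∣) ℚ.+ (ℚ.∣ a ℚ.* d ∣ ℚ.+ ℚ.∣ b ℚ.* c ∣)
      ≡⟨ ≡.cong₂ ℚ._+_ (≡.cong₂ ℚ._+_ (ℚₚ.∣p*q∣≡∣p∣*∣q∣ a c) (ℚₚ.∣p*q∣≡∣p∣*∣q∣ b d))
                     (≡.cong₂ ℚ._+_ (ℚₚ.∣p*q∣≡∣p∣*∣q∣ a d) (ℚₚ.∣p*q∣≡∣p∣*∣q∣ b c)) ⟩
    (A ℚ.* C ℚ.+ B ℚ.* D) ℚ.+ (A ℚ.* D ℚ.+ B ℚ.* C)
      ≡⟨ solve 4 (λ a b c d → (a :* c :+ b :* d) :+ (a :* d :+ b :* c)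
                                := (a :+ b) :* (c :+ d)) ≡.refl A B C D ⟩
    (A ℚ.+ B) ℚ.* (C ℚ.+ D) ∎
    where
    open ℚₚ.≤-Reasoning
    a = seq (re z) i
    b = seq (im z) i
    c = seq (re w) i
    d = seq (im w) i
    A = ℚ.∣ a ∣
    B = ℚ.∣ b ∣
    C = ℚ.∣ c ∣
    D = ℚ.∣ d ∣

  ‖fromℚ‖ : ∀ p i → ‖ fromℚ p ‖ i ≡ ℚ.∣ p ∣
  ‖fromℚ‖ p i = ℚₚ.+-identityʳ ℚ.∣ p ∣

  infix 4 _≐_
  record _≐_ (z w : ℂ) : Set where
    constructor pointwise
    field
      re-≡ : ∀ i → seq (re z) i ≡ seq (re w) i
      im-≡ : ∀ i → seq (im z) i ≡ seq (im w) i

  open _≐_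

  ‖‖-cong : ∀ {z w} → z ≐ w → ∀ i → ‖ z ‖ i ≡ ‖ w ‖ i
  ‖‖-cong e i = ≡.cong₂ (λ a b → ℚ.∣ a ∣ ℚ.+ ℚ.∣ b ∣) (re-≡ e i) (im-≡ e i)

  ⊴-≐ : ∀ {z w b} → z ≐ w → z ⊴ b → w ⊴ b
  ⊴-≐ {z} {w} {b} e z⊴b = bound λ ε 0<ε →
    eventually-map (λ i → subst (ℚ._≤ b ℚ.+ ε) (‖‖-cong e i)) (within z⊴b ε 0<ε)

  ⊴-mono : ∀ {z b c} → b ℚ.≤ c → z ⊴ b → z ⊴ c
  ⊴-mono b≤c z⊴b = bound λ ε 0<ε →
    eventually-map (λ i l → ℚₚ.≤-trans l (ℚₚ.+-monoˡ-≤ ε b≤c)) (within z⊴b ε 0<ε)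

  ⊴-+ : ∀ {z w b c} → z ⊴ b → w ⊴ c → z + w ⊴ b ℚ.+ c
  ⊴-+ {z} {w} {b} {c} z⊴b w⊴c = bound λ ε 0<ε → eventually-map₂
    (λ i l m → ℚₚ.≤-trans (‖+‖ z w i) (ℚₚ.≤-trans (ℚₚ.+-mono-≤ l m)
      (ℚₚ.≤-reflexive (≡.trans (interchange b (½ ℚ.* ε) c (½ ℚ.* ε))
                               (≡.cong (b ℚ.+ c ℚ.+_) (half-half ε))))))
    (within z⊴b (½ ℚ.* ε) (half-pos 0<ε)) (within w⊴c (½ ℚ.* ε) (half-pos 0<ε))

  ⊴-neg : ∀ {z b} → z ⊴ b → - z ⊴ b
  ⊴-neg {z} {b} z⊴b = bound λ ε 0<ε →
    eventually-map (λ i → subst (ℚ._≤ b ℚ.+ ε) (≡.sym (‖-‖ z i))) (within z⊴b ε 0<ε)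

  ⊴-* : ∀ {z w b c} → 0ℚ ℚ.≤ b → 0ℚ ℚ.≤ c → z ⊴ b → w ⊴ c → z * w ⊴ b ℚ.* c
  ⊴-* {z} {w} {b} {c} 0≤b 0≤c z⊴b w⊴c = bound λ ε 0<ε →
    -- η solves (b + c + 1) η = ε, and the cap δ ≤ 1 makes the quadratic error δ² linear.
    let η , 0<η , eη = shrink (ℚₚ.<-≤-trans 0<1 (p≤q+p (+-nonNeg 0≤b 0≤c))) 0<ε
        δ = η ℚ.⊓ 1ℚ
        0<δ = ⊓-pos 0<η 0<1
    in eventually-map₂
    (λ i l m → begin
      ‖ z * w ‖ i                   ≤⟨ ‖*‖ z w i ⟩
      ‖ z ‖ i ℚ.* ‖ w ‖ i           ≤⟨ *-mono-≤ (‖‖-nonNeg z i)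
                                         (+-nonNeg 0≤c (ℚₚ.<⇒≤ 0<δ)) l m ⟩
      (b ℚ.+ δ) ℚ.* (c ℚ.+ δ)       ≡⟨ expand b c δ ⟩
      b ℚ.* c ℚ.+ (b ℚ.+ c ℚ.+ δ) ℚ.* δ
                                    ≤⟨ ℚₚ.+-monoʳ-≤ (b ℚ.* c) (*-mono-≤
                                         (+-nonNeg (+-nonNeg 0≤b 0≤c) (ℚₚ.<⇒≤ 0<δ))
                                         (ℚₚ.<⇒≤ 0<η)
                                         (ℚₚ.+-monoʳ-≤ (b ℚ.+ c) (ℚₚ.p⊓q≤q η 1ℚ))
                                         (ℚₚ.p⊓q≤p η 1ℚ)) ⟩
      b ℚ.* c ℚ.+ (b ℚ.+ c ℚ.+ 1ℚ) ℚ.* η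
                                    ≡⟨ ≡.cong (b ℚ.* c ℚ.+_) eη ⟩
      b ℚ.* c ℚ.+ ε                 ∎)
    (within z⊴b δ 0<δ) (within w⊴c δ 0<δ)
    where
    open ℚₚ.≤-Reasoning
    expand : ∀ b c d → (b ℚ.+ d) ℚ.* (c ℚ.+ d) ≡ b ℚ.* c ℚ.+ (b ℚ.+ c ℚ.+ d) ℚ.* d
    expand = solve 3 (λ b c d → (b :+ d) :* (c :+ d) := b :* c :+ (b :+ c :+ d) :* d) ≡.refl
    ⊓-pos : ∀ {p q} → 0ℚ ℚ.< p → 0ℚ ℚ.< q → 0ℚ ℚ.< p ℚ.⊓ q
    ⊓-pos {p} {q} 0<p 0<q with ℚₚ.⊓-sel p q
    ... | inj₁ e = subst (0ℚ ℚ.<_) (≡.sym e) 0<p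
    ... | inj₂ e = subst (0ℚ ℚ.<_) (≡.sym e) 0<q

  ⊴-bound : ∀ z → ∃ λ b → 0ℚ ℚ.≤ b × z ⊴ b
  ⊴-bound z with bounded {seq (re z)} (cauchy (re z)) | bounded {seq (im z)} (cauchy (im z))
  ... | B , 0<B , re≤B | C , 0<C , im≤C =
    B ℚ.+ C , +-nonNeg (ℚₚ.<⇒≤ 0<B) (ℚₚ.<⇒≤ 0<C) , bound λ ε 0<ε →
      eventually-map₂ (λ i l m → ℚₚ.≤-trans (ℚₚ.+-mono-≤ l m) (p≤p+q (ℚₚ.<⇒≤ 0<ε))) re≤B im≤C

  ⊴-fromℚ : ∀ {p} → 0ℚ ℚ.≤ p → fromℚ p ⊴ p
  ⊴-fromℚ {p} 0≤p = bound λ ε 0<ε → always λ i → ℚₚ.≤-trans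
    (ℚₚ.≤-reflexive (≡.trans (‖fromℚ‖ p i) (ℚₚ.0≤p⇒∣p∣≡p 0≤p))) (p≤p+q (ℚₚ.<⇒≤ 0<ε))

  -- Together with its converse this reduces the laws of equality to estimates of differences, so
  -- that congruences follow from the bounds for sums and products.
  ⊴0⇒≈ : ∀ z w → z - w ⊴ 0ℚ → z ≈ w
  ⊴0⇒≈ z w h =
      (λ ε 0<ε → eventually-map (λ i → ℚₚ.≤-<-trans (p≤p+q (ℚₚ.0≤∣p∣ (seq (im z) i ℚ.- seq (im w) i))))
                                (small ε 0<ε))
    , (λ ε 0<ε → eventually-map (λ i → ℚₚ.≤-<-trans (p≤q+p (ℚₚ.0≤∣p∣ (seq (re z) i ℚ.- seq (re w) i))))
                                (small ε 0<ε))
    where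
    small : ∀ ε → 0ℚ ℚ.< ε → Eventually λ i → ‖ z - w ‖ i ℚ.< ε
    small ε 0<ε = eventually-map
      (λ i l → ℚₚ.≤-<-trans l (subst (ℚ._< ε) (≡.sym (ℚₚ.+-identityˡ (½ ℚ.* ε))) (half<self 0<ε)))
      (within h (½ ℚ.* ε) (half-pos 0<ε))

  ≈⇒⊴0 : ∀ z w → z ≈ w → z - w ⊴ 0ℚ
  ≈⇒⊴0 z w (e , e′) = bound λ ε 0<ε → eventually-map₂
    (λ i l m → ℚₚ.≤-trans (ℚₚ.+-mono-≤ (ℚₚ.<⇒≤ l) (ℚₚ.<⇒≤ m))
      (ℚₚ.≤-reflexive (≡.trans (half-half ε) (≡.sym (ℚₚ.+-identityˡ ε)))))
    (e (½ ℚ.* ε) (half-pos 0<ε)) (e′ (½ ℚ.* ε) (half-pos 0<ε))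

  private
    ℜ ℑ : ℂ → ℕ → ℚ
    ℜ z = seq (re z)
    ℑ z = seq (im z)

  -- w = z - (z - w), and the subtracted term has bound 0.
  ⊴-resp : ∀ {b} z w → z ≈ w → z ⊴ b → w ⊴ b
  ⊴-resp {b} z w z≈w z⊴b = ⊴-mono (ℚₚ.≤-reflexive (ℚₚ.+-identityʳ b))
    (⊴-≐ (pointwise (λ i → shape (ℜ z i) (ℜ w i)) (λ i → shape (ℑ z i) (ℑ w i)))
      (⊴-+ z⊴b (⊴-neg (≈⇒⊴0 z w z≈w))))
    where
    shape : ∀ a b → a ℚ.+ ℚ.- (a ℚ.- b) ≡ b
    shape = solve 2 (λ a b → a :+ :- (a :- b) := b) ≡.refl

  ≡⇒close : ∀ {a b} ε → 0ℚ ℚ.< ε → a ≡ b → ℚ.∣ a ℚ.- b ∣ ℚ.< ε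
  ≡⇒close {a} ε 0<ε ≡.refl = subst (ℚ._< ε) (≡.cong ℚ.∣_∣ (≡.sym (ℚₚ.+-inverseʳ a))) 0<ε

  ≐⇒≈ : ∀ z w → z ≐ w → z ≈ w
  ≐⇒≈ z w e = (λ ε 0<ε → always λ i → ≡⇒close ε 0<ε (re-≡ e i))
        , (λ ε 0<ε → always λ i → ≡⇒close ε 0<ε (im-≡ e i))

  ⊴0-+ : ∀ {z w} → z ⊴ 0ℚ → w ⊴ 0ℚ → z + w ⊴ 0ℚ
  ⊴0-+ p q = ⊴-mono (ℚₚ.≤-reflexive (ℚₚ.+-identityˡ 0ℚ)) (⊴-+ p q)

  ≈-sym : ∀ z w → z ≈ w → w ≈ z
  ≈-sym z w e = ⊴0⇒≈ w z (⊴-≐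
    (pointwise (λ i → shape (ℜ z i) (ℜ w i)) (λ i → shape (ℑ z i) (ℑ w i)))
    (⊴-neg (≈⇒⊴0 z w e)))
    where
    shape : ∀ a b → ℚ.- (a ℚ.- b) ≡ b ℚ.- a
    shape = solve 2 (λ a b → :- (a :- b) := b :- a) ≡.refl

  ≈-trans : ∀ z w u → z ≈ w → w ≈ u → z ≈ u
  ≈-trans z w u e e′ = ⊴0⇒≈ z u (⊴-≐
    (pointwise (λ i → shape (ℜ z i) (ℜ w i) (ℜ u i)) (λ i → shape (ℑ z i) (ℑ w i) (ℑ u i)))
    (⊴0-+ (≈⇒⊴0 z w e) (≈⇒⊴0 w u e′)))
    where
    shape : ∀ a b c → (a ℚ.- b) ℚ.+ (b ℚ.- c) ≡ a ℚ.- c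
    shape = solve 3 (λ a b c → (a :- b) :+ (b :- c) := a :- c) ≡.refl

  +ᶜ-cong : ∀ z z′ w w′ → z ≈ z′ → w ≈ w′ → z + w ≈ z′ + w′
  +ᶜ-cong z z′ w w′ e e′ = ⊴0⇒≈ (z + w) (z′ + w′) (⊴-≐
    (pointwise (λ i → shape (ℜ z i) (ℜ z′ i) (ℜ w i) (ℜ w′ i))
               (λ i → shape (ℑ z i) (ℑ z′ i) (ℑ w i) (ℑ w′ i)))
    (⊴0-+ (≈⇒⊴0 z z′ e) (≈⇒⊴0 w w′ e′)))
    where
    shape : ∀ a b c d → (a ℚ.- b) ℚ.+ (c ℚ.- d) ≡ (a ℚ.+ c) ℚ.- (b ℚ.+ d)
    shape = solve 4 (λ a b c d → (a :- b) :+ (c :- d) := (a :+ c) :- (b :+ d)) ≡.refl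

  -ᶜ-cong : ∀ z w → z ≈ w → - z ≈ - w
  -ᶜ-cong z w e = ⊴0⇒≈ (- z) (- w) (⊴-≐
    (pointwise (λ i → shape (ℜ z i) (ℜ w i)) (λ i → shape (ℑ z i) (ℑ w i)))
    (⊴-neg (≈⇒⊴0 z w e)))
    where
    shape : ∀ a b → ℚ.- (a ℚ.- b) ≡ ℚ.- a ℚ.- ℚ.- b
    shape = solve 2 (λ a b → :- (a :- b) := :- a :- :- b) ≡.refl

  -- z w - z′ w′ = z (w - w′) + (z - z′) w′, where each product has one factor of bound 0 and one
  -- that is bounded.
  *ᶜ-cong : ∀ z z′ w w′ → z ≈ z′ → w ≈ w′ → z * w ≈ z′ * w′
  *ᶜ-cong z z′ w w′ e e′ =
    let b , 0≤b , z⊴b = ⊴-bound z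
        c , 0≤c , w⊴c = ⊴-bound w′
    in ⊴0⇒≈ (z * w) (z′ * w′) (⊴-≐
         (pointwise (λ i → shapeʳ (ℜ z i) (ℑ z i) (ℜ z′ i) (ℑ z′ i) (ℜ w i) (ℑ w i) (ℜ w′ i) (ℑ w′ i))
                    (λ i → shapeⁱ (ℜ z i) (ℑ z i) (ℜ z′ i) (ℑ z′ i) (ℜ w i) (ℑ w i) (ℜ w′ i) (ℑ w′ i)))
         (⊴0-+ (⊴-mono (ℚₚ.≤-reflexive (ℚₚ.*-zeroʳ b)) (⊴-* 0≤b ℚₚ.≤-refl z⊴b (≈⇒⊴0 w w′ e′)))
               (⊴-mono (ℚₚ.≤-reflexive (ℚₚ.*-zeroˡ c)) (⊴-* ℚₚ.≤-refl 0≤c (≈⇒⊴0 z z′ e) w⊴c))))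
    where
    shapeʳ : ∀ a b a′ b′ c d c′ d′ →
      (a ℚ.* (c ℚ.- c′) ℚ.- b ℚ.* (d ℚ.- d′)) ℚ.+ ((a ℚ.- a′) ℚ.* c′ ℚ.- (b ℚ.- b′) ℚ.* d′)
      ≡ (a ℚ.* c ℚ.- b ℚ.* d) ℚ.- (a′ ℚ.* c′ ℚ.- b′ ℚ.* d′)
    shapeʳ = solve 8 (λ a b a′ b′ c d c′ d′ →
      (a :* (c :- c′) :- b :* (d :- d′)) :+ ((a :- a′) :* c′ :- (b :- b′) :* d′)
      := (a :* c :- b :* d) :- (a′ :* c′ :- b′ :* d′)) ≡.refl
    shapeⁱ : ∀ a b a′ b′ c d c′ d′ →
      (a ℚ.* (d ℚ.- d′) ℚ.+ b ℚ.* (c ℚ.- c′)) ℚ.+ ((a ℚ.- a′) ℚ.* d′ ℚ.+ (b ℚ.- b′) ℚ.* c′)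
      ≡ (a ℚ.* d ℚ.+ b ℚ.* c) ℚ.- (a′ ℚ.* d′ ℚ.+ b′ ℚ.* c′)
    shapeⁱ = solve 8 (λ a b a′ b′ c d c′ d′ →
      (a :* (d :- d′) :+ b :* (c :- c′)) :+ ((a :- a′) :* d′ :+ (b :- b′) :* c′)
      := (a :* d :+ b :* c) :- (a′ :* d′ :+ b′ :* c′)) ≡.refl

  ℂ-isCommutativeRing : IsCommutativeRing _≈_ _+_ _*_ -_ 0ᶜ 1ᶜ
  ℂ-isCommutativeRing = record
    { isRing = record
      { +-isAbelianGroup = record
        { isGroup = record
          { isMonoid = record
            { isSemigroup = record
              { isMagma = record
                { isEquivalence = record
                  { refl  = λ {z} → ≐⇒≈ z z (pointwise (λ i → ≡.refl) (λ i → ≡.refl))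
                  ; sym   = λ {z} {w} → ≈-sym z w
                  ; trans = λ {z} {w} {u} → ≈-trans z w u
                  }
                ; ∙-cong = λ {z} {z′} {w} {w′} → +ᶜ-cong z z′ w w′
                }
              ; assoc = λ z w u → ≐⇒≈ ((z + w) + u) (z + (w + u)) (pointwise (λ i → ℚₚ.+-assoc (ℜ z i) (ℜ w i) (ℜ u i))
                                                 (λ i → ℚₚ.+-assoc (ℑ z i) (ℑ w i) (ℑ u i)))
              }
            ; identity = (λ z → ≐⇒≈ (0ᶜ + z) z (pointwise (λ i → ℚₚ.+-identityˡ (ℜ z i)) (λ i → ℚₚ.+-identityˡ (ℑ z i))))
                       , (λ z → ≐⇒≈ (z + 0ᶜ) z (pointwise (λ i → ℚₚ.+-identityʳ (ℜ z i)) (λ i → ℚₚ.+-identityʳ (ℑ z i))))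
            }
          ; inverse = (λ z → ≐⇒≈ (- z + z) 0ᶜ (pointwise (λ i → ℚₚ.+-inverseˡ (ℜ z i)) (λ i → ℚₚ.+-inverseˡ (ℑ z i))))
                    , (λ z → ≐⇒≈ (z + - z) 0ᶜ (pointwise (λ i → ℚₚ.+-inverseʳ (ℜ z i)) (λ i → ℚₚ.+-inverseʳ (ℑ z i))))
          ; ⁻¹-cong = λ {z} {w} → -ᶜ-cong z w
          }
        ; comm = λ z w → ≐⇒≈ (z + w) (w + z) (pointwise (λ i → ℚₚ.+-comm (ℜ z i) (ℜ w i)) (λ i → ℚₚ.+-comm (ℑ z i) (ℑ w i)))
        }
      ; *-cong = λ {z} {z′} {w} {w′} → *ᶜ-cong z z′ w w′
      ; *-assoc = λ z w u → ≐⇒≈ ((z * w) * u) (z * (w * u)) (pointwise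
          (λ i → assocʳ (ℜ z i) (ℑ z i) (ℜ w i) (ℑ w i) (ℜ u i) (ℑ u i))
          (λ i → assocⁱ (ℜ z i) (ℑ z i) (ℜ w i) (ℑ w i) (ℜ u i) (ℑ u i)))
      ; *-identity = (λ z → ≐⇒≈ (1ᶜ * z) z (pointwise (λ i → unitʳ (ℜ z i) (ℑ z i)) (λ i → unitⁱ (ℜ z i) (ℑ z i))))
                   , (λ z → ≈-trans (z * 1ᶜ) (1ᶜ * z) z (comm z 1ᶜ)
                       (≐⇒≈ (1ᶜ * z) z (pointwise (λ i → unitʳ (ℜ z i) (ℑ z i)) (λ i → unitⁱ (ℜ z i) (ℑ z i)))))
      ; distrib = distˡ
                , (λ z w u → ≈-trans ((w + u) * z) (z * (w + u)) (w * z + u * z) (comm (w + u) z)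
                    (≈-trans (z * (w + u)) (z * w + z * u) (w * z + u * z) (distˡ z w u)
                      (+ᶜ-cong (z * w) (w * z) (z * u) (u * z) (comm z w) (comm z u))))
      }
    ; *-comm = comm
    }
    where
    assocʳ : ∀ a b c d e f →
      (a ℚ.* c ℚ.- b ℚ.* d) ℚ.* e ℚ.- (a ℚ.* d ℚ.+ b ℚ.* c) ℚ.* f
      ≡ a ℚ.* (c ℚ.* e ℚ.- d ℚ.* f) ℚ.- b ℚ.* (c ℚ.* f ℚ.+ d ℚ.* e)
    assocʳ = solve 6 (λ a b c d e f →
      (a :* c :- b :* d) :* e :- (a :* d :+ b :* c) :* f
      := a :* (c :* e :- d :* f) :- b :* (c :* f :+ d :* e)) ≡.refl
    assocⁱ : ∀ a b c d e f →
      (a ℚ.* c ℚ.- b ℚ.* d) ℚ.* f ℚ.+ (a ℚ.* d ℚ.+ b ℚ.* c) ℚ.* e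
      ≡ a ℚ.* (c ℚ.* f ℚ.+ d ℚ.* e) ℚ.+ b ℚ.* (c ℚ.* e ℚ.- d ℚ.* f)
    assocⁱ = solve 6 (λ a b c d e f →
      (a :* c :- b :* d) :* f :+ (a :* d :+ b :* c) :* e
      := a :* (c :* f :+ d :* e) :+ b :* (c :* e :- d :* f)) ≡.refl
    unitʳ : ∀ a b → 1ℚ ℚ.* a ℚ.- 0ℚ ℚ.* b ≡ a
    unitʳ = solve 2 (λ a b → con 1ℚ :* a :- con 0ℚ :* b := a) ≡.refl
    unitⁱ : ∀ a b → 1ℚ ℚ.* b ℚ.+ 0ℚ ℚ.* a ≡ b
    unitⁱ = solve 2 (λ a b → con 1ℚ :* b :+ con 0ℚ :* a := b) ≡.refl
    distʳ : ∀ a b c d e f → a ℚ.* (c ℚ.+ e) ℚ.- b ℚ.* (d ℚ.+ f)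
      ≡ (a ℚ.* c ℚ.- b ℚ.* d) ℚ.+ (a ℚ.* e ℚ.- b ℚ.* f)
    distʳ = solve 6 (λ a b c d e f → a :* (c :+ e) :- b :* (d :+ f)
      := (a :* c :- b :* d) :+ (a :* e :- b :* f)) ≡.refl
    distⁱ : ∀ a b c d e f → a ℚ.* (d ℚ.+ f) ℚ.+ b ℚ.* (c ℚ.+ e)
      ≡ (a ℚ.* d ℚ.+ b ℚ.* c) ℚ.+ (a ℚ.* f ℚ.+ b ℚ.* e)
    distⁱ = solve 6 (λ a b c d e f → a :* (d :+ f) :+ b :* (c :+ e)
      := (a :* d :+ b :* c) :+ (a :* f :+ b :* e)) ≡.refl
    distˡ : ∀ z w u → z * (w + u) ≈ z * w + z * u
    distˡ z w u = ≐⇒≈ (z * (w + u)) (z * w + z * u) (pointwise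
      (λ i → distʳ (ℜ z i) (ℑ z i) (ℜ w i) (ℑ w i) (ℜ u i) (ℑ u i))
      (λ i → distⁱ (ℜ z i) (ℑ z i) (ℜ w i) (ℑ w i) (ℜ u i) (ℑ u i)))
    commʳ : ∀ a b c d → a ℚ.* c ℚ.- b ℚ.* d ≡ c ℚ.* a ℚ.- d ℚ.* b
    commʳ = solve 4 (λ a b c d → a :* c :- b :* d := c :* a :- d :* b) ≡.refl
    commⁱ : ∀ a b c d → a ℚ.* d ℚ.+ b ℚ.* c ≡ c ℚ.* b ℚ.+ d ℚ.* a
    commⁱ = solve 4 (λ a b c d → a :* d :+ b :* c := c :* b :+ d :* a) ≡.refl
    comm : ∀ z w → z * w ≈ w * z
    comm z w = ≐⇒≈ (z * w) (w * z) (pointwise (λ i → commʳ (ℜ z i) (ℑ z i) (ℜ w i) (ℑ w i))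
                              (λ i → commⁱ (ℜ z i) (ℑ z i) (ℜ w i) (ℑ w i)))

  ℂ-commutativeRing : CommutativeRing 0ℓ 0ℓ
  ℂ-commutativeRing = record { isCommutativeRing = ℂ-isCommutativeRing }

  fromℚ-+ : ∀ p q → fromℚ (p ℚ.+ q) ≈ fromℚ p + fromℚ q
  fromℚ-+ p q = ≐⇒≈ (fromℚ (p ℚ.+ q)) (fromℚ p + fromℚ q) (pointwise (λ i → ≡.refl) (λ i → ≡.refl))

  fromℚ-* : ∀ p q → fromℚ (p ℚ.* q) ≈ fromℚ p * fromℚ q
  fromℚ-* p q = ≐⇒≈ (fromℚ (p ℚ.* q)) (fromℚ p * fromℚ q) (pointwise
    (λ i → solve 2 (λ p q → p :* q := p :* q :- con 0ℚ :* con 0ℚ) ≡.refl p q)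
    (λ i → solve 2 (λ p q → con 0ℚ := p :* con 0ℚ :+ con 0ℚ :* q) ≡.refl p q))

  -- The real part is |z|² times its reciprocal, correct from the position `N` on at which the
  -- representative of |z|² is known to be positive. The imaginary part cancels at every position.
  inv-inverse : ∀ z (z≠0 : 0ᴿ <ᴿ ∣ z ∣²) → z * inv z z≠0 ≈ 1ᶜ
  inv-inverse z (c , 0<c , N , c≤) =
      (λ ε 0<ε → N , λ i N≤i → ≡⇒close ε 0<ε (≡.trans
        (shapeʳ (ℜ z i) (ℑ z i) (recip (seq ∣ z ∣² i)))
        (recip-inverse (seq ∣ z ∣² i) (ℚₚ.<-≤-trans 0<c
          (subst (ℚ._≤ seq ∣ z ∣² i) (ℚₚ.+-identityˡ c) (c≤ i N≤i))))))
    , (λ ε 0<ε → always λ i → ≡⇒close ε 0<ε (shapeⁱ (ℜ z i) (ℑ z i) (recip (seq ∣ z ∣² i))))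
    where
    shapeʳ : ∀ a b r → a ℚ.* (a ℚ.* r) ℚ.- b ℚ.* (ℚ.- (b ℚ.* r))
                       ≡ (a ℚ.* a ℚ.+ b ℚ.* b) ℚ.* r
    shapeʳ = solve 3 (λ a b r → a :* (a :* r) :- b :* (:- (b :* r)) := (a :* a :+ b :* b) :* r) ≡.refl
    shapeⁱ : ∀ a b r → a ℚ.* (ℚ.- (b ℚ.* r)) ℚ.+ b ℚ.* (a ℚ.* r) ≡ 0ℚ
    shapeⁱ = solve 3 (λ a b r → a :* (:- (b :* r)) :+ b :* (a :* r) := con 0ℚ) ≡.refl

  infix 4 _⇝_
  _⇝_ : (ℕ → ℂ) → ℂ → Set
  s ⇝ S = ∀ ε → 0ℚ ℚ.< ε → Eventually λ n → s n - S ⊴ ε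

  ∣∣²≤⇒⊴ : ∀ z {x} → 0ℚ ℚ.≤ x → ∣ z ∣² <ᴿ fromℚᴿ (x ℚ.* x) → z ⊴ x ℚ.+ x
  ∣∣²≤⇒⊴ z {x} 0≤x (η , 0<η , h) = bound λ ε 0<ε → eventually-map (λ i l →
    ℚₚ.≤-trans (ℚₚ.+-mono-≤
      (sq-cancel-≤ {ℜ z i} 0≤x (ℚₚ.≤-trans (p≤p+q (sq-nonNeg (ℑ z i))) (ℚₚ.≤-trans (p≤p+q (ℚₚ.<⇒≤ 0<η)) l)))
      (sq-cancel-≤ {ℑ z i} 0≤x (ℚₚ.≤-trans (p≤q+p (sq-nonNeg (ℜ z i))) (ℚₚ.≤-trans (p≤p+q (ℚₚ.<⇒≤ 0<η)) l))))
      (p≤p+q (ℚₚ.<⇒≤ 0<ε))) h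
    where
    sq-nonNeg : ∀ a → 0ℚ ℚ.≤ a ℚ.* a
    sq-nonNeg a = subst (0ℚ ℚ.≤_) (∣sq∣≡ a) (*-nonNeg (ℚₚ.0≤∣p∣ a) (ℚₚ.0≤∣p∣ a))

  ⊴⇒∣∣²< : ∀ z {x} → 0ℚ ℚ.< x → z ⊴ ½ ℚ.* x → ∣ z ∣² <ᴿ fromℚᴿ ((x ℚ.+ x) ℚ.* (x ℚ.+ x))
  ⊴⇒∣∣²< z {x} 0<x z⊴½x =
    -- `x * x` is the gap that `<ᴿ` demands: eventually |z|² ≤ x², which is far enough below (2x)².
    x ℚ.* x , *-pos 0<x 0<x , eventually-map (λ i l → begin
      ℜ z i ℚ.* ℜ z i ℚ.+ ℑ z i ℚ.* ℑ z i ℚ.+ x ℚ.* x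
        ≡⟨ ≡.cong (ℚ._+ x ℚ.* x) (≡.cong₂ ℚ._+_ (≡.sym (∣sq∣≡ (ℜ z i))) (≡.sym (∣sq∣≡ (ℑ z i)))) ⟩
      A i ℚ.* A i ℚ.+ B i ℚ.* B i ℚ.+ x ℚ.* x
        ≤⟨ p≤p+q (+-nonNeg (*-nonNeg (0≤A i) (0≤B i)) (*-nonNeg (0≤A i) (0≤B i))) ⟩
      A i ℚ.* A i ℚ.+ B i ℚ.* B i ℚ.+ x ℚ.* x ℚ.+ (A i ℚ.* B i ℚ.+ A i ℚ.* B i)
        ≡⟨ shape (A i) (B i) x ⟩
      ‖ z ‖ i ℚ.* ‖ z ‖ i ℚ.+ x ℚ.* x
        ≤⟨ ℚₚ.+-monoˡ-≤ (x ℚ.* x) (*-mono-≤ (‖‖-nonNeg z i) 0≤x (l′ i l) (l′ i l)) ⟩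
      x ℚ.* x ℚ.+ x ℚ.* x
        ≤⟨ p≤p+q (+-nonNeg (*-nonNeg 0≤x 0≤x) (*-nonNeg 0≤x 0≤x)) ⟩
      x ℚ.* x ℚ.+ x ℚ.* x ℚ.+ (x ℚ.* x ℚ.+ x ℚ.* x)
        ≡⟨ solve 1 (λ x → x :* x :+ x :* x :+ (x :* x :+ x :* x) := (x :+ x) :* (x :+ x)) ≡.refl x ⟩
      (x ℚ.+ x) ℚ.* (x ℚ.+ x) ∎)
      (within z⊴½x (½ ℚ.* x) (half-pos 0<x))
    where
    open ℚₚ.≤-Reasoning
    A B : ℕ → ℚ
    A i = ℚ.∣ ℜ z i ∣
    B i = ℚ.∣ ℑ z i ∣
    0≤A : ∀ i → 0ℚ ℚ.≤ A i
    0≤A i = ℚₚ.0≤∣p∣ (ℜ z i)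
    0≤B : ∀ i → 0ℚ ℚ.≤ B i
    0≤B i = ℚₚ.0≤∣p∣ (ℑ z i)
    0≤x : 0ℚ ℚ.≤ x
    0≤x = ℚₚ.<⇒≤ 0<x
    l′ : ∀ i → ‖ z ‖ i ℚ.≤ ½ ℚ.* x ℚ.+ ½ ℚ.* x → ‖ z ‖ i ℚ.≤ x
    l′ i = subst (‖ z ‖ i ℚ.≤_) (half-half x)
    shape : ∀ a b x → a ℚ.* a ℚ.+ b ℚ.* b ℚ.+ x ℚ.* x ℚ.+ (a ℚ.* b ℚ.+ a ℚ.* b)
                      ≡ (a ℚ.+ b) ℚ.* (a ℚ.+ b) ℚ.+ x ℚ.* x
    shape = solve 3 (λ a b x → a :* a :+ b :* b :+ x :* x :+ (a :* b :+ a :* b)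
                                 := (a :+ b) :* (a :+ b) :+ x :* x) ≡.refl

  ⟶⇒⇝ : ∀ {s S} → s ⟶ S → s ⇝ S
  ⟶⇒⇝ {s} {S} h ε 0<ε = eventually-map
    (λ n l → subst (s n - S ⊴_) (half-half ε) (∣∣²≤⇒⊴ (s n - S) (ℚₚ.<⇒≤ (half-pos 0<ε)) l))
    (h (½ ℚ.* ε) (half-pos 0<ε))

  ⇝⇒⟶ : ∀ {s S} → s ⇝ S → s ⟶ S
  ⇝⇒⟶ {s} {S} h ε 0<ε = eventually-map
    (λ n l → subst (λ x → ∣ s n - S ∣² <ᴿ fromℚᴿ (x ℚ.* x)) (half-half ε)
               (⊴⇒∣∣²< (s n - S) (half-pos 0<ε) l))
    (h (½ ℚ.* (½ ℚ.* ε)) (half-pos (half-pos 0<ε)))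

  ⊴-separated : ∀ z w → (∀ ε → 0ℚ ℚ.< ε → z - w ⊴ ε) → z ≈ w
  ⊴-separated z w h = ⊴0⇒≈ z w (bound λ ε 0<ε → eventually-map
    (λ i → subst (‖ z - w ‖ i ℚ.≤_) (≡.trans (half-half ε) (≡.sym (ℚₚ.+-identityˡ ε))))
    (within (h (½ ℚ.* ε) (half-pos 0<ε)) (½ ℚ.* ε) (half-pos 0<ε)))

  ⊴-contraction : ∀ {α} z a c → z ≈ a + c * z → a ⊴ α → c ⊴ ½ ℚ.* ½ → z ⊴ α ℚ.+ α
  ⊴-contraction {α} z a c e a⊴α c⊴¼ = bound λ ε 0<ε →
    -- The errors of `e` and of `a` amount to 2δ; absorbing half of the norm doubles them to 4δ = ε.
    let δ = ½ ℚ.* (½ ℚ.* ε)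
        0<δ = half-pos (half-pos 0<ε)
    in eventually-map₂ (λ i l (m , k) → ℚₚ.≤-trans (≤½⇒≤2 {y = α ℚ.+ (δ ℚ.+ δ)} (begin
         ‖ z ‖ i
           ≡⟨ ‖‖-cong z-split i ⟩
         ‖ (z - (a + c * z)) + (a + c * z) ‖ i
           ≤⟨ ℚₚ.≤-trans (‖+‖ (z - (a + c * z)) (a + c * z) i)
                (ℚₚ.+-monoʳ-≤ (‖ z - (a + c * z) ‖ i) (‖+‖ a (c * z) i)) ⟩
         ‖ z - (a + c * z) ‖ i ℚ.+ (‖ a ‖ i ℚ.+ ‖ c * z ‖ i)
           ≤⟨ ℚₚ.+-mono-≤ l (ℚₚ.+-mono-≤ m (ℚₚ.≤-trans (‖*‖ c z i)
                (ℚₚ.*-monoʳ-≤-nonNeg (‖ z ‖ i) {{ℚ.nonNegative (‖‖-nonNeg z i)}} k))) ⟩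
         (0ℚ ℚ.+ δ) ℚ.+ ((α ℚ.+ δ) ℚ.+ (½ ℚ.* ½ ℚ.+ ½ ℚ.* ½) ℚ.* ‖ z ‖ i)
           ≡⟨ shape δ α (‖ z ‖ i) ⟩
         (α ℚ.+ (δ ℚ.+ δ)) ℚ.+ ½ ℚ.* ‖ z ‖ i ∎))
         (ℚₚ.≤-reflexive (≡.trans (interchange α (δ ℚ.+ δ) α (δ ℚ.+ δ))
           (≡.cong (α ℚ.+ α ℚ.+_) (≡.trans (≡.cong₂ ℚ._+_ (half-half (½ ℚ.* ε)) (half-half (½ ℚ.* ε)))
                                        (half-half ε))))))
       (within (≈⇒⊴0 z (a + c * z) e) δ 0<δ)
       (eventually-map₂ (λ _ → _,_) (within a⊴α δ 0<δ)
                                    (within c⊴¼ (½ ℚ.* ½) (half-pos (ℚₚ.positive⁻¹ ½))))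
    where
    open ℚₚ.≤-Reasoning
    z-split : z ≐ (z - (a + c * z)) + (a + c * z)
    z-split = pointwise (λ i → split (ℜ z i) (ℜ (a + c * z) i)) (λ i → split (ℑ z i) (ℑ (a + c * z) i))
    shape : ∀ d a x → (0ℚ ℚ.+ d) ℚ.+ ((a ℚ.+ d) ℚ.+ ½ ℚ.* x) ≡ (a ℚ.+ (d ℚ.+ d)) ℚ.+ ½ ℚ.* x
    shape = solve 3 (λ d a x → (con 0ℚ :+ d) :+ ((a :+ d) :+ con ½ :* x)
                               := (a :+ (d :+ d)) :+ con ½ :* x) ≡.refl

  dist : ℂ → ℕ → ℂ → ℕ → ℚ
  dist z i w k = ℚ.∣ ℜ z i ℚ.- ℜ w k ∣ ℚ.+ ℚ.∣ ℑ z i ℚ.- ℑ w k ∣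

  dist-sym : ∀ z i w k → dist z i w k ≡ dist w k z i
  dist-sym z i w k = ≡.cong₂ ℚ._+_ (∣-∣-comm (ℜ z i) (ℜ w k)) (∣-∣-comm (ℑ z i) (ℑ w k))

  dist-triangle : ∀ z i w k u l → dist z i u l ℚ.≤ dist z i w k ℚ.+ dist w k u l
  dist-triangle z i w k u l = ℚₚ.≤-trans
    (ℚₚ.+-mono-≤ (triangle (ℜ z i) (ℜ w k) (ℜ u l)) (triangle (ℑ z i) (ℑ w k) (ℑ u l)))
    (ℚₚ.≤-reflexive (interchange ℚ.∣ ℜ z i ℚ.- ℜ w k ∣ ℚ.∣ ℜ w k ℚ.- ℜ u l ∣
                                 ℚ.∣ ℑ z i ℚ.- ℑ w k ∣ ℚ.∣ ℑ w k ℚ.- ℑ u l ∣))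
    where
    telescope : ∀ a b c → (a ℚ.- b) ℚ.+ (b ℚ.- c) ≡ a ℚ.- c
    telescope = solve 3 (λ a b c → (a :- b) :+ (b :- c) := a :- c) ≡.refl
    triangle : ∀ a b c → ℚ.∣ a ℚ.- c ∣ ℚ.≤ ℚ.∣ a ℚ.- b ∣ ℚ.+ ℚ.∣ b ℚ.- c ∣
    triangle a b c = subst (λ x → ℚ.∣ x ∣ ℚ.≤ ℚ.∣ a ℚ.- b ∣ ℚ.+ ℚ.∣ b ℚ.- c ∣) (telescope a b c)
      (ℚₚ.∣p+q∣≤∣p∣+∣q∣ (a ℚ.- b) (b ℚ.- c))

  self-dist : ∀ z ε → 0ℚ ℚ.< ε → ∃ λ K → ∀ i → K ≤ i → dist z i z K ℚ.≤ ε
  self-dist z ε 0<ε =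
    let M , p = cauchy (re z) (½ ℚ.* ε) (half-pos 0<ε)
        N , q = cauchy (im z) (½ ℚ.* ε) (half-pos 0<ε)
    in M ⊔ N , λ i l → subst (dist z i z (M ⊔ N) ℚ.≤_) (half-half ε) (ℚₚ.+-mono-≤
         (ℚₚ.<⇒≤ (p i (M ⊔ N) (ℕₚ.m⊔n≤o⇒m≤o M N l) (ℕₚ.m≤m⊔n M N)))
         (ℚₚ.<⇒≤ (q i (M ⊔ N) (ℕₚ.m⊔n≤o⇒n≤o M N l) (ℕₚ.m≤n⊔m M N))))

  -- A diagonal construction: the j-th rational of the limit is a term `w j` of the sequence, far
  -- enough out that its tail is within `ρ j`, read at a position `K j` after which its
  -- representative moves by at most `ρ j`.
  module _ (s : ℕ → ℂ) (β : ℕ → ℚ)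
           (β→0 : ∀ ε → 0ℚ ℚ.< ε → Eventually λ n → β n ℚ.≤ ε)
           (tail : ∀ N n → N ≤ n → s n - s N ⊴ β N) where

    private
      N K : ℕ → ℕ
      N j = proj₁ (β→0 (ρ j) (ρ-pos j))
      w : ℕ → ℂ
      w j = s (N j)
      K j = proj₁ (self-dist (w j) (ρ j) (ρ-pos j))
      τ : ℕ → ℚ
      -- One `ρ j` each for the tail of the sequence, for the margin in `⊴` and for reading `w j` at
      -- `K j`.
      τ j = ρ j ℚ.+ ρ j ℚ.+ ρ j

      τ≤ : ∀ ε → 0ℚ ℚ.< ε → Eventually λ j → τ j ℚ.≤ ε
      τ≤ ε 0<ε = eventually-map (λ j l → begin
          τ j                                     ≤⟨ ℚₚ.+-mono-≤ (ℚₚ.+-mono-≤ l l) l ⟩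
          δ ℚ.+ δ ℚ.+ δ                           ≤⟨ ℚₚ.+-monoʳ-≤ (δ ℚ.+ δ) (p≤p+q (ℚₚ.<⇒≤ 0<δ)) ⟩
          δ ℚ.+ δ ℚ.+ (δ ℚ.+ δ)                   ≡⟨ ≡.cong₂ ℚ._+_ (half-half (½ ℚ.* ε)) (half-half (½ ℚ.* ε)) ⟩
          ½ ℚ.* ε ℚ.+ ½ ℚ.* ε                     ≡⟨ half-half ε ⟩
          ε                                       ∎)
        (ρ≤ δ 0<δ)
        where
        open ℚₚ.≤-Reasoning
        δ = ½ ℚ.* (½ ℚ.* ε)
        0<δ = half-pos (half-pos 0<ε)

      near : ∀ j n → N j ≤ n → Eventually λ i → dist (s n) i (w j) (K j) ℚ.≤ τ j
      near j n l = eventually-map₂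
        (λ i p q → ℚₚ.≤-trans (dist-triangle (s n) i (w j) i (w j) (K j)) (ℚₚ.+-mono-≤
          (ℚₚ.≤-trans p (ℚₚ.+-monoˡ-≤ (ρ j) (proj₂ (β→0 (ρ j) (ρ-pos j)) (N j) ℕₚ.≤-refl))) q))
        (within (tail (N j) n l) (ρ j) (ρ-pos j))
        (K j , proj₂ (self-dist (w j) (ρ j) (ρ-pos j)))

      -- Both entries are compared with a common later term `s n` at a far position. The conclusion
      -- does not mention that position, so the threshold itself can be taken.
      diagonal-close : ∀ j k → dist (w j) (K j) (w k) (K k) ℚ.≤ τ j ℚ.+ τ k
      diagonal-close j k = proj₂ both (proj₁ both) ℕₚ.≤-refl
        where
        n = N j ⊔ N k
        both : Eventually λ _ → dist (w j) (K j) (w k) (K k) ℚ.≤ τ j ℚ.+ τ k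
        both = eventually-map₂
          (λ i p q → ℚₚ.≤-trans (dist-triangle (w j) (K j) (s n) i (w k) (K k))
            (ℚₚ.+-mono-≤ (subst (ℚ._≤ τ j) (dist-sym (s n) i (w j) (K j)) p) q))
          (near j n (ℕₚ.m≤m⊔n (N j) (N k))) (near k n (ℕₚ.m≤n⊔m (N j) (N k)))

      diagonal-cauchy : ∀ ε → 0ℚ ℚ.< ε → ∃ λ J → ∀ j k → J ≤ j → J ≤ k →
                        dist (w j) (K j) (w k) (K k) ℚ.< ε
      diagonal-cauchy ε 0<ε =
        let J , h = τ≤ (½ ℚ.* (½ ℚ.* ε)) (half-pos (half-pos 0<ε))
        in J , λ j k lj lk → ℚₚ.≤-<-trans (ℚₚ.≤-trans (diagonal-close j k)
          (subst (τ j ℚ.+ τ k ℚ.≤_) (half-half (½ ℚ.* ε)) (ℚₚ.+-mono-≤ (h j lj) (h k lk))))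
          (half<self 0<ε)

      abstract
        re-cauchy : IsCauchy (λ j → ℜ (w j) (K j))
        re-cauchy ε 0<ε =
          let J , h = diagonal-cauchy ε 0<ε in J , λ j k lj lk → ℚₚ.≤-<-trans
          (p≤p+q (ℚₚ.0≤∣p∣ (ℑ (w j) (K j) ℚ.- ℑ (w k) (K k)))) (h j k lj lk)

        im-cauchy : IsCauchy (λ j → ℑ (w j) (K j))
        im-cauchy ε 0<ε =
          let J , h = diagonal-cauchy ε 0<ε in J , λ j k lj lk → ℚₚ.≤-<-trans
          (p≤q+p (ℚₚ.0≤∣p∣ (ℜ (w j) (K j) ℚ.- ℜ (w k) (K k)))) (h j k lj lk)

      limit : ℂ
      limit = mkℝ (λ j → ℜ (w j) (K j)) re-cauchy +i mkℝ (λ j → ℑ (w j) (K j)) im-cauchy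

    complete : ∃ λ S → s ⇝ S
    complete = limit , λ ε 0<ε →
      let δ = ½ ℚ.* (½ ℚ.* ε)
          0<δ = half-pos (half-pos 0<ε)
          J , h = τ≤ δ 0<δ
      in N J , λ n l → bound λ ε′ 0<ε′ → eventually-map₂ (λ i p J≤i → begin
           dist (s n) i (w i) (K i)
             ≤⟨ dist-triangle (s n) i (w J) (K J) (w i) (K i) ⟩
           dist (s n) i (w J) (K J) ℚ.+ dist (w J) (K J) (w i) (K i)
             ≤⟨ ℚₚ.+-mono-≤ p (diagonal-close J i) ⟩
           τ J ℚ.+ (τ J ℚ.+ τ i)
             ≤⟨ ℚₚ.+-mono-≤ (ℚₚ.≤-trans (h J ℕₚ.≤-refl) (p≤p+q (ℚₚ.<⇒≤ 0<δ)))
                            (ℚₚ.+-mono-≤ (h J ℕₚ.≤-refl) (h i J≤i)) ⟩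
           δ ℚ.+ δ ℚ.+ (δ ℚ.+ δ)
             ≡⟨ ≡.trans (≡.cong₂ ℚ._+_ (half-half (½ ℚ.* ε)) (half-half (½ ℚ.* ε))) (half-half ε) ⟩
           ε
             ≤⟨ p≤p+q (ℚₚ.<⇒≤ 0<ε′) ⟩
           ε ℚ.+ ε′ ∎)
         (near J n l) (J , λ i J≤i → J≤i)
      where open ℚₚ.≤-Reasoning

ℂ-normedRing : NormedRing
ℂ-normedRing = record
  { commutativeRing = ℂ-commutativeRing
  ; _⊴ᵣ_        = _⊴_
  ; resp        = λ {z} {w} → ⊴-resp z w
  ; mono        = ⊴-mono
  ; +-bound     = ⊴-+
  ; *-bound     = ⊴-*
  ; neg-bound   = ⊴-neg
  ; bounds      = ⊴-bound
  ; separated   = λ {z} {w} → ⊴-separated z w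
  ; contraction = λ {z} {a} {c} → ⊴-contraction z a c
  ; rational    = fromℚ
  ; rational-*  = fromℚ-*
  ; rational-+  = fromℚ-+
  ; rational-0  = ℂR.refl {0ᶜ}
  ; rational-1  = ℂR.refl {1ᶜ}
  ; rational-⊴  = ⊴-fromℚ
  ; converges   = complete
  }
  where module ℂR = CommutativeRing ℂ-commutativeRing

-- The series over ℂ and its convergence.

open ℂ∖ℤ≥1

q : ℂ∖ℤ≥1 → ℕ → ℂ
q z n = inv (fromℕ (suc n) - val z) (apart z n)

q-inverse : ∀ z n → (fromℕ (suc n) - val z) * q z n ≈ 1ᶜ
q-inverse z n = inv-inverse (fromℕ (suc n) - val z) (apart z n)

module ℂS = Sequences ℂ-commutativeRing
module ℂE = Estimates ℂ-normedRing
module ℂL = Limits ℂ-normedRing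

abstract
  q-bound : ∀ z → ∃ (ℂE.HarmonicBound (q z))
  q-bound z = ℂE.harmonicBound (q z) (val z)
    (Resolvent.q≈r+lrq ℂ-normedRing (val z) (q z) (q-inverse z))

truncated≈act : ∀ z u N →
  truncated z (exponents (u ++ Y ∷ [])) N ≈ ℂS.Σ≤ (ℂS.act ℂE.r (q z) (u ++ Y ∷ []) ℂS.δ₀) N
truncated≈act z = TruncatedSums.T-exponents ℂ-commutativeRing ℂE.r (q z) (truncated z)
  (λ N → ≡.refl) (λ a as → ≡.refl) (λ a as N → ≡.refl)

-- The leading x is decisive: the rest of the word gives entries of order n^(-1/2), and dividing
-- them by n makes them summable.
series-converges : ∀ w → Admissible w → ∀ z → ∃ λ S → w HasSum[ z ] S
series-converges w (u , ≡.refl) z =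
  proj₁ limit , ⇝⇒⟶ {truncated z (exponents w)} {proj₁ limit} (ℂL.⇝-cong {s} {truncated z (exponents w)} {proj₁ limit}
    (λ N → ≈-sym (truncated z (exponents w) N) (s N) (truncated≈act z (X ∷ u) N)) (proj₂ limit))
  where
  s : ℕ → ℂ
  s = ℂS.Σ≤ (ℂS.act ℂE.r (q z) w ℂS.δ₀)
  limit : ∃ λ S → s ⇝ S
  limit = ℂE.Σ≤-mulTail-converges (ℂE.act-moderate (proj₂ (q-bound z)) (u ++ Y ∷ []) ℂE.δ₀-moderate)

-- The four equations for f.

module _ (F : Word → ℂ∖ℤ≥1 → ℂ) (series : IsSeries F) where

  act-limit : ∀ z w → Admissible w → ℂS.Σ≤ (ℂS.act ℂE.r (q z) w ℂS.δ₀) ⇝ F w z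
  act-limit z w adm@(u , ≡.refl) = ℂL.⇝-cong {s = truncated z (exponents w)} {S = F w z}
    (truncated≈act z (X ∷ u)) (⟶⇒⇝ {S = F w z} (series w adm z))

  module _ (z : ℂ∖ℤ≥1) where

    open ShiftedResolvent.From ℂ-normedRing (val z) (q z) (q (pred z)) (q-inverse z) (q-inverse (pred z))
    open PowerSequences ℂ-commutativeRing

    module At = Equations.Shifted ℂ-normedRing (q z) (q (pred z)) (- val z) (- val (pred z))
      (Resolvent.q≈r ℂ-normedRing (val z) (q z) (q-inverse z)) q⁺≈r q₀ q′≈q
      (proj₂ (q-bound z)) (proj₂ (q-bound (pred z)))
      (λ w → F w z) (λ w → F w (pred z)) (act-limit z) (act-limit (pred z))
      (powers (- val z))
      (zpowers (- val (pred z)) (inv (- val (pred z)) (-pred≠0 z)) (inv-inverse (- val (pred z)) (-pred≠0 z))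
        (zpow (- val (pred z)) (-pred≠0 z)) (λ n → ≡.refl) (λ n → ≡.refl))
      (reciprocal≈q₀ {inv (- val (pred z)) (-pred≠0 z)} (inv-inverse (- val (pred z)) (-pred≠0 z)))

    -- The operator argument presents `l` by its first entry on the left-hand side and by its last
    -- entry on the right-hand side. The transport acts on the right-hand side alone, to give both
    -- the same form.
    equation-i : ∀ {n} k₁ (ks : Vec ℕ n) l₁ ls ls⁻ lₘ → l₁ ∷ ls ≡ ls⁻ ∷ʳ suc lₘ → 1 ≤ k₁ →
      Equation-i (f F) (map suc (k₁ ∷ ks)) (map suc (l₁ ∷ ls)) z
    equation-i {n} k₁ ks l₁ ls ls⁻ lₘ e 1≤k₁ = subst
      (λ l → ∑[ p ∈ I^ (suc n) ] termˡ (f F) (map suc (k₁ ∷ ks)) (map suc (l₁ ∷ ls)) z (δs p) (εs p)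
        ≈ ∑[ δ₁ ∈ O ] ∑[ p ∈ I^ n ] ∑[ ε ∈ O ]
            termʳ (f F) (map suc (k₁ ∷ ks)) (map suc l) z (δ₁ ∷ δs p) (εs p ∷ʳ ε))
      (≡.sym e) (At.equation-i k₁ ks l₁ ls ls⁻ lₘ e 1≤k₁)

    equation-ii : ∀ {n} (ks : Vec ℕ n) l₁ ls ls⁻ lₘ → l₁ ∷ ls ≡ ls⁻ ∷ʳ suc lₘ →
      Equation-ii (f F) (map suc (0 ∷ ks)) (map suc (l₁ ∷ ls)) z
    equation-ii {n} ks l₁ ls ls⁻ lₘ e = subst
      (λ l → ∑[ ε₁ ∈ O ] ∑[ p ∈ I^ n ]
               termˡ (f F) (map suc (0 ∷ ks)) (map suc (l₁ ∷ ls)) z (0 ∷ δs p) (ε₁ ∷ εs p)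
        ≈ ∑[ p ∈ I^ n ] ∑[ ε ∈ O ] termʳ (f F) (map suc (0 ∷ ks)) (map suc l) z (0 ∷ δs p) (εs p ∷ʳ ε))
      (≡.sym e) (At.equation-ii ks l₁ ls ls⁻ lₘ e)

    equation-iii : ∀ {n} k₁ (ks ks⁻ : Vec ℕ n) kₘ ls → ks⁻ ∷ʳ kₘ ≡ k₁ ∷ ks → 1 ≤ k₁ →
      Equation-iii (f F) (map suc (k₁ ∷ ks)) (map suc (ls ∷ʳ 0)) z
    equation-iii {n} k₁ ks ks⁻ kₘ ls e 1≤k₁ = subst
      (λ k → ∑[ p ∈ I^ n ] ∑[ δₘ ∈ O ] termˡ (f F) (map suc k) (map suc (ls ∷ʳ 0)) z (δs p ∷ʳ δₘ) (εs p ∷ʳ 0)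
        ≈ ∑[ δ₁ ∈ O ] ∑[ p ∈ I^ n ]
            termʳ (f F) (map suc (k₁ ∷ ks)) (map suc (ls ∷ʳ 0)) z (δ₁ ∷ δs p) (εs p ∷ʳ 0))
      e (At.equation-iii k₁ ks ks⁻ kₘ ls e 1≤k₁)

    equation-iv : ∀ {n} k₂ (ks ks⁻ : Vec ℕ n) kₘ l₁ ls → ks⁻ ∷ʳ kₘ ≡ k₂ ∷ ks →
      Equation-iv (f F) (map suc (0 ∷ k₂ ∷ ks)) (map suc (l₁ ∷ (ls ∷ʳ 0))) z
    equation-iv {n} k₂ ks ks⁻ kₘ l₁ ls e = subst
      (λ k → ∑[ ε₁ ∈ O ] ∑[ p ∈ I^ n ] ∑[ δₘ ∈ O ]
               termˡ (f F) (map suc (0 ∷ k)) (map suc (l₁ ∷ (ls ∷ʳ 0))) z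
                     (0 ∷ (δs p ∷ʳ δₘ)) (ε₁ ∷ (εs p ∷ʳ 0))
        ≈ ∑[ p ∈ I^ (suc n) ]
            termʳ (f F) (map suc (0 ∷ k₂ ∷ ks)) (map suc (l₁ ∷ (ls ∷ʳ 0))) z (0 ∷ δs p) (εs p ∷ʳ 0))
      e (At.equation-iv k₂ ks ks⁻ kₘ l₁ ls e)

-- Passing to predecessors makes k₁ = 1 and lₘ = 1 matches on `zero`, and gives every shortened
-- exponent the form `suc k ∸ δ`.
predecessors : ∀ {n} {k : Vec ℕ n} → All (1 ≤_) k → ∃ λ k′ → k ≡ map suc k′
predecessors []                     = [] , ≡.refl
predecessors (s≤s {n = x} z≤n ∷ ps) = let k′ , e = predecessors ps in x ∷ k′ , ≡.cong (suc x ∷_) e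

last-map-suc : ∀ {n} (ls⁻ : Vec ℕ n) {x lₘ} {xs : Vec ℕ n} → x ∷ xs ≡ ls⁻ ∷ʳ lₘ →
               last (map suc (x ∷ xs)) ≡ suc lₘ
last-map-suc ls⁻ {lₘ = lₘ} e = ≡.trans (≡.cong (λ v → last (map suc v)) e)
  (≡.trans (≡.cong last (Vecₚ.map-∷ʳ suc lₘ ls⁻)) (Vecₚ.last-∷ʳ (suc lₘ) (map suc ls⁻)))

EquationsFor : (Word → ℂ∖ℤ≥1 → ℂ) → ∀ {n} → Vec ℕ (suc n) → Vec ℕ (suc n) → ℂ∖ℤ≥1 → Set
EquationsFor F k l z =
    (head k ≢ 1 → last l ≢ 1 → Equation-i   (f F) k l z)
  × (head k ≡ 1 → last l ≢ 1 → Equation-ii  (f F) k l z)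
  × (head k ≢ 1 → last l ≡ 1 → Equation-iii (f F) k l z)

module _ (F : Word → ℂ∖ℤ≥1 → ℂ) (series : IsSeries F) where

  -- The four combinations of `zero` and `suc` for k₁ and lₘ select the case; equations with
  -- incompatible hypotheses hold vacuously.
  equations : ∀ {n} k₁ (ks : Vec ℕ n) l₁ ls z ls⁻ lₘ → l₁ ∷ ls ≡ ls⁻ ∷ʳ lₘ →
              EquationsFor F (map suc (k₁ ∷ ks)) (map suc (l₁ ∷ ls)) z
  equations zero     ks l₁ ls z ls⁻ zero     e =
      (λ k≢1 _ → contradiction ≡.refl k≢1)
    , (λ _ l≢1 → contradiction (last-map-suc ls⁻ e) l≢1)
    , (λ k≢1 _ → contradiction ≡.refl k≢1)
  equations zero     ks l₁ ls z ls⁻ (suc lₘ) e =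
      (λ k≢1 _ → contradiction ≡.refl k≢1)
    , (λ _ _ → equation-ii F series z ks l₁ ls ls⁻ lₘ e)
    , (λ k≢1 _ → contradiction ≡.refl k≢1)
  equations (suc k₁) ks l₁ ls z ls⁻ zero     e =
      (λ _ l≢1 → contradiction (last-map-suc ls⁻ e) l≢1)
    , (λ ())
    , (λ _ _ → let ks⁻ , kₘ , e′ = initLast (suc k₁ ∷ ks) in
        subst (λ l → Equation-iii (f F) (map suc (suc k₁ ∷ ks)) (map suc l) z) (≡.sym e)
          (equation-iii F series z (suc k₁) ks ks⁻ kₘ ls⁻ (≡.sym e′) (s≤s z≤n)))
  equations (suc k₁) ks l₁ ls z ls⁻ (suc lₘ) e =
      (λ _ _ → equation-i F series z (suc k₁) ks l₁ ls ls⁻ lₘ e (s≤s z≤n))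
    , (λ ())
    , (λ _ l≡1 → contradiction (≡.trans (≡.sym l≡1) (last-map-suc ls⁻ e)) λ ())

  equations-iv : ∀ {n} k₁ k₂ (ks : Vec ℕ n) l₁ l₂ ls z ls⁻ lₘ → l₂ ∷ ls ≡ ls⁻ ∷ʳ lₘ →
    let k = map suc (k₁ ∷ k₂ ∷ ks) ; l = map suc (l₁ ∷ l₂ ∷ ls) in
    head k ≡ 1 → last l ≡ 1 → Equation-iv (f F) k l z
  equations-iv zero k₂ ks l₁ l₂ ls z ls⁻ zero     e ≡.refl l≡1 =
    let ks⁻ , kₘ , e′ = initLast (k₂ ∷ ks) in
    subst (λ l → Equation-iv (f F) (map suc (0 ∷ k₂ ∷ ks)) (map suc (l₁ ∷ l)) z) (≡.sym e)
      (equation-iv F series z k₂ ks ks⁻ kₘ l₁ ls⁻ (≡.sym e′))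
  equations-iv zero k₂ ks l₁ l₂ ls z ls⁻ (suc lₘ) e ≡.refl l≡1 =
    contradiction (≡.trans (≡.sym l≡1) (last-map-suc (l₁ ∷ ls⁻) (≡.cong (l₁ ∷_) e))) λ ()

  difference-f : DifferenceEquations (f F)
  difference-f = first , second
    where
    first : ∀ n (k l : Vec ℕ (suc n)) → All (1 ≤_) k → All (1 ≤_) l → ∀ z → EquationsFor F k l z
    first n k l k≥1 l≥1 z = go (predecessors k≥1) (predecessors l≥1)
      where
      go : (∃ λ k′ → k ≡ map suc k′) → (∃ λ l′ → l ≡ map suc l′) → EquationsFor F k l z
      go (k₁ ∷ ks , e) (l₁ ∷ ls , e′) = let ls⁻ , lₘ , e″ = initLast (l₁ ∷ ls) in
        ≡.subst₂ (λ k l → EquationsFor F k l z) (≡.sym e) (≡.sym e′) (equations k₁ ks l₁ ls z ls⁻ lₘ e″)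
    second : ∀ n (k l : Vec ℕ (suc (suc n))) → All (1 ≤_) k → All (1 ≤_) l → ∀ z →
             head k ≡ 1 → last l ≡ 1 → Equation-iv (f F) k l z
    second n k l k≥1 l≥1 z = go (predecessors k≥1) (predecessors l≥1)
      where
      go : (∃ λ k′ → k ≡ map suc k′) → (∃ λ l′ → l ≡ map suc l′) →
           head k ≡ 1 → last l ≡ 1 → Equation-iv (f F) k l z
      go (k₁ ∷ k₂ ∷ ks , e) (l₁ ∷ l₂ ∷ ls , e′) = let ls⁻ , lₘ , e″ = initLast (l₂ ∷ ls) in
        ≡.subst₂ (λ k l → head k ≡ 1 → last l ≡ 1 → Equation-iv (f F) k l z) (≡.sym e) (≡.sym e′)
          (equations-iv k₁ k₂ ks l₁ l₂ ls z ls⁻ lₘ e″)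

-- Transfer from f to g.

module _ (F : Word → ℂ∖ℤ≥1 → ℂ) where

  open Reflection ℂ-commutativeRing

  reverse-shorten : ∀ {m} (k l δ ε : Vec ℕ m) →
    word (reverse (zipWith _∸_ l ε)) (reverse (zipWith _∸_ k δ)) ≡ shorten (reverse l) (reverse k) (reverse ε) (reverse δ)
  reverse-shorten k l δ ε = ≡.cong₂ word (zipWith-reverse _∸_ l ε) (zipWith-reverse _∸_ k δ)

  reverse-sums : ∀ {m} (δ ε : Vec ℕ m) → sum δ ℕ.+ sum ε ≡ sum (reverse ε) ℕ.+ sum (reverse δ)
  reverse-sums δ ε = ≡.trans (ℕₚ.+-comm (sum δ) (sum ε))
    (≡.cong₂ ℕ._+_ (≡.sym (sum-reverse ε)) (≡.sym (sum-reverse δ)))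

  module _ {m} (k l : Vec ℕ m) (z : ℂ∖ℤ≥1) where

    termˡ-reverse : ∀ δ ε → termˡ (g F) k l z δ ε ≡ termˡ (f F) (reverse l) (reverse k) z (reverse ε) (reverse δ)
    termˡ-reverse δ ε = ≡.cong₂ (λ s w → (- val z) ^ (m ∸ s) * F w z) (reverse-sums δ ε) (reverse-shorten k l δ ε)

    termʳ-reverse : ∀ δ ε → termʳ (g F) k l z δ ε ≡ termʳ (f F) (reverse l) (reverse k) z (reverse ε) (reverse δ)
    termʳ-reverse δ ε = ≡.cong₂
      (λ s w → zpow (- val (pred z)) (-pred≠0 z) (ℤ.+ m ℤ.- ℤ.+ s) * F w (pred z))
      (reverse-sums δ ε) (reverse-shorten k l δ ε)

  head-reverse : ∀ {n} (xs : Vec ℕ (suc n)) → head (reverse xs) ≡ last xs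
  head-reverse xs = ≡.trans (≡.sym (Vecₚ.last-reverse (reverse xs))) (≡.cong last (Vecₚ.reverse-involutive xs))

  -- For the reversed vectors the head is lₘ and the last entry is k₁, so the conditions k₁ = 1 and
  -- lₘ = 1 trade places: (ii) for g comes from (iii) for f and conversely, while (i) and (iv)
  -- correspond to themselves.
  difference-g : DifferenceEquations (f F) → DifferenceEquations (g F)
  difference-g (first , second) =
      (λ n k l k≥1 l≥1 z →
        let i , ii , iii = first n (reverse l) (reverse k) (All-reverse l≥1) (All-reverse k≥1) z in
          (λ k≢1 l≢1 → reflected-i (termˡ (g F) k l z) (termˡ (f F) (reverse l) (reverse k) z)
            (termʳ (g F) k l z) (termʳ (f F) (reverse l) (reverse k) z) (termˡ-reverse k l z) (termʳ-reverse k l z)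
            (i (λ e → l≢1 (≡.trans (≡.sym (head-reverse l)) e)) (λ e → k≢1 (≡.trans (≡.sym (Vecₚ.last-reverse k)) e))))
        , (λ k≡1 l≢1 → reflected-ii (termˡ (g F) k l z) (termˡ (f F) (reverse l) (reverse k) z)
            (termʳ (g F) k l z) (termʳ (f F) (reverse l) (reverse k) z) (termˡ-reverse k l z) (termʳ-reverse k l z)
            (iii (λ e → l≢1 (≡.trans (≡.sym (head-reverse l)) e)) (≡.trans (Vecₚ.last-reverse k) k≡1)))
        , (λ k≢1 l≡1 → reflected-iii (termˡ (g F) k l z) (termˡ (f F) (reverse l) (reverse k) z)
            (termʳ (g F) k l z) (termʳ (f F) (reverse l) (reverse k) z) (termˡ-reverse k l z) (termʳ-reverse k l z)
            (ii (≡.trans (head-reverse l) l≡1) (λ e → k≢1 (≡.trans (≡.sym (Vecₚ.last-reverse k)) e)))))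
    , (λ n k l k≥1 l≥1 z k≡1 l≡1 → reflected-iv (termˡ (g F) k l z) (termˡ (f F) (reverse l) (reverse k) z)
        (termʳ (g F) k l z) (termʳ (f F) (reverse l) (reverse k) z) (termˡ-reverse k l z) (termʳ-reverse k l z)
        (second n (reverse l) (reverse k) (All-reverse l≥1) (All-reverse k≥1) z
          (≡.trans (head-reverse l) l≡1) (≡.trans (Vecₚ.last-reverse k) k≡1)))

theorem3p1 : (∀ w → Admissible w → ∀ z → ∃ λ S → w HasSum[ z ] S)
    × (∀ (F : Word → ℂ∖ℤ≥1 → ℂ) → IsSeries F →
    DifferenceEquations (f F) × DifferenceEquations (g F))
theorem3p1 = series-converges , λ F series →
  difference-f F series , difference-g F (difference-f F series)
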